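{- Let $d=d(n)$ be a positive integer depending on the positive integer $n$; asymptotic statements refer to $n\to\infty$. (a) If $d>n^3/2$, then $$1\leq \frac{p_d(n)}{\binom{d+n-2}{d-1}}<\frac{1}{1-\frac{n^3}{2d}}.$$ (b) If $d n^{ -2}\to\infty$ as $n\to\infty$, then $\log p_d(n)=(n-1)(\log d-\log n+1)+o(n)$. (c) If $cn^2\leq d\leq Cn^2$ for some positive constants $c$ and $C$, then $\log p_d(n)=n\log n+O(n)$. (d) If $d n^{ -2}\to 0$ and $\log d\geq \log n+o(\log n)$ as $n\to\infty$, then $\log p_d(n)=n\log n+o(n\log n)$.
   Context: Let $\mathbb{Z}_+=\{0,1,2,\dots\}$. A set $S\subset\mathbb{Z}_+^d$ is a lower set if whenever $\mathbf{x}\in S$ and $\mathbf{x}'\in\mathbb{Z}_+^d$ satisfies $x'_i\leq x_i$ for all $i$, then $\mathbf{x}'\in S$. For positive integers $d,n$, $p_d(n)$ denotes the number of lower sets in $\mathbb{Z}_+^d$ with exactly $n$ points. $\log$ is the natural logarithm. -}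

module Defs where

open import Data.Empty using (⊥; ⊥-elim)
open import Data.Fin.Base as Fin using (Fin)
import Data.Fin.Properties as Fin
open import Data.Integer.Base as ℤ using (+_)
import Data.Integer.Properties as ℤ
open import Data.List.Base as List using (List; []; _∷_; _++_; length; map; filter; upTo; cartesianProductWith)
import Data.List.Properties as List
import Data.List.Membership.DecPropositional as DecMembership
open import Data.List.Membership.Propositional using (_∈_)
open import Data.List.Membership.Propositional.Properties using (∈-++⁻; ∈-++⁺ˡ; ∈-++⁺ʳ; ∈-map⁺; ∈-map⁻; ∈-filter⁺; ∈-filter⁻; ∈-upTo⁺; ∈-upTo⁻; ∈-cartesianProductWith⁺; ∈-cartesianProductWith⁻; ∈-lookup)
import Data.List.Relation.Unary.All as All
open import Data.List.Relation.Unary.All using (All; []; _∷_)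
open import Data.List.Relation.Unary.AllPairs using ([]; _∷_)
open import Data.List.Relation.Unary.Any as Any using (here; there)
open import Data.List.Relation.Unary.Any.Properties using (lookup-index)
open import Data.List.Relation.Unary.Unique.Propositional using (Unique)
import Data.List.Relation.Unary.Unique.Propositional.Properties as Unique
open import Data.Nat.Base as ℕ using (ℕ; zero; suc; z≤n; s≤s; NonZero; _∸_; _^_)
open import Data.Nat.Combinatorics using (_C_; nCk+nC[k+1]≡[n+1]C[k+1])
import Data.Nat.Properties as ℕ
open import Data.Product.Base using (∃; _×_; _,_; proj₁; proj₂)
open import Data.Rational.Base as ℚ using (ℚ; mkℚ; 0ℚ; 1ℚ; _/_)
import Data.Rational.Properties as ℚ
open import Data.Rational.Solver using (module +-*-Solver)
import Data.Rational.Unnormalised.Base as ℚᵘ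
import Data.Rational.Unnormalised.Properties as ℚᵘ
open import Data.Sum.Base using (inj₁; inj₂)
open import Data.Vec.Base as Vec using (Vec; []; _∷_; lookup; _[_]≔_)
import Data.Vec.Properties as Vec
open import Function.Base using (_∘_; id)
open import Function.Bundles using (_⇔_; mk⇔; Equivalence; Inverse)
open import Level using (0ℓ) renaming (suc to lsuc)
open import Relation.Binary.Bundles using (Setoid)
open import Relation.Binary.PropositionalEquality using (_≡_; refl; sym; trans; cong; cong₂; subst; subst₂)
import Relation.Binary.PropositionalEquality.Properties as ≡
open import Relation.Nullary using (Dec; yes; no)
open import Relation.Nullary.Decidable as Dec using (_→-dec_)
open import Relation.Unary using (Pred; Decidable)

open Equivalence using () renaming (to to ⇒; from to ⇐)

Point : ℕ → Set
Point d = Vec ℕ d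

_≼_ : ∀ {d} → Point d → Point d → Set
x′ ≼ x = ∀ i → lookup x′ i ℕ.≤ lookup x i

IsLowerSet : ∀ {d} → Pred (Point d) 0ℓ → Set
IsLowerSet S = ∀ {x x′} → S x → x′ ≼ x → S x′

HasExactly_Points : ∀ {d} → ℕ → Pred (Point d) 0ℓ → Set
HasExactly n Points S = ∃ λ xs → Unique xs × length xs ≡ n × (∀ x → S x ⇔ x ∈ xs)

record LowerSet (d n : ℕ) : Set₁ where
  field
    member : Pred (Point d) 0ℓ
    lower  : IsLowerSet member
    card   : HasExactly n Points member

open LowerSet

-- Lower sets are predicates, so they are counted up to having the same members.
lowerSets : (d n : ℕ) → Setoid (lsuc 0ℓ) 0ℓ
lowerSets d n = record
  { Carrier = LowerSet d n
  ; _≈_ = λ S T → ∀ x → member S x ⇔ member T x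
  ; isEquivalence = record
    { refl  = λ x → mk⇔ id id
    ; sym   = λ e x → mk⇔ (⇐ (e x)) (⇒ (e x))
    ; trans = λ e f x → mk⇔ (⇒ (f x) ∘ ⇒ (e x)) (⇐ (e x) ∘ ⇐ (f x))
    }
  }

choose : ∀ {A : Set} → ℕ → List A → List (List A)
choose zero    _        = [] ∷ []
choose (suc n) []       = []
choose (suc n) (x ∷ xs) = map (x ∷_) (choose n xs) ++ choose (suc n) xs

box : (d n : ℕ) → List (Point d)
box zero    n = [] ∷ []
box (suc d) n = cartesianProductWith _∷_ (upTo n) (box d n)

private
  _≟ₚ_ : ∀ {d} (x y : Point d) → Dec (x ≡ y)
  _≟ₚ_ = Vec.≡-dec ℕ._≟_

  open module M {d : ℕ} = DecMembership (_≟ₚ_ {d}) using (_∈?_)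

  _≼?_ : ∀ {d} (x y : Point d) → Dec (x ≼ y)
  x ≼? y = Fin.all? (λ i → lookup x i ℕ.≤? lookup y i)

LowerIn : ∀ {d} → ℕ → List (Point d) → Set
LowerIn {d} n ys = All (λ x → All (λ x′ → x′ ≼ x → x′ ∈ ys) (box d n)) ys

lowerIn? : ∀ {d} n → Decidable (LowerIn {d} n)
lowerIn? {d} n ys = All.all? (λ x → All.all? (λ x′ → (x′ ≼? x) →-dec (x′ ∈? ys)) (box d n)) ys

-- A lower set with n points is contained in {0,…,n-1}ᵈ, so it suffices to search
-- the n-element subsets of this box; p-counts verifies the resulting number.
lowerLists : (d n : ℕ) → List (List (Point d))
lowerLists d n = filter (lowerIn? n) (choose n (box d n))

p : (d n : ℕ) → ℕ
p d n = length (lowerLists d n)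

module Counting where
  lookup-inj : ∀ {A : Set} {xs : List A} → Unique xs → ∀ i j → List.lookup xs i ≡ List.lookup xs j → i ≡ j
  lookup-inj (_ ∷ _)  Fin.zero    Fin.zero    _ = refl
  lookup-inj {xs = _ ∷ xs} (a ∷ _)  Fin.zero    (Fin.suc j) e = ⊥-elim (All.lookup a (∈-lookup {xs = xs} j) e)
  lookup-inj {xs = _ ∷ xs} (a ∷ _)  (Fin.suc i) Fin.zero    e = ⊥-elim (All.lookup a (∈-lookup {xs = xs} i) (sym e))
  lookup-inj (_ ∷ u)  (Fin.suc i) (Fin.suc j) e = cong Fin.suc (lookup-inj u i j e)

  unique-≤ : ∀ {A : Set} {xs ys : List A} → Unique xs → (∀ {x} → x ∈ xs → x ∈ ys) → length xs ℕ.≤ length ys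
  unique-≤ {xs = xs} {ys} u sub = Fin.injective⇒≤ {f = f} inj
    where
    mem : ∀ i → List.lookup xs i ∈ ys
    mem i = sub (∈-lookup {xs = xs} i)
    f : Fin (length xs) → Fin (length ys)
    f i = Any.index (mem i)
    inj : ∀ {i j} → f i ≡ f j → i ≡ j
    inj {i} {j} e = lookup-inj u i j
      (trans (lookup-index (mem i)) (trans (cong (List.lookup ys) e) (sym (lookup-index (mem j)))))

  filter-local : ∀ {A : Set} {P Q : Pred A 0ℓ} (P? : Decidable P) (Q? : Decidable Q) xs →
                 (∀ {x} → x ∈ xs → P x ⇔ Q x) → filter P? xs ≡ filter Q? xs
  filter-local P? Q? []       e = refl
  filter-local P? Q? (x ∷ xs) e with P? x
  ... | yes px = trans (cong (x ∷_) (filter-local P? Q? xs (e ∘ there)))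
                       (sym (List.filter-accept Q? (⇒ (e (here refl)) px)))
  ... | no ¬px = trans (filter-local P? Q? xs (e ∘ there))
                       (sym (List.filter-reject Q? (¬px ∘ ⇐ (e (here refl)))))

  choose-length : ∀ {A : Set} n (xs : List A) {ys} → ys ∈ choose n xs → length ys ≡ n
  choose-length zero    xs       (here refl) = refl
  choose-length (suc n) (x ∷ xs) m with ∈-++⁻ (map (x ∷_) (choose n xs)) m
  ... | inj₂ r = choose-length (suc n) xs r
  ... | inj₁ l with _ , m′ , refl ← ∈-map⁻ (x ∷_) l = cong suc (choose-length n xs m′)

  choose-⊆ : ∀ {A : Set} n (xs : List A) {ys} → ys ∈ choose n xs → ∀ {y} → y ∈ ys → y ∈ xs
  choose-⊆ zero    xs       (here refl) ()
  choose-⊆ (suc n) (x ∷ xs) m y∈ with ∈-++⁻ (map (x ∷_) (choose n xs)) m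
  ... | inj₂ r = there (choose-⊆ (suc n) xs r y∈)
  ... | inj₁ l with ∈-map⁻ (x ∷_) l
  choose-⊆ (suc n) (x ∷ xs) m (here e)   | inj₁ l | _ , m′ , refl = here e
  choose-⊆ (suc n) (x ∷ xs) m (there y∈) | inj₁ l | _ , m′ , refl = there (choose-⊆ n xs m′ y∈)

  choose-unique : ∀ {A : Set} n {xs : List A} → Unique xs → Unique (choose n xs)
  choose-unique zero    u = [] ∷ []
  choose-unique (suc n) [] = []
  choose-unique (suc n) {x ∷ xs} u@(_ ∷ u′) =
    Unique.++⁺ (Unique.map⁺ (λ { refl → refl }) (choose-unique n u′)) (choose-unique (suc n) u′) disj
    where
    disj : ∀ {v} → v ∈ map (x ∷_) (choose n xs) × v ∈ choose (suc n) xs → ⊥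
    disj (l , r) with _ , _ , refl ← ∈-map⁻ (x ∷_) l =
      Unique.Unique[x∷xs]⇒x∉xs u (choose-⊆ (suc n) xs r (here refl))

  filter-∈-choose : ∀ {A : Set} {P : Pred A 0ℓ} (P? : Decidable P) xs →
                    filter P? xs ∈ choose (length (filter P? xs)) xs
  filter-∈-choose P? [] = here refl
  filter-∈-choose P? (x ∷ xs) with P? x
  ... | yes px = ∈-++⁺ˡ (∈-map⁺ (x ∷_) (filter-∈-choose P? xs))
  ... | no ¬px = skip (length (filter P? xs)) (filter-∈-choose P? xs)
    where
    skip : ∀ n {ys} → ys ∈ choose n xs → ys ∈ choose n (x ∷ xs)
    skip zero    (here e) = here e
    skip (suc n) m        = ∈-++⁺ʳ (map (x ∷_) (choose n xs)) m

  choose-filter : ∀ {d} n {xs : List (Point d)} → Unique xs → ∀ {ys} → ys ∈ choose n xs →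
                  filter (_∈? ys) xs ≡ ys
  choose-filter zero {xs} u (here refl) = List.filter-none (_∈? []) (All.universal (λ _ ()) xs)
  choose-filter (suc n) {x ∷ xs} u@(_ ∷ u′) {ys} m with ∈-++⁻ (map (x ∷_) (choose n xs)) m
  ... | inj₂ r = trans (List.filter-reject (_∈? ys) (Unique.Unique[x∷xs]⇒x∉xs u ∘ choose-⊆ (suc n) xs r))
                       (choose-filter (suc n) u′ r)
  ... | inj₁ l with zs , m′ , refl ← ∈-map⁻ (x ∷_) l =
    trans (List.filter-accept (_∈? (x ∷ zs)) (here refl))
          (cong (x ∷_) (trans (filter-local (_∈? (x ∷ zs)) (_∈? zs) xs loc) (choose-filter n u′ m′)))
    where
    loc : ∀ {y} → y ∈ xs → (y ∈ x ∷ zs) ⇔ (y ∈ zs)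
    loc y∈ = mk⇔ (λ { (here refl) → ⊥-elim (Unique.Unique[x∷xs]⇒x∉xs u y∈) ; (there q) → q }) there

  box-unique : ∀ d n → Unique (box d n)
  box-unique zero    n = [] ∷ []
  box-unique (suc d) n = Unique.cartesianProductWith⁺ _∷_ Vec.∷-injective (Unique.upTo⁺ n) (box-unique d n)

  ∈-box⁺ : ∀ {d n} (x : Point d) → (∀ i → lookup x i ℕ.< n) → x ∈ box d n
  ∈-box⁺ []       h = here refl
  ∈-box⁺ (a ∷ x) h = ∈-cartesianProductWith⁺ _∷_ (∈-upTo⁺ (h Fin.zero)) (∈-box⁺ x (h ∘ Fin.suc))

  ∈-box⁻ : ∀ {d n} {x : Point d} → x ∈ box d n → ∀ i → lookup x i ℕ.< n
  ∈-box⁻ {suc d} {n} m i with ∈-cartesianProductWith⁻ _∷_ (upTo n) (box d n) m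
  ∈-box⁻ {suc d} m Fin.zero    | _ , _ , a∈ , x∈ , refl = ∈-upTo⁻ a∈
  ∈-box⁻ {suc d} m (Fin.suc i) | _ , _ , a∈ , x∈ , refl = ∈-box⁻ x∈ i

  bounded : ∀ {d n} (S : LowerSet d n) {x} → member S x → ∀ i → lookup x i ℕ.< n
  bounded {d} {n} S {x} sx i with lookup x i ℕ.<? n
  ... | yes lt = lt
  ... | no ≮n with xs , _ , len , mem ← card S = ⊥-elim (ℕ.<-irrefl refl
        (subst₂ ℕ._≤_ (trans (List.length-map f (upTo (suc n))) (List.length-upTo (suc n))) len
          (unique-≤ (Unique.map⁺ inj (Unique.upTo⁺ (suc n))) sub)))
    where
    f : ℕ → Point d
    f k = x [ i ]≔ k
    inj : ∀ {k l} → f k ≡ f l → k ≡ l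
    inj {k} {l} e = trans (sym (Vec.lookup∘update i x k)) (trans (cong (λ v → lookup v i) e) (Vec.lookup∘update i x l))
    below : ∀ {k} → k ℕ.≤ n → f k ≼ x
    below {k} k≤n j with j Fin.≟ i
    ... | yes refl = subst (ℕ._≤ lookup x i) (sym (Vec.lookup∘update i x k)) (ℕ.≤-trans k≤n (ℕ.≮⇒≥ ≮n))
    ... | no j≢i   = ℕ.≤-reflexive (Vec.lookup∘update′ j≢i x k)
    sub : ∀ {y} → y ∈ map f (upTo (suc n)) → y ∈ xs
    sub y∈ with k , k∈ , refl ← ∈-map⁻ f y∈ = ⇒ (mem _) (lower S sx (below (ℕ.≤-pred (∈-upTo⁻ k∈))))

  member? : ∀ {d n} (S : LowerSet d n) → Decidable (member S)
  member? S x with xs , _ , _ , mem ← card S = Dec.map′ (⇐ (mem x)) (⇒ (mem x)) (x ∈? xs)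

  canon : ∀ {d n} → LowerSet d n → List (Point d)
  canon {d} {n} S = filter (member? S) (box d n)

  ∈-canon : ∀ {d n} (S : LowerSet d n) x → member S x ⇔ x ∈ canon S
  ∈-canon {d} {n} S x = mk⇔ (λ s → ∈-filter⁺ (member? S) (∈-box⁺ x (bounded S s)) s)
                            (λ m → proj₂ (∈-filter⁻ (member? S) {xs = box d n} m))

  canon-length : ∀ {d n} (S : LowerSet d n) → length (canon S) ≡ n
  canon-length {d} {n} S = go (card S)
    where
    go : HasExactly n Points (member S) → length (canon S) ≡ n
    go (xs , u , len , mem) = trans
      (ℕ.≤-antisym (unique-≤ (Unique.filter⁺ (member? S) (box-unique d n)) (⇒ (mem _) ∘ ⇐ (∈-canon S _)))
                   (unique-≤ u (⇒ (∈-canon S _) ∘ ⇐ (mem _)))) len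

  canon-∈ : ∀ {d n} (S : LowerSet d n) → canon S ∈ lowerLists d n
  canon-∈ {d} {n} S = ∈-filter⁺ (lowerIn? n)
    (subst (λ k → canon S ∈ choose k (box d n)) (canon-length S) (filter-∈-choose (member? S) (box d n)))
    (All.tabulate λ x∈ → All.tabulate λ _ x′≼x → ⇒ (∈-canon S _) (lower S (⇐ (∈-canon S _) x∈) x′≼x))

  lowerLists-unique : ∀ d n → Unique (lowerLists d n)
  lowerLists-unique d n = Unique.filter⁺ (lowerIn? n) (choose-unique n (box-unique d n))

  fromList : ∀ {d n} ys → ys ∈ lowerLists d n → LowerSet d n
  fromList {d} {n} ys m with ys∈ , low ← ∈-filter⁻ (lowerIn? n) {xs = choose n (box d n)} m = record
    { member = _∈ ys
    ; lower  = λ x∈ x′≼x → All.lookup (All.lookup low x∈)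
                 (∈-box⁺ _ (λ i → ℕ.≤-<-trans (x′≼x i) (∈-box⁻ (choose-⊆ n (box d n) ys∈ x∈) i))) x′≼x
    ; card   = ys
             , subst Unique (choose-filter n (box-unique d n) ys∈) (Unique.filter⁺ (_∈? ys) (box-unique d n))
             , choose-length n (box d n) ys∈
             , λ x → mk⇔ id id
    }

  toIndex : ∀ {d n} → LowerSet d n → Fin (p d n)
  toIndex S = Any.index (canon-∈ S)

  fromIndex : ∀ {d n} → Fin (p d n) → LowerSet d n
  fromIndex {d} {n} i = fromList (List.lookup (lowerLists d n) i) (∈-lookup i)

  canon-cong : ∀ {d n} {S : LowerSet d n} ys → ys ∈ lowerLists d n → (∀ x → member S x ⇔ x ∈ ys) → canon S ≡ ys
  canon-cong {d} {n} {S} ys m e = trans (filter-local (member? S) (_∈? ys) (box d n) (λ {x} _ → e x))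
    (choose-filter n (box-unique d n) (proj₁ (∈-filter⁻ (lowerIn? n) {xs = choose n (box d n)} m)))

  toIndex-unique : ∀ {d n} {S : LowerSet d n} i → (∀ x → member S x ⇔ x ∈ List.lookup (lowerLists d n) i) → toIndex S ≡ i
  toIndex-unique {d} {n} {S} i e = lookup-inj (lowerLists-unique d n) _ i
    (trans (sym (lookup-index (canon-∈ S))) (canon-cong {S = S} _ (∈-lookup i) e))

  toIndex-∈ : ∀ {d n} (S : LowerSet d n) x → member S x ⇔ x ∈ List.lookup (lowerLists d n) (toIndex S)
  toIndex-∈ S x = subst (λ ys → member S x ⇔ x ∈ ys) (lookup-index (canon-∈ S)) (∈-canon S x)

  ∈-fromIndex : ∀ {d n} i x → member (fromIndex {d} {n} i) x ≡ (x ∈ List.lookup (lowerLists d n) i)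
  ∈-fromIndex {d} {n} i x with ∈-filter⁻ (lowerIn? n) {xs = choose n (box d n)} (∈-lookup {xs = lowerLists d n} i)
  ... | _ , _ = refl

open Counting

p-counts : ∀ d n → Inverse (lowerSets d n) (≡.setoid (Fin (p d n)))
p-counts d n = record
  { to        = toIndex
  ; from      = fromIndex
  ; to-cong   = λ {S} {T} e → toIndex-unique {S = S} (toIndex T) (λ x → mk⇔ (⇒ (toIndex-∈ T x) ∘ ⇒ (e x)) (⇐ (e x) ∘ ⇐ (toIndex-∈ T x)))
  ; from-cong = λ { refl x → mk⇔ id id }
  ; inverse   = (λ {i} {S} e → toIndex-unique {S = S} i
                     (λ x → subst (λ B → member S x ⇔ B) (∈-fromIndex {d} {n} i x) (e x)))
              , (λ { {S} refl x → subst (_⇔ member S x) (sym (∈-fromIndex {d} {n} (toIndex S) x))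
                                    (mk⇔ (⇐ (toIndex-∈ S x)) (⇒ (toIndex-∈ S x))) })
  }

chain : ∀ d n → LowerSet (suc d) n
chain d n = record
  { member = _∈ map f (upTo n)
  ; lower  = below
  ; card   = map f (upTo n) , Unique.map⁺ Vec.∷-injectiveˡ (Unique.upTo⁺ n)
           , trans (List.length-map f (upTo n)) (List.length-upTo n) , λ x → mk⇔ id id
  }
  where
  f : ℕ → Point (suc d)
  f k = k ∷ Vec.replicate d 0
  zeros : ∀ {e} (y : Point e) → y ≼ Vec.replicate e 0 → y ≡ Vec.replicate e 0
  zeros []       h = refl
  zeros (a ∷ y) h = cong₂ _∷_ (ℕ.n≤0⇒n≡0 (h Fin.zero)) (zeros y (h ∘ Fin.suc))
  below : IsLowerSet (_∈ map f (upTo n))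
  below {x′ = a ∷ y} x∈ h with k , k∈ , refl ← ∈-map⁻ f x∈ =
    subst (λ z → (a ∷ z) ∈ map f (upTo n)) (sym (zeros y (h ∘ Fin.suc)))
      (∈-map⁺ f (∈-upTo⁺ (ℕ.≤-<-trans (h Fin.zero) (∈-upTo⁻ k∈))))

p≢0 : ∀ d n .{{_ : NonZero d}} → NonZero (p d n)
p≢0 (suc d) n = Fin.nonZeroIndex (toIndex (chain d n))

binom≢0 : ∀ d n .{{_ : NonZero d}} .{{_ : NonZero n}} → NonZero ((d ℕ.+ n ∸ 2) C (d ∸ 1))
binom≢0 (suc d) (suc n) = subst (λ k → NonZero (k C d)) (sym (cong (_∸ 1) (ℕ.+-suc d n))) (C≢0 d n)
  where
  C≢0 : ∀ k j → NonZero ((k ℕ.+ j) C k)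
  C≢0 zero    j = _
  C≢0 (suc k) j = subst NonZero (nCk+nC[k+1]≡[n+1]C[k+1] (k ℕ.+ j) k)
    (ℕ.≢-nonZero λ e → ℕ.≢-nonZero⁻¹ ((k ℕ.+ j) C k) {{C≢0 k j}} (ℕ.m+n≡0⇒m≡0 _ e))

1-n³/2d : (d n : ℕ) .{{_ : NonZero d}} → ℚ
1-n³/2d d n = 1ℚ ℚ.- (+ (n ^ 3) / (2 ℕ.* d)) {{ℕ.m*n≢0 2 d}}

1-n³/2d≢0 : ∀ d n .{{_ : NonZero d}} → + (n ^ 3) / 2 ℚ.< + d / 1 → ℚ.NonZero (1-n³/2d d n)
1-n³/2d≢0 (suc d) n h = ℚ.pos⇒nonZero (1-n³/2d (suc d) n) {{ℚ.positive (subst (ℚ._< 1-n³/2d (suc d) n) (ℚ.+-inverseʳ q) (ℚ.+-monoˡ-< (ℚ.- q) q<1))}}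
  where
  q = + (n ^ 3) / (2 ℕ.* suc d)
  h′ : ℚᵘ.mkℚᵘ (+ (n ^ 3)) 1 ℚᵘ.< ℚᵘ.mkℚᵘ (+ suc d) 0
  h′ = ℚᵘ.<-respˡ-≃ (ℚ.toℚᵘ-fromℚᵘ _) (ℚᵘ.<-respʳ-≃ (ℚ.toℚᵘ-fromℚᵘ _) (ℚ.toℚᵘ-mono-< h))
  q<1ᵘ : ℚᵘ.mkℚᵘ (+ (n ^ 3)) (d ℕ.+ suc (d ℕ.+ 0)) ℚᵘ.< ℚᵘ.1ℚᵘ
  q<1ᵘ with ℚᵘ.*<* l ← h′ = ℚᵘ.*<* (subst (+ (n ^ 3) ℤ.* + 1 ℤ.<_) (trans (ℤ.*-comm (+ suc d) (+ 2)) (sym (ℤ.*-identityˡ _))) l)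
  q<1 : q ℚ.< 1ℚ
  q<1 = ℚ.toℚᵘ-cancel-< (ℚᵘ.<-respˡ-≃ (ℚᵘ.≃-sym (ℚ.toℚᵘ-fromℚᵘ _)) q<1ᵘ)

-- Real numbers are Cauchy sequences of rationals, with the order below (and the
-- induced equality) in place of a quotient.
IsCauchy : (ℕ → ℚ) → Set
IsCauchy x = ∀ ε → 0ℚ ℚ.< ε → ∃ λ N → ∀ m n → N ℕ.≤ m → N ℕ.≤ n → ℚ.∣ x m ℚ.- x n ∣ ℚ.≤ ε

record ℝ : Set where
  constructor mkℝ
  field
    seq    : ℕ → ℚ
    cauchy : IsCauchy seq

open ℝ

module Analysis where
  ∣-∣-≤ : ∀ {a b} → a ℚ.≤ b → ℚ.- a ℚ.≤ b → ℚ.∣ a ∣ ℚ.≤ b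
  ∣-∣-≤ {a} l r with ℚ.∣p∣≡p∨∣p∣≡-p a
  ... | inj₁ e = subst (ℚ._≤ _) (sym e) l
  ... | inj₂ e = subst (ℚ._≤ _) (sym e) r

  ≤+⇒-≤ : ∀ {a b c} → a ℚ.≤ c ℚ.+ b → a ℚ.- b ℚ.≤ c
  ≤+⇒-≤ {a} {b} {c} h = subst (a ℚ.- b ℚ.≤_) (solve 2 (λ c b → (c :+ b) :- b := c) refl c b) (ℚ.+-monoˡ-≤ (ℚ.- b) h)
    where open +-*-Solver

  neg-sub : ∀ a b → ℚ.- (a ℚ.- b) ≡ b ℚ.- a
  neg-sub = solve 2 (λ a b → :- (a :- b) := b :- a) refl
    where open +-*-Solver

  halve : ∀ ε → ε ℚ.* ℚ.½ ℚ.+ ε ℚ.* ℚ.½ ≡ ε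
  halve ε = trans (sym (ℚ.*-distribˡ-+ ε ℚ.½ ℚ.½)) (ℚ.*-identityʳ ε)

  half-pos : ∀ ε → 0ℚ ℚ.< ε → 0ℚ ℚ.< ε ℚ.* ℚ.½
  half-pos ε h = subst (ℚ._< ε ℚ.* ℚ.½) (ℚ.*-zeroˡ ℚ.½) (ℚ.*-monoˡ-<-pos ℚ.½ h)

  const-cauchy : ∀ q → IsCauchy (λ _ → q)
  const-cauchy q ε h = 0 , λ _ _ _ _ → subst (ℚ._≤ ε) (sym (cong ℚ.∣_∣ (ℚ.+-inverseʳ q))) (ℚ.<⇒≤ h)

  +-cauchy : ∀ x y → IsCauchy x → IsCauchy y → IsCauchy (λ n → x n ℚ.+ y n)
  +-cauchy x y cx cy ε h with N₁ , f ← cx (ε ℚ.* ℚ.½) (half-pos ε h) | N₂ , g ← cy (ε ℚ.* ℚ.½) (half-pos ε h) =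
    N₁ ℕ.⊔ N₂ , λ m n m≥ n≥ → subst₂ ℚ._≤_
      (cong ℚ.∣_∣ (solve 4 (λ a b c d → (a :- b) :+ (c :- d) := (a :+ c) :- (b :+ d)) refl (x m) (x n) (y m) (y n)))
      (halve ε)
      (ℚ.≤-trans (ℚ.∣p+q∣≤∣p∣+∣q∣ (x m ℚ.- x n) (y m ℚ.- y n))
        (ℚ.+-mono-≤ (f m n (ℕ.m⊔n≤o⇒m≤o N₁ N₂ m≥) (ℕ.m⊔n≤o⇒m≤o N₁ N₂ n≥))
                    (g m n (ℕ.m⊔n≤o⇒n≤o N₁ N₂ m≥) (ℕ.m⊔n≤o⇒n≤o N₁ N₂ n≥))))
    where open +-*-Solver

  neg-cauchy : ∀ x → IsCauchy x → IsCauchy (λ n → ℚ.- x n)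
  neg-cauchy x cx ε h with N , f ← cx ε h = N , λ m n m≥ n≥ → subst (ℚ._≤ ε)
    (trans (sym (ℚ.∣-p∣≡∣p∣ (x m ℚ.- x n))) (cong ℚ.∣_∣ (ℚ.neg-distrib-+ (x m) (ℚ.- x n)))) (f m n m≥ n≥)

  abs-cauchy : ∀ x → IsCauchy x → IsCauchy (λ n → ℚ.∣ x n ∣)
  abs-cauchy x cx ε h with N , f ← cx ε h = N , λ m n m≥ n≥ → ∣-∣-≤
    (ℚ.≤-trans (step (x m) (x n)) (f m n m≥ n≥))
    (subst (ℚ._≤ ε) (sym (neg-sub ℚ.∣ x m ∣ ℚ.∣ x n ∣)) (ℚ.≤-trans (step (x n) (x m)) (f n m n≥ m≥)))
    where
    open +-*-Solver
    step : ∀ a b → ℚ.∣ a ∣ ℚ.- ℚ.∣ b ∣ ℚ.≤ ℚ.∣ a ℚ.- b ∣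
    step a b = ≤+⇒-≤ (subst (λ z → ℚ.∣ z ∣ ℚ.≤ ℚ.∣ a ℚ.- b ∣ ℚ.+ ℚ.∣ b ∣)
      (solve 2 (λ a b → (a :- b) :+ b := a) refl a b) (ℚ.∣p+q∣≤∣p∣+∣q∣ (a ℚ.- b) b))

  scale-cauchy : ∀ q x → IsCauchy x → IsCauchy (λ n → q ℚ.* x n)
  scale-cauchy q x cx ε h = proj₁ (cx δ δ>0) , λ m n m≥ n≥ → subst₂ ℚ._≤_
      (trans (sym (ℚ.∣p*q∣≡∣p∣*∣q∣ q (x m ℚ.- x n)))
        (cong ℚ.∣_∣ (solve 3 (λ q a b → q :* (a :- b) := q :* a :- q :* b) refl q (x m) (x n))))
      K*δ≡ε
      (ℚ.≤-trans (ℚ.*-monoˡ-≤-nonNeg ℚ.∣ q ∣ {{ℚ.∣-∣-nonNeg q}} (proj₂ (cx δ δ>0) m n m≥ n≥))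
        (ℚ.*-monoʳ-≤-nonNeg δ {{ℚ.nonNegative (ℚ.<⇒≤ δ>0)}} ∣q∣≤K))
    where
    open +-*-Solver
    K = ℚ.∣ q ∣ ℚ.+ 1ℚ
    instance
      K>0 : ℚ.Positive K
      K>0 = ℚ.nonNeg+pos⇒pos ℚ.∣ q ∣ {{ℚ.∣-∣-nonNeg q}} 1ℚ
      K≢0 : ℚ.NonZero K
      K≢0 = ℚ.pos⇒nonZero K
    δ = (ℚ.1/ K) ℚ.* ε
    δ>0 : 0ℚ ℚ.< δ
    δ>0 = subst (ℚ._< δ) (ℚ.*-zeroʳ (ℚ.1/ K)) (ℚ.*-monoʳ-<-pos (ℚ.1/ K) {{ℚ.1/pos⇒pos K}} h)
    K*δ≡ε : K ℚ.* δ ≡ ε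
    K*δ≡ε = trans (sym (ℚ.*-assoc K (ℚ.1/ K) ε)) (trans (cong (ℚ._* ε) (ℚ.*-inverseʳ K)) (ℚ.*-identityˡ ε))
    ∣q∣≤K : ℚ.∣ q ∣ ℚ.≤ K
    ∣q∣≤K = subst (ℚ._≤ K) (ℚ.+-identityʳ ℚ.∣ q ∣) (ℚ.+-monoʳ-≤ ℚ.∣ q ∣ (ℚ.<⇒≤ (ℚ.positive⁻¹ 1ℚ)))

open Analysis

infixl 6 _+ᴿ_ _-ᴿ_
infixr 7 _·_
infix  8 -ᴿ_
infix  4 _≤ᴿ_ _<ᴿ_

fromℕ : ℕ → ℚ
fromℕ n = + n / 1

fromℚ : ℚ → ℝ
fromℚ q = mkℝ (λ _ → q) (const-cauchy q)

_+ᴿ_ : ℝ → ℝ → ℝ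
x +ᴿ y = mkℝ (λ n → seq x n ℚ.+ seq y n) (+-cauchy (seq x) (seq y) (cauchy x) (cauchy y))

-ᴿ_ : ℝ → ℝ
-ᴿ x = mkℝ (λ n → ℚ.- seq x n) (neg-cauchy (seq x) (cauchy x))

_-ᴿ_ : ℝ → ℝ → ℝ
x -ᴿ y = x +ᴿ (-ᴿ y)

_·_ : ℚ → ℝ → ℝ
q · x = mkℝ (λ n → q ℚ.* seq x n) (scale-cauchy q (seq x) (cauchy x))

∣_∣ᴿ : ℝ → ℝ
∣ x ∣ᴿ = mkℝ (λ n → ℚ.∣ seq x n ∣) (abs-cauchy (seq x) (cauchy x))

_≤ᴿ_ : ℝ → ℝ → Set
x ≤ᴿ y = ∀ ε → 0ℚ ℚ.< ε → ∃ λ N → ∀ n → N ℕ.≤ n → seq x n ℚ.≤ seq y n ℚ.+ ε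

_<ᴿ_ : ℝ → ℝ → Set
x <ᴿ y = ∃ λ ε → 0ℚ ℚ.< ε × ∃ λ N → ∀ n → N ℕ.≤ n → seq x n ℚ.+ ε ℚ.≤ seq y n

∑< : ℕ → (ℕ → ℚ) → ℚ
∑< zero    f = 0ℚ
∑< (suc n) f = ∑< n f ℚ.+ f n

-- The right Riemann sum of ∫₁ᵏ dt/t with mesh 1/M: its (i+1)-st term is
-- (1/M) · 1/(1 + (i+1)/M) = 1/(M+i+1).
logSum : (k M : ℕ) → ℚ
logSum k M = ∑< ((k ∸ 1) ℕ.* M) (λ i → + 1 / suc (M ℕ.+ i))

module LogConvergence where
  inv : ℕ → ℚ
  inv n = + 1 / suc n

  inv≃ : ∀ n → ℚ.toℚᵘ (inv n) ℚᵘ.≃ ℚᵘ.mkℚᵘ (+ 1) n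
  inv≃ n = ℚ.toℚᵘ-fromℚᵘ (ℚᵘ.mkℚᵘ (+ 1) n)

  inv-anti : ∀ {m n} → m ℕ.≤ n → inv n ℚ.≤ inv m
  inv-anti {m} {n} m≤n = ℚ.toℚᵘ-cancel-≤ (ℚᵘ.≤-respˡ-≃ (ℚᵘ.≃-sym (inv≃ n)) (ℚᵘ.≤-respʳ-≃ (ℚᵘ.≃-sym (inv≃ m))
    (ℚᵘ.*≤* (subst₂ ℤ._≤_ (sym (ℤ.*-identityˡ (+ suc m))) (sym (ℤ.*-identityˡ (+ suc n))) (ℤ.+≤+ (s≤s m≤n))))))

  inv-nonNeg : ∀ n → 0ℚ ℚ.≤ inv n
  inv-nonNeg n = ℚ.nonNegative⁻¹ (inv n) {{ℚ.normalize-nonNeg 1 (suc n)}}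

  inv-cancel : ∀ b n → fromℕ (suc n) ℚ.* inv (b ℕ.* suc n ℕ.+ n) ≡ inv b
  inv-cancel b n = ℚ.toℚᵘ-injective (ℚᵘ.≃-trans (ℚ.toℚᵘ-homo-* (fromℕ (suc n)) (inv (b ℕ.* suc n ℕ.+ n)))
    (ℚᵘ.≃-trans (ℚᵘ.*-cong (ℚ.toℚᵘ-fromℚᵘ (ℚᵘ.mkℚᵘ (+ suc n) 0)) (inv≃ (b ℕ.* suc n ℕ.+ n)))
      (ℚᵘ.≃-trans (ℚᵘ.*≡* (cong +_ arith)) (ℚᵘ.≃-sym (inv≃ b)))))
    where
    arith : suc n ℕ.* 1 ℕ.* suc b ≡ 1 ℕ.* (1 ℕ.* suc (b ℕ.* suc n ℕ.+ n))
    arith = trans (cong (ℕ._* suc b) (ℕ.*-identityʳ (suc n)))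
      (trans (ℕ.*-comm (suc n) (suc b))
        (trans (cong suc (ℕ.+-comm n (b ℕ.* suc n)))
          (sym (trans (ℕ.*-identityˡ _) (ℕ.*-identityˡ _)))))

  ∑-mono : ∀ n {f g} → (∀ i → i ℕ.< n → f i ℚ.≤ g i) → ∑< n f ℚ.≤ ∑< n g
  ∑-mono zero    h = ℚ.≤-refl
  ∑-mono (suc n) h = ℚ.+-mono-≤ (∑-mono n (λ i i<n → h i (ℕ.m<n⇒m<1+n i<n))) (h n (ℕ.n<1+n n))

  ∑-cong : ∀ n {f g} → (∀ i → f i ≡ g i) → ∑< n f ≡ ∑< n g
  ∑-cong zero    h = refl
  ∑-cong (suc n) h = cong₂ ℚ._+_ (∑-cong n h) (h n)

  ∑-const : ∀ n c → ∑< n (λ _ → c) ≡ fromℕ n ℚ.* c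
  ∑-const zero    c = sym (ℚ.*-zeroˡ c)
  ∑-const (suc n) c = trans (cong₂ ℚ._+_ (∑-const n c) (sym (ℚ.*-identityˡ c)))
    (trans (sym (ℚ.*-distribʳ-+ c (fromℕ n) 1ℚ)) (cong (ℚ._* c) (fromℕ-suc n)))
    where
    fromℕ-suc : ∀ n → fromℕ n ℚ.+ 1ℚ ≡ fromℕ (suc n)
    fromℕ-suc n = ℚ.toℚᵘ-injective (ℚᵘ.≃-trans (ℚ.toℚᵘ-homo-+ (fromℕ n) 1ℚ)
      (ℚᵘ.≃-trans (ℚᵘ.+-cong (ℚ.toℚᵘ-fromℚᵘ (ℚᵘ.mkℚᵘ (+ n) 0)) (ℚᵘ.≃-refl {ℚᵘ.1ℚᵘ}))
        (ℚᵘ.≃-trans (ℚᵘ.*≡* (cong (ℤ._* + 1) (trans (cong (ℤ._+ + 1) (ℤ.*-identityʳ (+ n))) (cong +_ (ℕ.+-comm n 1)))))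
          (ℚᵘ.≃-sym (ℚ.toℚᵘ-fromℚᵘ (ℚᵘ.mkℚᵘ (+ suc n) 0))))))

  ∑-+ : ∀ m n f → ∑< (m ℕ.+ n) f ≡ ∑< m f ℚ.+ ∑< n (λ j → f (m ℕ.+ j))
  ∑-+ m zero    f = trans (cong (λ k → ∑< k f) (ℕ.+-identityʳ m)) (sym (ℚ.+-identityʳ _))
  ∑-+ m (suc n) f = trans (cong (λ k → ∑< k f) (ℕ.+-suc m n))
    (trans (cong (ℚ._+ f (m ℕ.+ n)) (∑-+ m n f)) (ℚ.+-assoc (∑< m f) _ _))

  ∑-block : ∀ a N f → ∑< (a ℕ.* N) f ≡ ∑< a (λ i → ∑< N (λ j → f (i ℕ.* N ℕ.+ j)))
  ∑-block zero    N f = refl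
  ∑-block (suc a) N f = trans (cong (λ k → ∑< k f) (ℕ.+-comm N (a ℕ.* N)))
    (trans (∑-+ (a ℕ.* N) N f) (cong (ℚ._+ ∑< N (λ j → f (a ℕ.* N ℕ.+ j))) (∑-block a N f)))

  ∑-shift : ∀ n f → ∑< n f ℚ.+ f n ≡ f 0 ℚ.+ ∑< n (f ∘ suc)
  ∑-shift zero    f = ℚ.+-comm 0ℚ (f 0)
  ∑-shift (suc n) f = trans (cong (ℚ._+ f (suc n)) (∑-shift n f)) (ℚ.+-assoc (f 0) _ _)

  module _ (k : ℕ) where
    private
      K = k ∸ 1

    blocks : ∀ M n → logSum k (M ℕ.* suc n) ≡
             ∑< (K ℕ.* M) (λ i → ∑< (suc n) (λ j → inv ((M ℕ.+ i) ℕ.* suc n ℕ.+ j)))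
    blocks M n = trans (cong (λ l → ∑< l (λ i → inv (M ℕ.* suc n ℕ.+ i))) (sym (ℕ.*-assoc K M (suc n))))
      (trans (∑-block (K ℕ.* M) (suc n) (λ i → inv (M ℕ.* suc n ℕ.+ i)))
        (∑-cong (K ℕ.* M) λ i → ∑-cong (suc n) λ j → cong inv
          (trans (sym (ℕ.+-assoc (M ℕ.* suc n) (i ℕ.* suc n) j)) (cong (ℕ._+ j) (sym (ℕ.*-distribʳ-+ (suc n) M i))))))

    logSum-lower : ∀ M n → logSum k M ℚ.≤ logSum k (M ℕ.* suc n)
    logSum-lower M n = subst (logSum k M ℚ.≤_) (sym (blocks M n)) (∑-mono (K ℕ.* M) λ i _ →
      subst (ℚ._≤ ∑< (suc n) (λ j → inv ((M ℕ.+ i) ℕ.* suc n ℕ.+ j)))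
        (trans (∑-const (suc n) _) (inv-cancel (M ℕ.+ i) n))
        (∑-mono (suc n) λ j j<N → inv-anti (ℕ.+-monoʳ-≤ ((M ℕ.+ i) ℕ.* suc n) (ℕ.≤-pred j<N))))

    logSum-upper : ∀ m n → logSum k (suc m ℕ.* suc n) ℚ.≤ inv m ℚ.+ logSum k (suc m)
    logSum-upper m n = subst (ℚ._≤ inv m ℚ.+ logSum k (suc m)) (sym (blocks (suc m) n))
      (ℚ.≤-trans (∑-mono L {g = λ i → inv (m ℕ.+ i)} λ i _ →
          subst (∑< (suc n) (λ j → inv ((suc m ℕ.+ i) ℕ.* suc n ℕ.+ j)) ℚ.≤_)
            (trans (∑-const (suc n) _) (inv-cancel (m ℕ.+ i) n))
            (∑-mono (suc n) λ j _ → inv-anti (bound (m ℕ.+ i) j)))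
        (ℚ.≤-trans
          (subst (ℚ._≤ A ℚ.+ inv (m ℕ.+ L)) (ℚ.+-identityʳ A) (ℚ.+-monoʳ-≤ A (inv-nonNeg (m ℕ.+ L))))
          (ℚ.≤-reflexive (trans (∑-shift L (λ i → inv (m ℕ.+ i)))
            (cong₂ ℚ._+_ (cong inv (ℕ.+-identityʳ m)) (∑-cong L λ i → cong inv (ℕ.+-suc m i)))))))
      where
      L = K ℕ.* suc m
      A = ∑< L (λ i → inv (m ℕ.+ i))
      bound : ∀ b j → b ℕ.* suc n ℕ.+ n ℕ.≤ suc b ℕ.* suc n ℕ.+ j
      bound b j = ℕ.≤-trans (ℕ.≤-reflexive (ℕ.+-comm (b ℕ.* suc n) n))
        (ℕ.≤-trans (ℕ.n≤1+n _) (ℕ.m≤m+n (suc n ℕ.+ b ℕ.* suc n) j))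

    logSum-diff : ∀ m n → logSum k (suc m) ℚ.- logSum k (suc n) ℚ.≤ inv n
    logSum-diff m n = ≤+⇒-≤ (ℚ.≤-trans (logSum-lower (suc m) n)
      (subst (λ z → logSum k z ℚ.≤ inv n ℚ.+ logSum k (suc n)) (ℕ.*-comm (suc n) (suc m)) (logSum-upper n m)))

    inv-small : ∀ ε → 0ℚ ℚ.< ε → ∃ λ N → inv N ℚ.≤ ε
    inv-small ε@(mkℚ (+ zero)    b _) h = ⊥-elim (ℚ.<-irrefl (sym (ℚ.↥p≡0⇒p≡0 ε refl)) h)
    inv-small ε@(mkℚ (+ (suc a)) b _) _ = b , ℚ.toℚᵘ-cancel-≤ (ℚᵘ.≤-respˡ-≃ (ℚᵘ.≃-sym (inv≃ b))
      (ℚᵘ.*≤* (ℤ.*-monoʳ-≤-nonNeg (+ suc b) {+ 1} {+ suc a} (ℤ.+≤+ (s≤s z≤n)))))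
    inv-small (mkℚ ℤ.-[1+ a ] b _) (ℚ.*<* ())

    logSum-cauchy : IsCauchy (λ m → logSum k (suc m))
    logSum-cauchy ε h with N , small ← inv-small ε h = N , λ m n m≥ n≥ → ∣-∣-≤
      (ℚ.≤-trans (logSum-diff m n) (ℚ.≤-trans (inv-anti n≥) small))
      (subst (ℚ._≤ ε) (sym (neg-sub (logSum k (suc m)) (logSum k (suc n))))
        (ℚ.≤-trans (logSum-diff n m) (ℚ.≤-trans (inv-anti m≥) small)))

log : (k : ℕ) .{{_ : NonZero k}} → ℝ
log k = mkℝ (λ m → logSum k (suc m)) (LogConvergence.logSum-cauchy k)

Seq : Set → Set
Seq A = (n : ℕ) .{{_ : NonZero n}} → A

Eventually : ((n : ℕ) .{{_ : NonZero n}} → Set) → Set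
Eventually P = ∃ λ N → ∀ n .{{_ : NonZero n}} → N ℕ.≤ n → P n

_⟶∞ : Seq ℚ → Set
f ⟶∞ = ∀ M → Eventually λ n → M ℚ.≤ f n

_⟶0 : Seq ℚ → Set
f ⟶0 = ∀ ε → 0ℚ ℚ.< ε → Eventually λ n → ℚ.∣ f n ∣ ℚ.≤ ε

infix 4 _∈o_ _∈O_

_∈o_ : Seq ℝ → Seq ℝ → Set
f ∈o g = ∀ ε → 0ℚ ℚ.< ε → Eventually λ n → ∣ f n ∣ᴿ ≤ᴿ ε · ∣ g n ∣ᴿ

_∈O_ : Seq ℝ → Seq ℝ → Set
f ∈O g = ∃ λ K → Eventually λ n → ∣ f n ∣ᴿ ≤ᴿ K · ∣ g n ∣ᴿ

_/n² : Seq ℕ → Seq ℚ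
(d /n²) n = (+ d n / (n ^ 2)) {{ℕ.m^n≢0 n 2}}

{-# OPTIONS --safe #-}
module Submission where

-- A lower set with n points either lies on the coordinate axes, and is then a composition of n - 1
-- into d parts, or has an off-axis point of maximal height. That point is the sum of two distinct
-- nonzero points of the set, so p d n ≤ binom + C(n-1,2) · p d (n-1), and (a) follows by induction on n.
--
-- For (b)-(d), build a lower set as a list starting from 0: first offer the d unit points, then the sums
-- of the entries j and i of the list for all j, i < n, and append each offered point that is new
-- and belongs to the set. Every point of the set is found, so the set is determined by the n - 1
-- successful ones among d + n² offers. Hence dⁿ⁻¹ ≤ (n-1)! p d n ≤ (d + n²)ⁿ⁻¹, and Stirling's formula
-- gives (b), (c) and the upper bound of (d). For the lower bound of (d), take 0, all units in
-- m = min (d, n/K) dimensions and n - 1 - m of the C(m,2) sums of two units.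

open import Data.Empty using (⊥; ⊥-elim)
open import Data.Fin.Base as Fin using (Fin)
import Data.Fin.Properties as Fin
open import Data.Integer.Base as ℤ using (+_)
import Data.Integer.Properties as ℤ
open import Data.List.Base as List using (List; []; _∷_; [_]; _++_; length; map; filter; concatMap; upTo; cartesianProduct; allFin; foldl)
import Data.List.Membership.DecPropositional as DecMembership
open import Data.List.Membership.Propositional using (_∈_; _∉_)
open import Data.List.Membership.Propositional.Properties using (∈-lookup; ∈-++⁺ˡ; ∈-++⁺ʳ; ∈-++⁻; ∈-map⁺; ∈-map⁻; ∈-filter⁺; ∈-filter⁻; ∈-upTo⁺; ∈-upTo⁻; ∈-concatMap⁺; ∈-cartesianProduct⁺; ∈-allFin)
import Data.List.Properties as List
open import Data.List.Relation.Unary.All as All using ([]; _∷_)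
import Data.List.Relation.Unary.All.Properties as All
open import Data.List.Relation.Unary.AllPairs as AllPairs using (AllPairs; []; _∷_)
import Data.List.Relation.Unary.AllPairs.Properties as AllPairs
open import Data.List.Relation.Unary.Any as Any using (here; there)
open import Data.List.Relation.Unary.Unique.Propositional using (Unique)
import Data.List.Relation.Unary.Unique.Propositional.Properties as Unique
open import Data.Nat.Base as ℕ using (ℕ; zero; suc; _+_; _*_; _∸_; _^_; _≤_; _<_; _!; s≤s; z≤n; NonZero)
open import Data.Nat.Combinatorics using (_C_; nCk+nC[k+1]≡[n+1]C[k+1]; nCk≡nC[n∸k]; nCn≡1; nC1≡n)
open import Data.Nat.DivMod using (m/n*n≤m; m≥n⇒m/n>0; m≡m%n+[m/n]*n; m%n<n)
open import Data.Nat.Induction using (<-rec)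
import Data.Nat.Properties as ℕ
open import Data.Nat.Properties using (_!≢0)
open import Data.Nat.Tactic.RingSolver using (solve-∀)
open import Data.Product.Base using (∃; ∃₂; _×_; _,_; proj₁; proj₂)
open import Data.Rational.Base as ℚ using (ℚ; 0ℚ; 1ℚ; _/_)
import Data.Rational.Properties as ℚ
open import Data.Rational.Solver using (module +-*-Solver)
import Data.Rational.Unnormalised.Base as ℚᵘ
import Data.Rational.Unnormalised.Properties as ℚᵘ
open import Data.Sum.Base using (_⊎_; inj₁; inj₂)
open import Data.Vec.Base as Vec using ([]; _∷_; lookup; replicate; zipWith; sum; _[_]≔_)
import Data.Vec.Properties as Vec
open import Function.Base using (_∘_; id; it; const)
open import Function.Bundles using (_⇔_; mk⇔; Equivalence)
open import Relation.Binary.PropositionalEquality using (_≡_; _≢_; refl; sym; trans; cong; cong₂; subst; subst₂; module ≡-Reasoning)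
open import Relation.Nullary using (Dec; yes; no)
open import Relation.Nullary.Decidable using (¬?)
open import Relation.Unary using (Decidable)
open import Defs
open Analysis
open Counting
open LogConvergence
open ℝ

open Equivalence using () renaming (to to ⇒; from to ⇐)

-- In (a) the two summands must be distinct: only then is the pair one of C(n-1,2). That factor is
-- at most n²/2, and passing from n - 1 to n points multiplies the binomial by at least d/n, which
-- is the origin of n³/(2d). The encoding is complete because a point other than 0 and the units is
-- a sum of two nonzero points, and in a lower set both are members strictly below it. The offers do
-- not depend on the set, so a code is a sublist of a fixed list. Stirling enters as nⁿ⁻¹ ≤ (n-1)!
-- eⁿ⁻¹ ≤ nⁿ; the gap is log n, hence o(n). For d well below n², dⁿ⁻¹ ≤ (n-1)! p d n yields only
-- about n log(d/n). The lower bound of (d) therefore draws its points from about m² sums instead of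
-- d units: for m of order n, the quotient m²/n is again of order n, and a large K keeps the points
-- spent on units to a small share of n. Every error is first stated with an explicit natural number
-- κ, where 1/(κ+1) plays the role of ε, so each asymptotic claim becomes an inequality at a fixed
-- n.

_≟ₚ_ : ∀ {d} (x y : Point d) → Dec (x ≡ y)
_≟ₚ_ = Vec.≡-dec ℕ._≟_

open module PointMembership {d : ℕ} = DecMembership (_≟ₚ_ {d}) using (_∈?_)

-- Binomial coefficients and powers

C-absorb : ∀ n k → suc k * (suc n C suc k) ≡ suc n * (n C k)
C-absorb zero    zero    = refl
C-absorb zero    (suc k) = ℕ.*-zeroʳ (suc (suc k))
C-absorb (suc n) zero    = trans (ℕ.*-identityˡ _) (trans (sym (nCk+nC[k+1]≡[n+1]C[k+1] (suc n) 0))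
  (cong suc (trans (trans (sym (ℕ.*-identityˡ _)) (C-absorb n 0)) refl)))
C-absorb (suc n) (suc k) = begin
  suc (suc k) * (suc (suc n) C suc (suc k))
    ≡⟨ cong (suc (suc k) *_) (nCk+nC[k+1]≡[n+1]C[k+1] (suc n) (suc k)) ⟨
  suc (suc k) * (x + (suc n C suc (suc k)))
    ≡⟨ distr k x _ ⟩
  x + (suc k * x + suc (suc k) * (suc n C suc (suc k)))
    ≡⟨ cong (x ℕ.+_) (cong₂ _+_ (C-absorb n k) (C-absorb n (suc k))) ⟩
  x + (suc n * (n C k) + suc n * (n C suc k))
    ≡⟨ cong (x ℕ.+_) (ℕ.*-distribˡ-+ (suc n) (n C k) (n C suc k)) ⟨
  x + suc n * ((n C k) + (n C suc k))
    ≡⟨ cong (λ z → x + suc n * z) (nCk+nC[k+1]≡[n+1]C[k+1] n k) ⟩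
  suc (suc n) * x ∎
  where
  open ≡-Reasoning
  x = suc n C suc k
  distr : ∀ k x y → suc (suc k) * (x + y) ≡ x + (suc k * x + suc (suc k) * y)
  distr = solve-∀

-- `k ! * (n C k)` is the falling factorial n(n-1)...(n-k+1). This is its recurrence, from which
-- both power bounds below follow factor by factor.
k!*C-suc : ∀ n k → suc k ! * (suc n C suc k) ≡ suc n * (k ! * (n C k))
k!*C-suc n k = begin
  suc k * k ! * (suc n C suc k)   ≡⟨ assoc (suc k) (k !) _ ⟩
  k ! * (suc k * (suc n C suc k)) ≡⟨ cong (k ! *_) (C-absorb n k) ⟩
  k ! * (suc n * (n C k))         ≡⟨ assoc′ (k !) (suc n) _ ⟩
  suc n * (k ! * (n C k))         ∎
  where
  open ≡-Reasoning
  assoc : ∀ a b c → a * b * c ≡ b * (a * c)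
  assoc = solve-∀
  assoc′ : ∀ a b c → a * (b * c) ≡ b * (a * c)
  assoc′ = solve-∀

k!*C≤^ : ∀ n k → k ! * (n C k) ≤ n ^ k
k!*C≤^ n       zero    = ℕ.≤-refl
k!*C≤^ zero    (suc k) = ℕ.≤-reflexive (ℕ.*-zeroʳ (suc k !))
k!*C≤^ (suc n) (suc k) = subst (_≤ suc n ^ suc k) (sym (k!*C-suc n k))
  (ℕ.*-monoʳ-≤ (suc n) (ℕ.≤-trans (k!*C≤^ n k) (ℕ.^-monoˡ-≤ k (ℕ.n≤1+n n))))

^≤k!*C : ∀ m k → suc m ^ k ≤ k ! * ((k + m) C k)
^≤k!*C m zero    = ℕ.≤-refl
^≤k!*C m (suc k) = subst (suc m ^ suc k ≤_) (sym (k!*C-suc (k + m) k))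
  (ℕ.*-mono-≤ (s≤s (ℕ.m≤n+m m k)) (^≤k!*C m k))

length-choose : ∀ {A : Set} k (xs : List A) → length (choose k xs) ≡ length xs C k
length-choose zero    xs       = refl
length-choose (suc k) []       = refl
length-choose (suc k) (x ∷ xs) = trans (List.length-++ (map (x ∷_) (choose k xs)))
  (trans (cong₂ _+_ (trans (List.length-map (x ∷_) (choose k xs)) (length-choose k xs)) (length-choose (suc k) xs))
    (nCk+nC[k+1]≡[n+1]C[k+1] (length xs) k))

length-concatMap : ∀ {A B : Set} (f : A → List B) c xs → (∀ {x} → x ∈ xs → length (f x) ≡ c) →
                   length (concatMap f xs) ≡ length xs * c
length-concatMap f c []       h = refl
length-concatMap f c (x ∷ xs) h = trans (List.length-++ (f x))
  (cong₂ _+_ (h (here refl)) (length-concatMap f c xs (h ∘ there)))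

-- Bounding `p` by codes from above and by families from below

module _ (d n : ℕ) where

  lowerLists⇒choose : ∀ {ys} → ys ∈ lowerLists d n → ys ∈ choose n (box d n)
  lowerLists⇒choose = proj₁ ∘ ∈-filter⁻ (lowerIn? n) {xs = choose n (box d n)}

  lowerLists-length : ∀ {ys} → ys ∈ lowerLists d n → length ys ≡ n
  lowerLists-length = choose-length n (box d n) ∘ lowerLists⇒choose

  lowerLists-Unique : ∀ {ys} → ys ∈ lowerLists d n → Unique ys
  lowerLists-Unique m = subst Unique (choose-filter n (box-unique d n) (lowerLists⇒choose m))
    (Unique.filter⁺ _ (box-unique d n))

  lowerLists-lower : ∀ {ys} → ys ∈ lowerLists d n → IsLowerSet (_∈ ys)
  lowerLists-lower {ys} m x∈ x′≼x = All.lookup (All.lookup low x∈)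
    (∈-box⁺ _ (λ i → ℕ.≤-<-trans (x′≼x i) (∈-box⁻ (choose-⊆ n (box d n) (lowerLists⇒choose m) x∈) i))) x′≼x
    where
    low : LowerIn n ys
    low = proj₂ (∈-filter⁻ (lowerIn? n) {xs = choose n (box d n)} m)

  ofList : ∀ ys → Unique ys → length ys ≡ n → IsLowerSet (_∈ ys) → LowerSet d n
  ofList ys u len low = record { member = _∈ ys ; lower = low ; card = ys , u , len , λ x → mk⇔ id id }

  -- The lists in `lowerLists` are sublists of `box d n`, so filtering the box turns any list with
  -- the same members into the listed representative, whatever its order or repetitions.
  canonical : List (Point d) → List (Point d)
  canonical xs = filter (_∈? xs) (box d n)

  canonical-≡ : ∀ {ys xs} → ys ∈ lowerLists d n → (∀ x → x ∈ ys ⇔ x ∈ xs) → ys ≡ canonical xs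
  canonical-≡ m e = trans (sym (choose-filter n (box-unique d n) (lowerLists⇒choose m)))
    (filter-local _ _ (box d n) (λ {x} _ → e x))

  -- Covering is enough: codes may be redundant, and some may decode to lists that form no lower
  -- set. Only the members of a decoded list matter, since `canonical` normalises it.
  p-≤ : ∀ {B : Set} (codes : List B) (decode : B → List (Point d)) →
        (∀ {ys} → ys ∈ lowerLists d n → ∃ λ b → b ∈ codes × (∀ x → x ∈ ys ⇔ x ∈ decode b)) →
        p d n ≤ length codes
  p-≤ codes decode h = subst (p d n ≤_) (List.length-map (canonical ∘ decode) codes)
    (unique-≤ (lowerLists-unique d n) sub)
    where
    sub : ∀ {ys} → ys ∈ lowerLists d n → ys ∈ map (canonical ∘ decode) codes
    sub m with b , b∈ , e ← h m = subst (_∈ map (canonical ∘ decode) codes) (sym (canonical-≡ m e)) (∈-map⁺ _ b∈)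

  ≤-p : ∀ {B : Set} {fam : List B} → Unique fam → (g : ∀ {b} → b ∈ fam → LowerSet d n) →
        (∀ {b b′} (q : b ∈ fam) (q′ : b′ ∈ fam) →
           (∀ x → LowerSet.member (g q) x ⇔ LowerSet.member (g q′) x) → b ≡ b′) →
        length fam ≤ p d n
  ≤-p {fam = fam} u g inj = Fin.injective⇒≤ {f = f} λ {i} {j} e → lookup-inj u i j (inj (∈-lookup i) (∈-lookup j) (same e))
    where
    f : Fin (length fam) → Fin (p d n)
    f i = toIndex (g (∈-lookup {xs = fam} i))
    same : ∀ {S T : LowerSet d n} → toIndex S ≡ toIndex T → ∀ x → LowerSet.member S x ⇔ LowerSet.member T x
    same {S} {T} e x = mk⇔
      (λ s → ⇐ (toIndex-∈ T x) (subst (λ i → x ∈ List.lookup (lowerLists d n) i) e (⇒ (toIndex-∈ S x) s)))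
      (λ t → ⇐ (toIndex-∈ S x) (subst (λ i → x ∈ List.lookup (lowerLists d n) i) (sym e) (⇒ (toIndex-∈ T x) t)))

-- Points, axes and decompositions into summands

infixl 6 _⊕_

_⊕_ : ∀ {d} → Point d → Point d → Point d
_⊕_ = zipWith _+_

𝟎 : ∀ {d} → Point d
𝟎 {d} = replicate d 0

axis : ∀ {d} → Fin d → ℕ → Point d
axis Fin.zero    k = k ∷ 𝟎
axis (Fin.suc i) k = 0 ∷ axis i k

lookup-axis : ∀ {d} (i : Fin d) k → lookup (axis i k) i ≡ k
lookup-axis Fin.zero    k = refl
lookup-axis (Fin.suc i) k = lookup-axis i k

data Position {d} (x : Point d) : Set where
  origin  : x ≡ 𝟎 → Position x
  onAxis  : ∀ i k → x ≡ axis i (suc k) → Position x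
  offAxis : ∀ i j → i ≢ j → lookup x i ≢ 0 → lookup x j ≢ 0 → Position x

OffAxis : ∀ {d} → Point d → Set
OffAxis {d} x = ∃₂ λ (i j : Fin d) → i ≢ j × lookup x i ≢ 0 × lookup x j ≢ 0

position : ∀ {d} (x : Point d) → Position x
position []       = origin refl
position (a ∷ x) with position x
position (zero  ∷ x) | origin e          = origin (cong (0 ∷_) e)
position (suc a ∷ x) | origin e          = onAxis Fin.zero a (cong (suc a ∷_) e)
position (zero  ∷ x) | onAxis i k e      = onAxis (Fin.suc i) k (cong (0 ∷_) e)
position (_     ∷ x) | offAxis i j ≢ p q = offAxis (Fin.suc i) (Fin.suc j) (≢ ∘ Fin.suc-injective) p q
position (suc a ∷ x) | onAxis i k e      = offAxis Fin.zero (Fin.suc i) (λ ()) (λ ()) 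
  (λ h → ℕ.1+n≢0 (trans (sym (lookup-axis i (suc k))) (trans (cong (λ y → lookup y i) (sym e)) h)))

lookup-𝟎 : ∀ {d} (i : Fin d) → lookup 𝟎 i ≡ 0
lookup-𝟎 i = Vec.lookup-replicate i 0

lookup-axis-≢ : ∀ {d} (i j : Fin d) k → i ≢ j → lookup (axis i k) j ≡ 0
lookup-axis-≢ Fin.zero    Fin.zero    k i≢j = ⊥-elim (i≢j refl)
lookup-axis-≢ Fin.zero    (Fin.suc j) k i≢j = lookup-𝟎 j
lookup-axis-≢ (Fin.suc i) Fin.zero    k i≢j = refl
lookup-axis-≢ (Fin.suc i) (Fin.suc j) k i≢j = lookup-axis-≢ i j k (i≢j ∘ cong Fin.suc)

axis-0 : ∀ {d} (i : Fin d) → axis i 0 ≡ 𝟎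
axis-0 Fin.zero    = refl
axis-0 (Fin.suc i) = cong (0 ∷_) (axis-0 i)

axis-⊕ : ∀ {d} (i : Fin d) a b → axis i a ⊕ axis i b ≡ axis i (a + b)
axis-⊕ Fin.zero    a b = cong (a + b ∷_) (Vec.zipWith-identityˡ (λ _ → refl) 𝟎)
axis-⊕ (Fin.suc i) a b = cong (0 ∷_) (axis-⊕ i a b)

≼-𝟎 : ∀ {d} {x : Point d} → x ≼ 𝟎 → x ≡ 𝟎
≼-𝟎 {x = []}    h = refl
≼-𝟎 {x = a ∷ x} h = cong₂ _∷_ (ℕ.n≤0⇒n≡0 (h Fin.zero)) (≼-𝟎 {x = x} (h ∘ Fin.suc))

𝟎-≼ : ∀ {d} {x : Point d} → 𝟎 ≼ x
𝟎-≼ {x = x} i = subst (_≤ lookup x i) (sym (lookup-𝟎 i)) z≤n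

≼-axis : ∀ {d} (i : Fin d) k {x} → x ≼ axis i k → ∃ λ k′ → k′ ≤ k × x ≡ axis i k′
≼-axis Fin.zero    k {a ∷ x} h = a , h Fin.zero , cong (a ∷_) (≼-𝟎 {x = x} (h ∘ Fin.suc))
≼-axis (Fin.suc i) k {a ∷ x} h with k′ , k′≤k , e ← ≼-axis i k {x} (h ∘ Fin.suc) =
  k′ , k′≤k , cong₂ _∷_ (ℕ.n≤0⇒n≡0 (h Fin.zero)) e

axis-≼ : ∀ {d} (i : Fin d) {k′ k} → k′ ≤ k → axis i k′ ≼ axis i k
axis-≼ Fin.zero    h Fin.zero    = h
axis-≼ Fin.zero    h (Fin.suc j) = ℕ.≤-refl
axis-≼ (Fin.suc i) h Fin.zero    = ℕ.≤-refl
axis-≼ (Fin.suc i) h (Fin.suc j) = axis-≼ i h j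

⊕-≼ˡ : ∀ {d} (x y : Point d) → x ≼ (x ⊕ y)
⊕-≼ˡ x y i = subst (lookup x i ≤_) (sym (Vec.lookup-zipWith _+_ i x y)) (ℕ.m≤m+n _ _)

⊕-comm : ∀ {d} (x y : Point d) → x ⊕ y ≡ y ⊕ x
⊕-comm = Vec.zipWith-comm ℕ.+-comm

⊕-≼ʳ : ∀ {d} (x y : Point d) → y ≼ (x ⊕ y)
⊕-≼ʳ x y = subst (y ≼_) (⊕-comm y x) (⊕-≼ˡ y x)

⊕-identityˡ : ∀ {d} (x : Point d) → 𝟎 ⊕ x ≡ x
⊕-identityˡ = Vec.zipWith-identityˡ (λ _ → refl)

sum-𝟎 : ∀ d → sum (𝟎 {d}) ≡ 0
sum-𝟎 zero    = refl
sum-𝟎 (suc d) = sum-𝟎 d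

sum≡0 : ∀ {d} (x : Point d) → sum x ≡ 0 → x ≡ 𝟎
sum≡0 []         e = refl
sum≡0 (zero ∷ x) e = cong (0 ∷_) (sum≡0 x e)

sum-⊕ : ∀ {d} (x y : Point d) → sum (x ⊕ y) ≡ sum x + sum y
sum-⊕ []      []      = refl
sum-⊕ (a ∷ x) (b ∷ y) = trans (cong (a + b ℕ.+_) (sum-⊕ x y)) (interchange a b (sum x) (sum y))
  where
  interchange : ∀ a b c e → a + b + (c + e) ≡ a + c + (b + e)
  interchange = solve-∀

sum-mono : ∀ {d} (x y : Point d) → x ≼ y → sum x ≤ sum y
sum-mono []      []      h = z≤n
sum-mono (_ ∷ x) (_ ∷ y) h = ℕ.+-mono-≤ (h Fin.zero) (sum-mono x y (h ∘ Fin.suc))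

-- The coordinate sum is strictly monotone, hence a height: it selects the maximal point in (a) and
-- drives the induction that shows the encoding complete.
≼-sum-≡ : ∀ {d} (x y : Point d) → x ≼ y → sum y ≤ sum x → x ≡ y
≼-sum-≡ []      []      h l = refl
≼-sum-≡ (a ∷ x) (b ∷ y) h l with ℕ.m≤n⇒m<n∨m≡n (h Fin.zero)
... | inj₁ a<b  = ⊥-elim (ℕ.<-irrefl refl (ℕ.<-≤-trans (ℕ.+-mono-<-≤ a<b (sum-mono x y (h ∘ Fin.suc))) l))
... | inj₂ refl = cong (a ∷_) (≼-sum-≡ x y (h ∘ Fin.suc) (ℕ.+-cancelˡ-≤ a _ _ l))

⊕≢ʳ : ∀ {d} (x y : Point d) → x ≢ 𝟎 → x ⊕ y ≢ y
⊕≢ʳ x y x≢𝟎 e = x≢𝟎 (sum≡0 x (ℕ.+-cancelʳ-≡ (sum y) (sum x) 0 (trans (sym (sum-⊕ x y)) (cong sum e))))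

⊕≢ˡ : ∀ {d} (x y : Point d) → y ≢ 𝟎 → x ⊕ y ≢ x
⊕≢ˡ x y y≢𝟎 e = ⊕≢ʳ y x y≢𝟎 (trans (⊕-comm y x) e)

⊕-split : ∀ {d} (x : Point d) i → (x [ i ]≔ 0) ⊕ axis i (lookup x i) ≡ x
⊕-split (a ∷ x) Fin.zero    = cong (a ∷_) (Vec.zipWith-identityʳ ℕ.+-identityʳ x)
⊕-split (a ∷ x) (Fin.suc i) = cong₂ _∷_ (ℕ.+-identityʳ a) (⊕-split x i)

-- Nonzero summands lie strictly below x, so a lower set containing x contains both as points other
-- than x.
record Split {d} (x : Point d) : Set where
  field
    left right : Point d
    left⊕right : left ⊕ right ≡ x
    left≢𝟎     : left ≢ 𝟎
    right≢𝟎    : right ≢ 𝟎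

  left≼ : left ≼ x
  left≼ = subst (left ≼_) left⊕right (⊕-≼ˡ left right)

  right≼ : right ≼ x
  right≼ = subst (right ≼_) left⊕right (⊕-≼ʳ left right)

  left≢ : left ≢ x
  left≢ e = ⊕≢ˡ left right right≢𝟎 (trans left⊕right (sym e))

  right≢ : right ≢ x
  right≢ e = ⊕≢ʳ left right left≢𝟎 (trans left⊕right (sym e))

-- Coordinate i is split off: the right summand lives on axis i, while the left one keeps the
-- nonzero coordinate j. They differ at j.
offAxis-split : ∀ {d} {x : Point d} → OffAxis x → ∃ λ (s : Split x) → Split.left s ≢ Split.right s
offAxis-split {x = x} (i , j , i≢j , p , q) = record
  { left⊕right = ⊕-split x i
  ; left≢𝟎     = λ e → q (trans (sym left-j) (trans (cong (λ y → lookup y j) e) (lookup-𝟎 j)))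
  ; right≢𝟎    = λ e → p (trans (sym (lookup-axis i _)) (trans (cong (λ y → lookup y i) e) (lookup-𝟎 i)))
  } , λ e → q (trans (sym left-j) (trans (cong (λ y → lookup y j) e) (lookup-axis-≢ i j _ i≢j)))
  where
  left-j : lookup (x [ i ]≔ 0) j ≡ lookup x j
  left-j = Vec.lookup∘update′ (i≢j ∘ sym) x 0

offAxis≢axis : ∀ {d} {x : Point d} → OffAxis x → ∀ i k → x ≢ axis i k
offAxis≢axis (j , j′ , j≢j′ , p , q) i k refl with i Fin.≟ j
... | no  i≢j  = p (lookup-axis-≢ i j k i≢j)
... | yes refl = q (lookup-axis-≢ i j′ k j≢j′)

offAxis-≼ : ∀ {d} {x y : Point d} → OffAxis x → x ≼ y → OffAxis y
offAxis-≼ (i , j , i≢j , p , q) h =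
  i , j , i≢j , (λ e → p (ℕ.n≤0⇒n≡0 (subst (_ ≤_) e (h i)))) , (λ e → q (ℕ.n≤0⇒n≡0 (subst (_ ≤_) e (h j))))

-- Lower sets on the axes, given by their heights, and compositions

axisPts : ∀ {d} → Point d → List (Point d)
axisPts []      = [] ∷ []
axisPts (a ∷ v) = map (λ k → suc k ∷ 𝟎) (upTo a) ++ map (0 ∷_) (axisPts v)

length-axisPts : ∀ {d} (a : Point d) → length (axisPts a) ≡ suc (sum a)
length-axisPts []      = refl
length-axisPts (a ∷ v) = trans (List.length-++ (map (λ k → suc k ∷ 𝟎) (upTo a)))
  (trans (cong₂ _+_ (trans (List.length-map _ (upTo a)) (List.length-upTo a)) (trans (List.length-map _ (axisPts v)) (length-axisPts v)))
    (ℕ.+-suc a (sum v)))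

axisPts-unique : ∀ {d} (a : Point d) → Unique (axisPts a)
axisPts-unique []      = [] ∷ []
axisPts-unique (a ∷ v) = Unique.++⁺ (Unique.map⁺ (ℕ.suc-injective ∘ Vec.∷-injectiveˡ) (Unique.upTo⁺ a))
  (Unique.map⁺ Vec.∷-injectiveʳ (axisPts-unique v)) disj
  where
  disj : ∀ {x} → x ∈ map (λ k → suc k ∷ 𝟎) (upTo a) × x ∈ map (0 ∷_) (axisPts v) → ⊥
  disj (l , r) with _ , _ , refl ← ∈-map⁻ _ l | _ , _ , () ← ∈-map⁻ _ r

𝟎∈axisPts : ∀ {d} (a : Point d) → 𝟎 ∈ axisPts a
𝟎∈axisPts []      = here refl
𝟎∈axisPts (a ∷ v) = ∈-++⁺ʳ _ (∈-map⁺ (0 ∷_) (𝟎∈axisPts v))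

∈-axisPts⁺ : ∀ {d} (a : Point d) i {k} → k < lookup a i → axis i (suc k) ∈ axisPts a
∈-axisPts⁺ (a ∷ v) Fin.zero    h = ∈-++⁺ˡ (∈-map⁺ _ (∈-upTo⁺ h))
∈-axisPts⁺ (a ∷ v) (Fin.suc i) h = ∈-++⁺ʳ _ (∈-map⁺ (0 ∷_) (∈-axisPts⁺ v i h))

∈-axisPts⁻ : ∀ {d} (a : Point d) {x} → x ∈ axisPts a → x ≡ 𝟎 ⊎ ∃₂ λ i k → k < lookup a i × x ≡ axis i (suc k)
∈-axisPts⁻ []      (here e) = inj₁ e
∈-axisPts⁻ (a ∷ v) m with ∈-++⁻ (map (λ k → suc k ∷ 𝟎) (upTo a)) m
... | inj₁ l with k , k∈ , e ← ∈-map⁻ _ l = inj₂ (Fin.zero , k , ∈-upTo⁻ k∈ , e)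
... | inj₂ r with y , y∈ , refl ← ∈-map⁻ (0 ∷_) r with ∈-axisPts⁻ v y∈
...   | inj₁ e               = inj₁ (cong (0 ∷_) e)
...   | inj₂ (i , k , h , e) = inj₂ (Fin.suc i , k , h , cong (0 ∷_) e)

axis∈axisPts⁻ : ∀ {d} (a : Point d) i {k} → axis i (suc k) ∈ axisPts a → k < lookup a i
axis∈axisPts⁻ a i {k} m with ∈-axisPts⁻ a m
... | inj₁ e with () ← trans (sym (lookup-axis i (suc k))) (trans (cong (λ y → lookup y i) e) (lookup-𝟎 i))
... | inj₂ (j , k′ , h , e) with j Fin.≟ i
...   | no j≢i with () ← trans (sym (lookup-axis i (suc k))) (trans (cong (λ y → lookup y i) e) (lookup-axis-≢ j i (suc k′) j≢i))
...   | yes refl with refl ← trans (sym (lookup-axis i (suc k))) (trans (cong (λ y → lookup y i) e) (lookup-axis i (suc k′))) = h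

axisPts-lower : ∀ {d} (a : Point d) → IsLowerSet (_∈ axisPts a)
axisPts-lower a {x′ = x′} m h with ∈-axisPts⁻ a m
... | inj₁ refl = subst (_∈ axisPts a) (sym (≼-𝟎 {x = x′} h)) (𝟎∈axisPts a)
... | inj₂ (i , k , k<a , refl) with ≼-axis i (suc k) {x′} h
...   | zero   , _  , refl = subst (_∈ axisPts a) (sym (axis-0 i)) (𝟎∈axisPts a)
...   | suc k′ , k′≤k , refl = ∈-axisPts⁺ a i (ℕ.≤-trans k′≤k k<a)

incHead : ∀ {d} → Point (suc d) → Point (suc d)
incHead (a ∷ v) = suc a ∷ v

-- Split by whether the first part is 0; the two cases are the two terms of Pascal's rule in
-- `length-compositions`.
compositions : ∀ (d s : ℕ) → List (Point d)
compositions zero    zero    = [] ∷ []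
compositions zero    (suc s) = []
compositions (suc d) zero    = 𝟎 ∷ []
compositions (suc d) (suc s) = map (0 ∷_) (compositions d (suc s)) ++ map incHead (compositions (suc d) s)

length-compositions : ∀ d s → length (compositions (suc d) s) ≡ (d + s) C d
length-compositions d       zero    = sym (trans (cong (_C d) (ℕ.+-identityʳ d)) (nCn≡1 d))
length-compositions zero    (suc s) = trans (List.length-map _ (compositions 1 s)) (length-compositions zero s)
length-compositions (suc d) (suc s) = trans (List.length-++ (map (0 ∷_) (compositions (suc d) (suc s))))
  (trans (cong₂ _+_ (trans (List.length-map _ (compositions (suc d) (suc s))) (length-compositions d (suc s)))
                    (trans (List.length-map _ (compositions (suc (suc d)) s))
                      (trans (length-compositions (suc d) s) (cong (_C suc d) (sym (ℕ.+-suc d s))))))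
    (nCk+nC[k+1]≡[n+1]C[k+1] (d + suc s) d))

∈-compositions⁺ : ∀ {d s} (a : Point d) → sum a ≡ s → a ∈ compositions d s
∈-compositions⁺ {s = zero}  []          e = here refl
∈-compositions⁺ {s = zero}  (a ∷ v)     e = here (sum≡0 (a ∷ v) e)
∈-compositions⁺ {s = suc s} (zero ∷ v)  e = ∈-++⁺ˡ (∈-map⁺ (0 ∷_) (∈-compositions⁺ v e))
∈-compositions⁺ {s = suc s} (suc a ∷ v) e = ∈-++⁺ʳ _ (∈-map⁺ _ (∈-compositions⁺ (a ∷ v) (ℕ.suc-injective e)))

∈-compositions⁻ : ∀ d s {a} → a ∈ compositions d s → sum a ≡ s
∈-compositions⁻ zero    zero    (here refl) = refl
∈-compositions⁻ (suc d) zero    (here refl) = sum-𝟎 d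
∈-compositions⁻ (suc d) (suc s) m with ∈-++⁻ (map (0 ∷_) (compositions d (suc s))) m
... | inj₁ l with v , v∈ , refl ← ∈-map⁻ (0 ∷_) l = ∈-compositions⁻ d (suc s) v∈
... | inj₂ r with a ∷ v , av∈ , refl ← ∈-map⁻ _ r = cong suc (∈-compositions⁻ (suc d) s av∈)

compositions-unique : ∀ d s → Unique (compositions d s)
compositions-unique zero    zero    = [] ∷ []
compositions-unique zero    (suc s) = []
compositions-unique (suc d) zero    = [] ∷ []
compositions-unique (suc d) (suc s) = Unique.++⁺ (Unique.map⁺ Vec.∷-injectiveʳ (compositions-unique d (suc s)))
  (Unique.map⁺ (λ { {_ ∷ _} {_ ∷ _} refl → refl }) (compositions-unique (suc d) s)) disj
  where
  disj : ∀ {x} → x ∈ map (0 ∷_) (compositions d (suc s)) × x ∈ map incHead (compositions (suc d) s) → ⊥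
  disj (l , r) with _ , _ , refl ← ∈-map⁻ _ l | (_ ∷ _) , _ , () ← ∈-map⁻ _ r

binom≤p : ∀ d n → (d + n) C d ≤ p (suc d) (suc n)
binom≤p d n = subst (_≤ p (suc d) (suc n)) (length-compositions d n)
  (≤-p (suc d) (suc n) (compositions-unique (suc d) n)
    (λ {a} m → ofList (suc d) (suc n) (axisPts a) (axisPts-unique a)
       (trans (length-axisPts a) (cong suc (∈-compositions⁻ (suc d) n m))) (axisPts-lower a))
    (λ {a} {b} _ _ e → ≼-antisym a b (λ i → incl a b i (λ x → ⇒ (e x))) (λ i → incl b a i (λ x → ⇐ (e x)))))
  where
  incl : ∀ (a b : Point (suc d)) i → (∀ x → x ∈ axisPts a → x ∈ axisPts b) → lookup a i ≤ lookup b i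
  incl a b i sub with lookup a i in eq
  ... | zero  = z≤n
  -- The topmost point of `axisPts a` on axis i bounds the height of b there.
  ... | suc k = axis∈axisPts⁻ b i (sub _ (∈-axisPts⁺ a i (ℕ.≤-reflexive (sym eq))))
  ≼-antisym : ∀ {e} (a b : Point e) → a ≼ b → b ≼ a → a ≡ b
  ≼-antisym []      []      h k = refl
  ≼-antisym (_ ∷ a) (_ ∷ b) h k = cong₂ _∷_ (ℕ.≤-antisym (h Fin.zero) (k Fin.zero)) (≼-antisym a b (h ∘ Fin.suc) (k ∘ Fin.suc))

-- The recursion for `p` behind the upper bound of (a)

threshold : (Q : ℕ → Set) → Decidable Q → (∀ {k l} → k ≤ l → Q l → Q k) → ∀ N → (∀ {k} → Q k → k < N) →
            ∃ λ a → ∀ k → Q k ⇔ k < a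
threshold Q Q? down zero    bd = 0 , λ k → mk⇔ bd (λ ())
threshold Q Q? down (suc N) bd with Q? N
... | yes q = suc N , λ k → mk⇔ bd (λ { (s≤s k≤N) → down k≤N q })
... | no ¬q = threshold Q Q? down N λ {k} q → ℕ.≤∧≢⇒< (ℕ.≤-pred (bd q)) (λ { refl → ¬q q })

-- `P` and `Q` may overlap, so the maximum is compared only with points for which `cover` did not
-- choose `P`; `decodable` rules that choice out for off-axis points.
largest : ∀ {A : Set} {P Q : A → Set} (h : A → ℕ) → (∀ x → P x ⊎ Q x) → ∀ xs →
          (∀ {x} → x ∈ xs → P x) ⊎ ∃ λ x → x ∈ xs × Q x × (∀ {y} → y ∈ xs → P y ⊎ h y ≤ h x)
largest h cover []       = inj₁ λ ()
largest h cover (x ∷ xs) with cover x | largest h cover xs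
... | inj₁ px | inj₁ all = inj₁ λ { (here refl) → px ; (there m) → all m }
... | inj₂ qx | inj₁ all = inj₂ (x , here refl , qx , λ { (here refl) → inj₂ ℕ.≤-refl ; (there m) → inj₁ (all m) })
... | inj₁ px | inj₂ (y , y∈ , qy , max) = inj₂ (y , there y∈ , qy , λ { (here refl) → inj₁ px ; (there m) → max m })
... | inj₂ qx | inj₂ (y , y∈ , qy , max) with ℕ.≤-total (h x) (h y)
...   | inj₁ x≤y = inj₂ (y , there y∈ , qy , λ { (here refl) → inj₂ x≤y ; (there m) → max m })
...   | inj₂ y≤x = inj₂ (x , here refl , qx , λ { (here refl) → inj₂ ℕ.≤-refl ; (there m) → up (max m) })
  where
  up : ∀ {z} → _ ⊎ h z ≤ h y → _ ⊎ h z ≤ h x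
  up (inj₁ pz)  = inj₁ pz
  up (inj₂ z≤y) = inj₂ (ℕ.≤-trans z≤y y≤x)

∈-choose-2 : ∀ {A : Set} {x y : A} {zs} → x ∈ zs → y ∈ zs → x ≢ y → (x ∷ y ∷ []) ∈ choose 2 zs ⊎ (y ∷ x ∷ []) ∈ choose 2 zs
∈-choose-2 (here refl) (here refl) x≢y = ⊥-elim (x≢y refl)
∈-choose-2 (here refl) (there y∈)  x≢y = inj₁ (∈-++⁺ˡ (∈-map⁺ _ (∈-choose-1 y∈)))
  where
  ∈-choose-1 : ∀ {A : Set} {y : A} {zs} → y ∈ zs → (y ∷ []) ∈ choose 1 zs
  ∈-choose-1 (here refl) = here refl
  ∈-choose-1 (there m)   = there (∈-choose-1 m)
∈-choose-2 (there x∈)  (here refl) x≢y with ∈-choose-2 (here refl) (there x∈) (x≢y ∘ sym)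
... | inj₁ m = inj₂ m
... | inj₂ m = inj₁ m
∈-choose-2 (there x∈) (there y∈) x≢y with ∈-choose-2 x∈ y∈ x≢y
... | inj₁ m = inj₁ (∈-++⁺ʳ _ m)
... | inj₂ m = inj₂ (∈-++⁺ʳ _ m)

𝟎∈lowerLists : ∀ d n {ys} → ys ∈ lowerLists d (suc n) → 𝟎 ∈ ys
𝟎∈lowerLists d n {[]}     m with () ← lowerLists-length d (suc n) m
𝟎∈lowerLists d n {y ∷ ys} m = lowerLists-lower d (suc n) m (here refl) (𝟎-≼ {x = y})

-- The value 𝟎 is a default; the codes apply this to two-element lists only.
pairSum : ∀ {d} → List (Point d) → Point d
pairSum (y ∷ z ∷ _) = y ⊕ z
pairSum _           = 𝟎

module _ (d n : ℕ) where
  private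
    -- Either the heights on the axes, or a lower set with one point less together with the pair
    -- whose sum is added. Some codes of the second kind may decode to no lower set, which is
    -- harmless for an upper bound.
    Code = Point d ⊎ (List (Point d) × List (Point d))

    extensions : List (List (Point d) × List (Point d))
    extensions = concatMap (λ T → map (T ,_) (choose 2 T)) (lowerLists d n)

    codes : List Code
    codes = map inj₁ (compositions d n) ++ map inj₂ extensions

    decode : Code → List (Point d)
    decode (inj₁ a)        = axisPts a
    decode (inj₂ (T , yz)) = pairSum yz ∷ T

    length-codes : length codes ≡ length (compositions d n) + p d n * (n C 2)
    length-codes = trans (List.length-++ (map inj₁ (compositions d n)))
      (cong₂ _+_ (List.length-map inj₁ (compositions d n)) (trans (List.length-map inj₂ extensions)
        (length-concatMap _ (n C 2) (lowerLists d n) λ {T} T∈ →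
          trans (List.length-map (T ,_) (choose 2 T)) (trans (length-choose 2 T) (cong (_C 2) (lowerLists-length d n T∈))))))

  module _ {ys : List (Point d)} (ys∈ : ys ∈ lowerLists d (suc n)) where
    private
      ys-lower : IsLowerSet (_∈ ys)
      ys-lower = lowerLists-lower d (suc n) ys∈

      onAxes : (∀ {x} → x ∈ ys → x ≡ 𝟎 ⊎ ∃₂ λ i k → x ≡ axis i (suc k)) →
               ∃ λ b → b ∈ codes × (∀ x → x ∈ ys ⇔ x ∈ decode b)
      onAxes all = inj₁ a , ∈-++⁺ˡ (∈-map⁺ inj₁ (∈-compositions⁺ a sum-a)) , λ x → mk⇔ (to x) (from x)
        where
        height : ∀ i → ∃ λ a → ∀ k → axis i (suc k) ∈ ys ⇔ k < a
        height i = threshold (λ k → axis i (suc k) ∈ ys) (λ k → axis i (suc k) ∈? ys)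
          (λ {k} {l} k≤l m → ys-lower m (axis-≼ i (s≤s k≤l))) n
          (λ {k} m → ℕ.≤-pred (subst (_< suc n) (lookup-axis i (suc k))
            (∈-box⁻ (choose-⊆ (suc n) (box d (suc n)) (lowerLists⇒choose d (suc n) ys∈) m) i)))
        a : Point d
        a = Vec.tabulate (proj₁ ∘ height)
        lookup-a : ∀ i → lookup a i ≡ proj₁ (height i)
        lookup-a i = Vec.lookup∘tabulate (proj₁ ∘ height) i
        to : ∀ x → x ∈ ys → x ∈ axisPts a
        to x m with all m
        ... | inj₁ refl           = 𝟎∈axisPts a
        ... | inj₂ (i , k , refl) = ∈-axisPts⁺ a i (subst (k <_) (sym (lookup-a i)) (⇒ (proj₂ (height i) k) m))
        from : ∀ x → x ∈ axisPts a → x ∈ ys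
        from x m with ∈-axisPts⁻ a m
        ... | inj₁ refl               = 𝟎∈lowerLists d n ys∈
        ... | inj₂ (i , k , h , refl) = ⇐ (proj₂ (height i) k) (subst (k <_) (lookup-a i) h)
        -- Read off from cardinalities: `axisPts a` has `suc (sum a)` elements and the same members
        -- as `ys`.
        sum-a : sum a ≡ n
        sum-a = ℕ.suc-injective (trans (sym (length-axisPts a)) (trans
          (ℕ.≤-antisym (unique-≤ (axisPts-unique a) (λ {x} → from x)) (unique-≤ (lowerLists-Unique d (suc n) ys∈) (λ {x} → to x)))
          (lowerLists-length d (suc n) ys∈)))

      -- A point of maximal height among the off-axis ones is maximal in ys, since every point above it is off-axis.
      extension : ∀ x → x ∈ ys → OffAxis x → (∀ {y} → y ∈ ys → OffAxis y → sum y ≤ sum x) →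
                  ∃ λ b → b ∈ codes × (∀ x → x ∈ ys ⇔ x ∈ decode b)
      extension x x∈ off max = code (∈-choose-2 left∈ right∈ left≢right)
        where
        s = proj₁ (offAxis-split off)
        left≢right = proj₂ (offAxis-split off)
        open Split s
        ≢x? = λ y → ¬? (y ≟ₚ x)
        rest = filter ≢x? ys
        rest-Unique : Unique rest
        rest-Unique = Unique.filter⁺ ≢x? (lowerLists-Unique d (suc n) ys∈)
        ∈-rest⁺ : ∀ {y} → y ∈ ys → y ≢ x → y ∈ rest
        ∈-rest⁺ = ∈-filter⁺ ≢x?
        ∈-rest⁻ : ∀ {y} → y ∈ rest → y ∈ ys × y ≢ x
        ∈-rest⁻ = ∈-filter⁻ ≢x? {xs = ys}
        to : ∀ {y} → y ∈ ys → y ∈ x ∷ rest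
        to {y} m with y ≟ₚ x
        ... | yes refl = here refl
        ... | no  y≢x  = there (∈-rest⁺ m y≢x)
        from : ∀ {y} → y ∈ x ∷ rest → y ∈ ys
        from (here refl) = x∈
        from (there m)   = proj₁ (∈-rest⁻ m)
        length-rest : length rest ≡ n
        length-rest = ℕ.suc-injective (trans
          (ℕ.≤-antisym (unique-≤ (All.tabulate (λ m e → proj₂ (∈-rest⁻ m) (sym e)) ∷ rest-Unique) from)
                       (unique-≤ (lowerLists-Unique d (suc n) ys∈) to))
          (lowerLists-length d (suc n) ys∈))
        rest-lower : IsLowerSet (_∈ rest)
        rest-lower {y} {y′} m h = ∈-rest⁺ (ys-lower (proj₁ (∈-rest⁻ m)) h) λ { refl →
          proj₂ (∈-rest⁻ m) (sym (≼-sum-≡ x y h (max (proj₁ (∈-rest⁻ m)) (offAxis-≼ {x = x} {y} off h)))) }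
        R : LowerSet d n
        R = ofList d n rest rest-Unique length-rest rest-lower
        -- The codes range over `lowerLists`, so `rest` is replaced by the listed representative
        -- with the same members.
        T = canon R
        left∈ : left ∈ T
        left∈ = ⇒ (∈-canon R left) (∈-rest⁺ (ys-lower x∈ left≼) left≢)
        right∈ : right ∈ T
        right∈ = ⇒ (∈-canon R right) (∈-rest⁺ (ys-lower x∈ right≼) right≢)
        code-at : ∀ {yz} → yz ∈ choose 2 T → pairSum yz ≡ x → ∃ λ b → b ∈ codes × (∀ x → x ∈ ys ⇔ x ∈ decode b)
        code-at {yz} m e = inj₂ (T , yz)
          , ∈-++⁺ʳ (map inj₁ (compositions d n)) (∈-map⁺ inj₂ (∈-concatMap⁺ _ (Any.map (λ { refl → ∈-map⁺ (T ,_) m }) (canon-∈ R))))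
          , λ y → mk⇔ (λ m → there′ (to m)) (λ m → from (there″ m))
          where
          there′ : ∀ {y} → y ∈ x ∷ rest → y ∈ pairSum yz ∷ T
          there′ (here refl) = here (sym e)
          there′ (there m)   = there (⇒ (∈-canon R _) m)
          there″ : ∀ {y} → y ∈ pairSum yz ∷ T → y ∈ x ∷ rest
          there″ (here refl) = here e
          there″ (there m)   = there (⇐ (∈-canon R _) m)
        code : (left ∷ right ∷ []) ∈ choose 2 T ⊎ (right ∷ left ∷ []) ∈ choose 2 T →
               ∃ λ b → b ∈ codes × (∀ x → x ∈ ys ⇔ x ∈ decode b)
        code (inj₁ m) = code-at m left⊕right
        code (inj₂ m) = code-at m (trans (⊕-comm right left) left⊕right)

      axes? : (x : Point d) → (x ≡ 𝟎 ⊎ ∃₂ λ i k → x ≡ axis i (suc k)) ⊎ OffAxis x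
      axes? x with position x
      ... | origin e              = inj₁ (inj₁ e)
      ... | onAxis i k e          = inj₁ (inj₂ (i , k , e))
      ... | offAxis i j i≢j pi pj = inj₂ (i , j , i≢j , pi , pj)

    decodable : ∃ λ b → b ∈ codes × (∀ x → x ∈ ys ⇔ x ∈ decode b)
    decodable with largest sum axes? ys
    ... | inj₁ all                 = onAxes all
    ... | inj₂ (x , x∈ , off , max) = extension x x∈ off λ m off′ → bound off′ (max m)
      where
      bound : ∀ {y : Point d} {h} → OffAxis y → (y ≡ 𝟎 ⊎ ∃₂ λ i k → y ≡ axis i (suc k)) ⊎ sum y ≤ h → sum y ≤ h
      bound off (inj₂ l)                    = l
      bound off@(i , _) (inj₁ (inj₁ e))     = ⊥-elim (offAxis≢axis off i 0 (trans e (sym (axis-0 i))))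
      bound off (inj₁ (inj₂ (i , k , e)))   = ⊥-elim (offAxis≢axis off i (suc k) e)

  p-suc≤ : p d (suc n) ≤ length (compositions d n) + p d n * (n C 2)
  p-suc≤ = subst (p d (suc n) ≤_) length-codes (p-≤ d (suc n) codes decode decodable)

-- The ratio of `p` to the binomial coefficient

C-sym : ∀ a b → (a + b) C a ≡ (a + b) C b
C-sym a b = trans (nCk≡nC[n∸k] (ℕ.m≤m+n a b)) (cong ((a + b) C_) (ℕ.m+n∸m≡n a b))

-- The exact ratio of these binomials is (d+m+1)/(m+1); its numerator is weakened to d+1.
C-ratio : ∀ d m → suc d * ((d + m) C d) ≤ suc m * ((d + suc m) C d)
C-ratio d m = begin
  suc d * ((d + m) C d)             ≡⟨ cong (suc d *_) (C-sym d m) ⟩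
  suc d * ((d + m) C m)             ≤⟨ ℕ.*-monoˡ-≤ ((d + m) C m) (s≤s (ℕ.m≤m+n d m)) ⟩
  suc (d + m) * ((d + m) C m)       ≡⟨ C-absorb (d + m) m ⟨
  suc m * (suc (d + m) C suc m)     ≡⟨ cong (λ k → suc m * (k C suc m)) (ℕ.+-suc d m) ⟨
  suc m * ((d + suc m) C suc m)     ≡⟨ cong (suc m *_) (C-sym d (suc m)) ⟨
  suc m * ((d + suc m) C d)         ∎
  where open ℕ.≤-Reasoning

2*C2 : ∀ n → 2 * (suc n C 2) ≡ suc n * n
2*C2 n = trans (C-absorb n 1) (cong (suc n *_) (nC1≡n n))

-- The upper bound of (a) without denominators. N stands for the difference and stays fixed while n
-- drops, since the hypothesis for fewer points is weaker. The recursion adds C(n,2) times the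
-- previous count; by induction and `C-ratio` this costs at most n(n-1)n ≤ n³ binomials, and n³ <
-- (n+1)³ makes the inequality strict.
p*[2d∸n³]<2d*binom : ∀ d n N → N + suc n ^ 3 ≤ 2 * suc d → p (suc d) (suc n) * N < 2 * suc d * ((d + n) C d)
p*[2d∸n³]<2d*binom d n N h = begin-strict
  p (suc d) (suc n) * N        ≤⟨ ℕ.*-monoˡ-≤ N (p-suc≤ (suc d) n) ⟩
  (length (compositions (suc d) n) + q * (n C 2)) * N ≡⟨ cong (λ z → (z + q * (n C 2)) * N) (length-compositions d n) ⟩
  (A + q * (n C 2)) * N        ≡⟨ expand A q (n C 2) N ⟩
  A * N + (n C 2) * (q * N)    ≤⟨ ℕ.+-monoʳ-≤ (A * N) (step n h) ⟩
  A * N + n * n * n * A        <⟨ ℕ.+-monoʳ-< (A * N) (ℕ.*-monoˡ-< A (cube n)) ⟩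
  A * N + suc n ^ 3 * A        ≡⟨ collect A N (suc n ^ 3) ⟩
  (N + suc n ^ 3) * A          ≤⟨ ℕ.*-monoˡ-≤ A h ⟩
  2 * suc d * A                ∎
  where
  open ℕ.≤-Reasoning
  A = (d + n) C d
  q = p (suc d) n
  instance
    A≢0 : NonZero A
    A≢0 = subst (λ k → NonZero (k C d)) (cong (_∸ 1) (ℕ.+-suc d n)) (binom≢0 (suc d) (suc n))
  expand : ∀ a q c n → (a + q * c) * n ≡ a * n + c * (q * n)
  expand = solve-∀
  collect : ∀ a n c → a * n + c * a ≡ (n + c) * a
  collect = solve-∀
  cube : ∀ n → n * n * n < suc n ^ 3
  cube n = subst (n * n * n <_) (sym (eq n)) (ℕ.m≤m+n (suc (n * n * n)) _)
    where
    eq : ∀ n → suc n * (suc n * (suc n * 1)) ≡ suc (n * n * n) + (3 * n * n + 3 * n)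
    eq = solve-∀
  step : ∀ n → N + suc n ^ 3 ≤ 2 * suc d → (n C 2) * (p (suc d) n * N) ≤ n * n * n * ((d + n) C d)
  step zero    h = z≤n
  step (suc m) h = begin
    c * (p (suc d) (suc m) * N)                 ≤⟨ ℕ.*-monoʳ-≤ c (ℕ.<⇒≤ (p*[2d∸n³]<2d*binom d m N (ℕ.≤-trans (ℕ.+-monoʳ-≤ N (ℕ.^-monoˡ-≤ 3 (ℕ.n≤1+n (suc m)))) h))) ⟩
    c * (2 * suc d * ((d + m) C d))             ≡⟨ r₁ c (suc d) _ ⟩
    2 * c * (suc d * ((d + m) C d))             ≡⟨ cong (_* (suc d * ((d + m) C d))) (2*C2 m) ⟩
    suc m * m * (suc d * ((d + m) C d))         ≤⟨ ℕ.*-mono-≤ (ℕ.*-monoʳ-≤ (suc m) (ℕ.n≤1+n m)) (C-ratio d m) ⟩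
    suc m * suc m * (suc m * ((d + suc m) C d)) ≡⟨ ℕ.*-assoc (suc m * suc m) (suc m) _ ⟨
    suc m * suc m * suc m * ((d + suc m) C d)   ∎
    where
    c = suc m C 2
    r₁ : ∀ c d x → c * (2 * d * x) ≡ 2 * c * (d * x)
    r₁ = solve-∀

/-cancel : ∀ a b .{{_ : NonZero b}} → (+ a / b) ℚ.* fromℕ b ≡ fromℕ a
/-cancel a (suc b) = ℚ.toℚᵘ-injective (ℚᵘ.≃-trans (ℚ.toℚᵘ-homo-* (+ a / suc b) (fromℕ (suc b)))
  (ℚᵘ.≃-trans (ℚᵘ.*-cong (ℚ.toℚᵘ-fromℚᵘ (ℚᵘ.mkℚᵘ (+ a) b)) (ℚ.toℚᵘ-fromℚᵘ (ℚᵘ.mkℚᵘ (+ suc b) 0)))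
    (ℚᵘ.≃-trans (ℚᵘ.*≡* (trans (cong (ℤ._* + 1) (sym (ℤ.pos-* a (suc b)))) (trans (sym (ℤ.pos-* (a * suc b) 1)) (trans (cong +_ eq) (ℤ.pos-* a (suc b * 1))))))
      (ℚᵘ.≃-sym (ℚ.toℚᵘ-fromℚᵘ (ℚᵘ.mkℚᵘ (+ a) 0))))))
  where
  eq : a * suc b * 1 ≡ a * (suc b * 1)
  eq = ℕ.*-assoc a (suc b) 1

fromℕ-+ : ∀ a b → fromℕ (a + b) ≡ fromℕ a ℚ.+ fromℕ b
fromℕ-+ a b = sym (ℚ.toℚᵘ-injective (ℚᵘ.≃-trans (ℚ.toℚᵘ-homo-+ (fromℕ a) (fromℕ b))
  (ℚᵘ.≃-trans (ℚᵘ.+-cong (ℚ.toℚᵘ-fromℚᵘ (ℚᵘ.mkℚᵘ (+ a) 0)) (ℚ.toℚᵘ-fromℚᵘ (ℚᵘ.mkℚᵘ (+ b) 0)))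
    (ℚᵘ.≃-trans (ℚᵘ.*≡* (cong (ℤ._* + 1) (cong₂ ℤ._+_ (ℤ.*-identityʳ (+ a)) (ℤ.*-identityʳ (+ b)))))
      (ℚᵘ.≃-sym (ℚ.toℚᵘ-fromℚᵘ (ℚᵘ.mkℚᵘ (+ (a + b)) 0)))))))

fromℕ-* : ∀ a b → fromℕ (a * b) ≡ fromℕ a ℚ.* fromℕ b
fromℕ-* a b = sym (ℚ.toℚᵘ-injective (ℚᵘ.≃-trans (ℚ.toℚᵘ-homo-* (fromℕ a) (fromℕ b))
  (ℚᵘ.≃-trans (ℚᵘ.*-cong (ℚ.toℚᵘ-fromℚᵘ (ℚᵘ.mkℚᵘ (+ a) 0)) (ℚ.toℚᵘ-fromℚᵘ (ℚᵘ.mkℚᵘ (+ b) 0)))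
    (ℚᵘ.≃-trans (ℚᵘ.*≡* (cong (ℤ._* + 1) (sym (ℤ.pos-* a b))))
      (ℚᵘ.≃-sym (ℚ.toℚᵘ-fromℚᵘ (ℚᵘ.mkℚᵘ (+ (a * b)) 0)))))))

fromℕ-mono-≤ : ∀ {a b} → a ≤ b → fromℕ a ℚ.≤ fromℕ b
fromℕ-mono-≤ {a} {b} h = ℚ.toℚᵘ-cancel-≤ (ℚᵘ.≤-respˡ-≃ (ℚᵘ.≃-sym (ℚ.toℚᵘ-fromℚᵘ (ℚᵘ.mkℚᵘ (+ a) 0)))
  (ℚᵘ.≤-respʳ-≃ (ℚᵘ.≃-sym (ℚ.toℚᵘ-fromℚᵘ (ℚᵘ.mkℚᵘ (+ b) 0))) (ℚᵘ.*≤* (ℤ.*-monoʳ-≤-nonNeg (+ 1) (ℤ.+≤+ h)))))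

fromℕ-mono-< : ∀ {a b} → a < b → fromℕ a ℚ.< fromℕ b
fromℕ-mono-< {a} {b} h = ℚ.toℚᵘ-cancel-< (ℚᵘ.<-respˡ-≃ (ℚᵘ.≃-sym (ℚ.toℚᵘ-fromℚᵘ (ℚᵘ.mkℚᵘ (+ a) 0)))
  (ℚᵘ.<-respʳ-≃ (ℚᵘ.≃-sym (ℚ.toℚᵘ-fromℚᵘ (ℚᵘ.mkℚᵘ (+ b) 0))) (ℚᵘ.*<* (ℤ.*-monoʳ-<-pos (+ 1) (ℤ.+<+ h)))))

fromℕ-cancel-≤ : ∀ {a b} → fromℕ a ℚ.≤ fromℕ b → a ≤ b
fromℕ-cancel-≤ h = ℕ.≮⇒≥ (λ l → ℚ.<-irrefl refl (ℚ.<-≤-trans (fromℕ-mono-< l) h))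

fromℕ-cancel-< : ∀ {a b} → fromℕ a ℚ.< fromℕ b → a < b
fromℕ-cancel-< h = ℕ.≰⇒> (λ l → ℚ.<-irrefl refl (ℚ.<-≤-trans h (fromℕ-mono-≤ l)))

fromℕ-nonNeg : ∀ a → ℚ.NonNegative (fromℕ a)
fromℕ-nonNeg a = ℚ.nonNegative (fromℕ-mono-≤ {0} {a} z≤n)

fromℕ-pos : ∀ a .{{_ : NonZero a}} → ℚ.Positive (fromℕ a)
fromℕ-pos a = ℚ.positive (fromℕ-mono-< {0} {a} (ℕ.>-nonZero⁻¹ a))

1≤/ : ∀ {a b} .{{_ : NonZero b}} → b ≤ a → 1ℚ ℚ.≤ + a / b
1≤/ {a} {b} h = ℚ.*-cancelʳ-≤-pos (fromℕ b) {{fromℕ-pos b}}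
  (subst₂ ℚ._≤_ (sym (ℚ.*-identityˡ (fromℕ b))) (sym (/-cancel a b)) (fromℕ-mono-≤ h))

theorem2-a : ∀ d n .{{_ : NonZero d}} .{{_ : NonZero n}} → (n³/2<d : + (n ^ 3) / 2 ℚ.< fromℕ d) →
             let ratio = (+ p d n / ((d + n ∸ 2) C (d ∸ 1))) {{binom≢0 d n}}
             in 1ℚ ℚ.≤ ratio × ratio ℚ.< (ℚ.1/ 1-n³/2d d n) {{1-n³/2d≢0 d n n³/2<d}}
theorem2-a (suc d) (suc n) h = 1≤/ {{B≢0}} B≤p , ratio<
  where
  instance
    B≢0 : NonZero ((suc d + suc n ∸ 2) C d)
    B≢0 = binom≢0 (suc d) (suc n)
  B = (suc d + suc n ∸ 2) C d
  B≡ : B ≡ (d + n) C d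
  B≡ = cong (λ k → (k ∸ 1) C d) (ℕ.+-suc d n)
  P = p (suc d) (suc n)
  B≤p : B ≤ P
  B≤p = subst (_≤ P) (sym B≡) (binom≤p d n)
  D = 2 * suc d
  n³<D : suc n ^ 3 < D
  n³<D = fromℕ-cancel-< (subst₂ ℚ._<_ (/-cancel (suc n ^ 3) 2)
    (trans (sym (fromℕ-* (suc d) 2)) (cong fromℕ (ℕ.*-comm (suc d) 2)))
    (ℚ.*-monoˡ-<-pos (fromℕ 2) {{fromℕ-pos 2}} h))
  N = D ∸ suc n ^ 3
  N+n³ : N + suc n ^ 3 ≡ D
  N+n³ = ℕ.m∸n+n≡m (ℕ.<⇒≤ n³<D)
  q = 1-n³/2d (suc d) (suc n)
  r = + P / B
  -- Multiplying by 2d turns the factor 1 - n³/(2d) into the natural number N, so the bound on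
  -- `P * N` says that the ratio times this factor is below 1.
  q*D : q ℚ.* fromℕ D ≡ fromℕ N
  q*D = begin
    q ℚ.* fromℕ D                                   ≡⟨ solve 2 (λ x D → (con 1ℚ :- x) :* D := D :- x :* D) refl (+ (suc n ^ 3) / D) (fromℕ D) ⟩
    fromℕ D ℚ.- (+ (suc n ^ 3) / D) ℚ.* fromℕ D     ≡⟨ cong₂ ℚ._-_ (trans (cong fromℕ (sym N+n³)) (fromℕ-+ N (suc n ^ 3))) (/-cancel (suc n ^ 3) D) ⟩
    fromℕ N ℚ.+ fromℕ (suc n ^ 3) ℚ.- fromℕ (suc n ^ 3) ≡⟨ solve 2 (λ x y → x :+ y :- y := x) refl (fromℕ N) (fromℕ (suc n ^ 3)) ⟩
    fromℕ N ∎
    where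
    open ≡-Reasoning
    open +-*-Solver
  q>0 : ℚ.Positive q
  q>0 = ℚ.positive {q} (ℚ.*-cancelʳ-<-nonNeg (fromℕ D) {{fromℕ-nonNeg D}} {0ℚ} {q}
    (subst₂ ℚ._<_ (sym (ℚ.*-zeroˡ (fromℕ D))) (sym q*D) (fromℕ-mono-< (ℕ.m<n⇒0<n∸m n³<D))))
  r*q<1 : r ℚ.* q ℚ.< 1ℚ
  r*q<1 = ℚ.*-cancelʳ-<-nonNeg (fromℕ (D * B)) {{fromℕ-nonNeg (D * B)}} (subst₂ ℚ._<_ left (sym (ℚ.*-identityˡ _))
    (fromℕ-mono-< (subst (λ b → P * N < D * b) (sym B≡) (p*[2d∸n³]<2d*binom d n N (ℕ.≤-reflexive N+n³)))))
    where
    open ≡-Reasoning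
    open +-*-Solver
    left : fromℕ (P * N) ≡ r ℚ.* q ℚ.* fromℕ (D * B)
    left = begin
      fromℕ (P * N)                                ≡⟨ fromℕ-* P N ⟩
      fromℕ P ℚ.* fromℕ N                          ≡⟨ cong₂ ℚ._*_ (/-cancel P B) q*D ⟨
      (r ℚ.* fromℕ B) ℚ.* (q ℚ.* fromℕ D)          ≡⟨ solve 4 (λ r b q d → (r :* b) :* (q :* d) := (r :* q) :* (d :* b)) refl r (fromℕ B) q (fromℕ D) ⟩
      r ℚ.* q ℚ.* (fromℕ D ℚ.* fromℕ B)            ≡⟨ cong (r ℚ.* q ℚ.*_) (fromℕ-* D B) ⟨
      r ℚ.* q ℚ.* fromℕ (D * B)                    ∎
  ratio< : r ℚ.< (ℚ.1/ q) {{1-n³/2d≢0 (suc d) (suc n) h}}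
  ratio< = ℚ.*-cancelʳ-<-nonNeg q {{ℚ.pos⇒nonNeg q {{q>0}}}} {r} {(ℚ.1/ q) {{1-n³/2d≢0 (suc d) (suc n) h}}}
    (subst (r ℚ.* q ℚ.<_) (sym (ℚ.*-inverseˡ q {{1-n³/2d≢0 (suc d) (suc n) h}})) r*q<1)

-- Encoding by slots

-- The default 𝟎 makes an index past the end propose a point already in the list, so such an offer
-- is never accepted.
nth : ∀ {d} → List (Point d) → ℕ → Point d
nth []      j       = 𝟎
nth (x ∷ L) zero    = x
nth (x ∷ L) (suc j) = nth L j

nth-++ : ∀ {d} (L G : List (Point d)) {j} → j < length L → nth (L ++ G) j ≡ nth L j
nth-++ (x ∷ L) G {zero}  h       = refl
nth-++ (x ∷ L) G {suc j} (s≤s h) = nth-++ L G h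

nth-≥ : ∀ {d} (L : List (Point d)) {j} → length L ≤ j → nth L j ≡ 𝟎
nth-≥ []      h       = refl
nth-≥ (x ∷ L) (s≤s h) = nth-≥ L h

nth-∈ : ∀ {d} (L : List (Point d)) j → 𝟎 ∈ L → nth L j ∈ L
nth-∈ L j 𝟎∈ with j ℕ.<? length L
... | no j≮  = subst (_∈ L) (sym (nth-≥ L (ℕ.≮⇒≥ j≮))) 𝟎∈
... | yes j< = go L j<
  where
  go : ∀ L {j} → j < length L → nth L j ∈ L
  go (x ∷ L) {zero}  h       = here refl
  go (x ∷ L) {suc j} (s≤s h) = there (go L h)

∈-nth : ∀ {d} {x : Point d} {L} → x ∈ L → ∃ λ j → j < length L × nth L j ≡ x
∈-nth (here refl) = 0 , s≤s z≤n , refl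
∈-nth (there m) with j , h , e ← ∈-nth m = suc j , s≤s h , e

-- inj₁ i proposes the i-th unit point, inj₂ (j , i) the sum of entries j and i of the list built so far.
Slot : ℕ → Set
Slot d = Fin d ⊎ (ℕ × ℕ)

proposal : ∀ {d} → Slot d → List (Point d) → Point d
proposal (inj₁ i)       L = axis i 1
proposal (inj₂ (j , i)) L = nth L j ⊕ nth L i

pairSlots : ℕ → List (ℕ × ℕ)
pairSlots n = cartesianProduct (upTo n) (upTo n)

slots : ∀ d → ℕ → List (Slot d)
slots d n = map inj₁ (allFin d) ++ map inj₂ (pairSlots n)

length-slots : ∀ d n → length (slots d n) ≡ d + n * n
length-slots d n = trans (List.length-++ (map inj₁ (allFin d)))
  (cong₂ _+_ (trans (List.length-map inj₁ (allFin d)) (List.length-tabulate {n = d} id))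
    (trans (List.length-map inj₂ (pairSlots n)) (trans (length-cartesianProduct (upTo n) (upTo n))
      (cong₂ _*_ (List.length-upTo n) (List.length-upTo n)))))
  where
  length-cartesianProduct : ∀ {A B : Set} (xs : List A) (ys : List B) → length (cartesianProduct xs ys) ≡ length xs * length ys
  length-cartesianProduct []       ys = refl
  length-cartesianProduct (x ∷ xs) ys = trans (List.length-++ (map (x ,_) ys))
    (cong₂ _+_ (List.length-map (x ,_) ys) (length-cartesianProduct xs ys))

-- This order settles the case that entry j is missing when its slot comes up: every later slot has
-- first index at least j, so none of them can lengthen the list.
pairSlots-sorted : ∀ n → AllPairs (λ s t → proj₁ s ≤ proj₁ t) (pairSlots n)
pairSlots-sorted n = go (upTo n) (AllPairs.applyUpTo⁺₁ id n (λ i<j _ → ℕ.<⇒≤ i<j))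
  where
  go : ∀ xs → AllPairs _≤_ xs → AllPairs (λ s t → proj₁ s ≤ proj₁ t) (cartesianProduct xs (upTo n))
  go []       []       = []
  go (x ∷ xs) (a ∷ as) = AllPairs.++⁺
    (AllPairs.map⁺ (AllPairs.applyUpTo⁺₁ id n (λ _ _ → ℕ.≤-refl)))
    (go xs as)
    (All.map⁺ (All.universal (λ _ → below xs a) (upTo n)))
    where
    below : ∀ xs → All.All (x ≤_) xs → All.All (λ t → x ≤ proj₁ t) (cartesianProduct xs (upTo n))
    below []       []       = []
    below (y ∷ xs) (h ∷ hs) = All.++⁺ (All.map⁺ (All.universal (λ _ → h) (upTo n))) (below xs hs)

extend : ∀ {d} → List (Point d) → Slot d → List (Point d)
extend L s = L ++ [ proposal s L ]

module Encoding {d : ℕ} (ys : List (Point d)) where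

  -- Offering the slots ss in turn extends L to F, and c collects the slots whose proposals were accepted.
  data Run : List (Slot d) → List (Point d) → List (Slot d) → List (Point d) → Set where
    done : ∀ {L} → Run [] L [] L
    take : ∀ {s ss L c F} → proposal s L ∈ ys → proposal s L ∉ L → Run ss (extend L s) c F → Run (s ∷ ss) L (s ∷ c) F
    skip : ∀ {s ss L c F} → (proposal s L ∈ ys → proposal s L ∈ L) → Run ss L c F → Run (s ∷ ss) L c F

  run : ∀ ss L → ∃₂ λ c F → Run ss L c F
  run []       L = [] , L , done
  run (s ∷ ss) L with proposal s L ∈? ys | proposal s L ∈? L
  ... | no ∉ys | _      = _ , _ , skip (⊥-elim ∘ ∉ys) (proj₂ (proj₂ (run ss L)))
  ... | yes _  | yes ∈L = _ , _ , skip (λ _ → ∈L) (proj₂ (proj₂ (run ss L)))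
  ... | yes ∈ys | no ∉L = _ , _ , take ∈ys ∉L (proj₂ (proj₂ (run ss (extend L s))))

  run-++ : ∀ {ss ss′ L c c′ L′ F} → Run ss L c L′ → Run ss′ L′ c′ F → Run (ss ++ ss′) L (c ++ c′) F
  run-++ done         r′ = r′
  run-++ (take a b r) r′ = take a b (run-++ r r′)
  run-++ (skip a r)   r′ = skip a (run-++ r r′)

  run-choose : ∀ {ss L c F} → Run ss L c F → c ∈ choose (length c) ss
  run-choose done = here refl
  run-choose (take _ _ r) = ∈-++⁺ˡ (∈-map⁺ _ (run-choose r))
  run-choose {s ∷ ss} {c = []}    (skip _ r) = here refl
  run-choose {s ∷ ss} {c = t ∷ c} (skip _ r) = ∈-++⁺ʳ (map (s ∷_) (choose (length c) ss)) (run-choose r)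

  -- `foldl extend` replays the accepted slots without access to `ys`. Skipped slots leave the list
  -- unchanged, so each accepted slot sees the same list as in the run.
  run-decode : ∀ {ss L c F} → Run ss L c F → F ≡ foldl extend L c
  run-decode done         = refl
  run-decode (take _ _ r) = run-decode r
  run-decode (skip _ r)   = run-decode r

  run-length : ∀ {ss L c F} → Run ss L c F → length F ≡ length L + length c
  run-length done                           = sym (ℕ.+-identityʳ _)
  run-length {L = L} (take {c = c} _ _ r) = trans (run-length r)
    (trans (cong (_+ length c) (List.length-++ L)) (ℕ.+-assoc (length L) 1 (length c)))
  run-length (skip _ r)                     = run-length r

  run-prefix : ∀ {ss L c F} → Run ss L c F → ∃ λ G → F ≡ L ++ G
  run-prefix done = [] , sym (List.++-identityʳ _)
  run-prefix {L = L} (take _ _ r) with G , e ← run-prefix r = _ , trans e (List.++-assoc L _ G)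
  run-prefix (skip _ r) = run-prefix r

  run-⊇ : ∀ {ss L c F} → Run ss L c F → ∀ {x} → x ∈ L → x ∈ F
  run-⊇ r m with G , refl ← run-prefix r = ∈-++⁺ˡ m

  run-⊆ : ∀ {ss L c F} → Run ss L c F → (∀ {x} → x ∈ L → x ∈ ys) → ∀ {x} → x ∈ F → x ∈ ys
  run-⊆ done h = h
  run-⊆ {L = L} (take a _ r) h = run-⊆ r λ m → new (∈-++⁻ L m)
    where
    new : ∀ {x} → x ∈ L ⊎ x ∈ [ _ ] → x ∈ ys
    new (inj₁ m)           = h m
    new (inj₂ (here refl)) = a
  run-⊆ (skip _ r) h = run-⊆ r h

  run-unique : ∀ {ss L c F} → Run ss L c F → Unique L → Unique F
  run-unique done         u = u
  run-unique (take _ b r) u = run-unique r (Unique.++⁺ u ([] ∷ []) λ { (m , here refl) → b m })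
  run-unique (skip _ r)   u = run-unique r u

  run-unit : ∀ {ss L c F i} → Run (map inj₁ ss) L c F → i ∈ ss → axis i 1 ∈ ys → axis i 1 ∈ F
  run-unit {i ∷ ss} {L} (take _ _ r) (here refl) h = run-⊇ r (∈-++⁺ʳ L (here refl))
  run-unit {i ∷ ss}     (skip a r)   (here refl) h = run-⊇ r (a h)
  run-unit {_ ∷ ss}     (take _ _ r) (there m)   h = run-unit r m h
  run-unit {_ ∷ ss}     (skip _ r)   (there m)   h = run-unit r m h

  -- Once the list is too short for the current slot, all later slots propose known points.
  run-stuck : ∀ {ss L c F j} → Run (map inj₂ ss) L c F → All.All (λ s → j ≤ proj₁ s) ss → 𝟎 ∈ L → length L ≤ j → F ≡ L
  run-stuck {[]} done hs 𝟎∈ l = refl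
  run-stuck {(j′ , i) ∷ ss} {L} (take _ ∉L r) (h ∷ hs) 𝟎∈ l = ⊥-elim (∉L (subst (_∈ L)
    (sym (trans (cong (_⊕ nth L i) (nth-≥ L (ℕ.≤-trans l h))) (⊕-identityˡ (nth L i)))) (nth-∈ L i 𝟎∈)))
  run-stuck {_ ∷ ss} (skip _ r) (_ ∷ hs) 𝟎∈ l = run-stuck r hs 𝟎∈ l

  -- If entry j is present when (j, i) is offered, so is entry i ≤ j, and both keep their values in
  -- F because lists grow only at the end. If it is missing, the list is stuck, against j < length
  -- F.
  run-pair : ∀ {ss L c F j i} → AllPairs (λ s t → proj₁ s ≤ proj₁ t) ss → Run (map inj₂ ss) L c F → 𝟎 ∈ L →
             (j , i) ∈ ss → i ≤ j → j < length F → nth F j ⊕ nth F i ∈ ys → nth F j ⊕ nth F i ∈ F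
  run-pair {_ ∷ ss} {L} (_ ∷ as) (take _ _ r) 𝟎∈ (there m) i≤j j<F h = run-pair as r (∈-++⁺ˡ 𝟎∈) m i≤j j<F h
  run-pair {_ ∷ ss}     (_ ∷ as) (skip _ r)   𝟎∈ (there m) i≤j j<F h = run-pair as r 𝟎∈ m i≤j j<F h
  run-pair {(j , i) ∷ ss} {L} {c} {F} (a ∷ as) r 𝟎∈ (here refl) i≤j j<F h with j ℕ.<? length L
  ... | no j≮L = ⊥-elim (j≮L (subst (λ F → j < length F) (run-stuck r (ℕ.≤-refl ∷ a) 𝟎∈ (ℕ.≮⇒≥ j≮L)) j<F))
  ... | yes j<L = subst (_∈ F) (sym same) (hit r)
    where
    same : nth F j ⊕ nth F i ≡ nth L j ⊕ nth L i
    same with G , refl ← run-prefix r = cong₂ _⊕_ (nth-++ L G j<L) (nth-++ L G (ℕ.≤-<-trans i≤j j<L))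
    hit : ∀ {c} → Run (inj₂ (j , i) ∷ map inj₂ ss) L c F → nth L j ⊕ nth L i ∈ F
    hit (take _ _ r) = run-⊇ r (∈-++⁺ʳ L (here refl))
    hit (skip a r)   = run-⊇ r (a (subst (_∈ ys) same h))

-- For k = 0 both summands are the same unit point, which is why the slots must include pairs (j,
-- j).
axis-split : ∀ {d} (i : Fin d) k → Split (axis i (suc (suc k)))
axis-split i k = record
  { left = axis i 1
  ; right = axis i (suc k)
  ; left⊕right = axis-⊕ i 1 (suc k)
  ; left≢𝟎 = axis≢𝟎 0
  ; right≢𝟎 = axis≢𝟎 k
  }
  where
  axis≢𝟎 : ∀ k → axis i (suc k) ≢ 𝟎
  axis≢𝟎 k e with () ← trans (sym (lookup-axis i (suc k))) (trans (cong (λ y → lookup y i) e) (lookup-𝟎 i))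

module _ (d n : ℕ) {ys : List (Point d)} (ys∈ : ys ∈ lowerLists d (suc n)) where
  open Encoding ys
  private
    run₁ = run (map inj₁ (allFin d)) [ 𝟎 ]
    L₁   = proj₁ (proj₂ run₁)
    r₁   = proj₂ (proj₂ run₁)
    run₂ = run (map inj₂ (pairSlots (suc n))) L₁
    F    = proj₁ (proj₂ run₂)
    r₂   = proj₂ (proj₂ run₂)
    c    = proj₁ run₁ ++ proj₁ run₂

    r : Run (slots d (suc n)) [ 𝟎 ] c F
    r = run-++ r₁ r₂

    F⊆ys : ∀ {x} → x ∈ F → x ∈ ys
    F⊆ys = run-⊆ r λ { (here refl) → 𝟎∈lowerLists d n ys∈ }

    F-unique : Unique F
    F-unique = run-unique r ([] ∷ [])

    -- Hence all indices into F are below n+1, and every pair of entries has its slot in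
    -- `pairSlots (suc n)`.
    F≤n : length F ≤ suc n
    F≤n = subst (length F ≤_) (lowerLists-length d (suc n) ys∈) (unique-≤ F-unique F⊆ys)

    closed : ∀ {j i} → i ≤ j → j < length F → nth F j ⊕ nth F i ∈ ys → nth F j ⊕ nth F i ∈ F
    closed i≤j j<F = run-pair (pairSlots-sorted (suc n)) r₂ (run-⊇ r₁ (here refl))
      (∈-cartesianProduct⁺ (∈-upTo⁺ j<n) (∈-upTo⁺ (ℕ.≤-<-trans i≤j j<n))) i≤j j<F
      where j<n = ℕ.<-≤-trans j<F F≤n

    F-closed : ∀ {y z} → y ∈ F → z ∈ F → y ⊕ z ∈ ys → y ⊕ z ∈ F
    F-closed {y} {z} y∈ z∈ h with j , j<F , refl ← ∈-nth y∈ | i , i<F , refl ← ∈-nth z∈ with ℕ.≤-total i j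
    ... | inj₁ i≤j = closed i≤j j<F h
    ... | inj₂ j≤i = subst (_∈ F) (⊕-comm (nth F i) (nth F j))
      (closed j≤i i<F (subst (_∈ ys) (⊕-comm (nth F j) (nth F i)) h))

    ys⊆F : ∀ {x} → x ∈ ys → x ∈ F
    ys⊆F {x} m = <-rec (λ h → ∀ x → sum x ≡ h → x ∈ ys → x ∈ F) step (sum x) x refl m
      where
      step : ∀ h → (∀ {h′} → h′ < h → ∀ x → sum x ≡ h′ → x ∈ ys → x ∈ F) → ∀ x → sum x ≡ h → x ∈ ys → x ∈ F
      step _ rec x refl m = go (position x)
        where
        smaller : ∀ y → y ≼ x → y ≢ x → y ∈ F
        smaller y y≼x y≢x = rec (ℕ.≰⇒> (y≢x ∘ ≼-sum-≡ y x y≼x)) y refl (lowerLists-lower d (suc n) ys∈ m y≼x)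
        sums : Split x → x ∈ F
        sums s = subst (_∈ F) left⊕right
          (F-closed (smaller left left≼ left≢) (smaller right right≼ right≢) (subst (_∈ ys) (sym left⊕right) m))
          where open Split s
        go : Position x → x ∈ F
        go (origin e)            = run-⊇ r (here e)
        go (onAxis i zero e)     = subst (_∈ F) (sym e) (run-⊇ r₂ (run-unit r₁ (∈-allFin i) (subst (_∈ ys) e m)))
        go (onAxis i (suc k) e)  = sums (subst Split (sym e) (axis-split i k))
        go (offAxis i j i≢j p q) = sums (proj₁ (offAxis-split (i , j , i≢j , p , q)))

    -- The origin starts the list without a slot, so n accepted slots make n+1 points.
    length-c : length c ≡ n
    length-c = ℕ.suc-injective (trans (sym (run-length r)) (trans
      (ℕ.≤-antisym (unique-≤ F-unique F⊆ys) (unique-≤ (lowerLists-Unique d (suc n) ys∈) ys⊆F))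
      (lowerLists-length d (suc n) ys∈)))

  encodable : ∃ λ c → c ∈ choose n (slots d (suc n)) × (∀ x → x ∈ ys ⇔ x ∈ foldl extend [ 𝟎 ] c)
  encodable = c , subst (λ k → c ∈ choose k (slots d (suc n))) length-c (run-choose r)
    , λ x → subst (λ F → x ∈ ys ⇔ x ∈ F) (run-decode r) (mk⇔ ys⊆F F⊆ys)

-- The codes number C(d+(n+1)², n). The factorial stays on the left until Stirling's formula is
-- applied.
n!*p≤ : ∀ d n → n ! * p d (suc n) ≤ (d + suc n * suc n) ^ n
n!*p≤ d n = ℕ.≤-trans (ℕ.*-monoʳ-≤ (n !) (ℕ.≤-trans
  (p-≤ d (suc n) (choose n (slots d (suc n))) (foldl extend [ 𝟎 ]) (encodable d n))
  (ℕ.≤-reflexive (trans (length-choose n (slots d (suc n))) (cong (_C n) (length-slots d (suc n)))))))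
  (k!*C≤^ (d + suc n * suc n) n)

-- The lower sets on the axes suffice: n! times their number is a product of n factors, each at
-- least d+1.
≤n!*p : ∀ d n → suc d ^ n ≤ n ! * p (suc d) (suc n)
≤n!*p d n = ℕ.≤-trans (^≤k!*C d n) (ℕ.*-monoʳ-≤ (n !)
  (ℕ.≤-trans (ℕ.≤-reflexive (trans (cong (_C n) (ℕ.+-comm n d)) (sym (C-sym d n)))) (binom≤p d n)))

-- Lower sets whose points have coordinate sum at most two

units : ∀ d → List (Point d)
units zero    = []
units (suc d) = (1 ∷ 𝟎) ∷ map (0 ∷_) (units d)

-- The 0/1 vectors with exactly two ones, that is, sums of two distinct units, split by the first
-- coordinate as in Pascal's rule.
unitSums : ∀ d → List (Point d)
unitSums zero    = []
unitSums (suc d) = map (1 ∷_) (units d) ++ map (0 ∷_) (unitSums d)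

length-units : ∀ d → length (units d) ≡ d
length-units zero    = refl
length-units (suc d) = cong suc (trans (List.length-map _ (units d)) (length-units d))

length-unitSums : ∀ d → length (unitSums d) ≡ d C 2
length-unitSums zero    = refl
length-unitSums (suc d) = trans (List.length-++ (map (1 ∷_) (units d)))
  (trans (cong₂ _+_ (trans (List.length-map _ (units d)) (trans (length-units d) (sym (nC1≡n d))))
                    (trans (List.length-map _ (unitSums d)) (length-unitSums d)))
    (nCk+nC[k+1]≡[n+1]C[k+1] d 1))

units-unique : ∀ d → Unique (units d)
units-unique zero    = []
units-unique (suc d) = All.tabulate (λ m e → disj m e) ∷ Unique.map⁺ Vec.∷-injectiveʳ (units-unique d)
  where
  disj : ∀ {x} → x ∈ map (0 ∷_) (units d) → (1 ∷ 𝟎) ≢ x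
  disj m refl with _ , _ , () ← ∈-map⁻ _ m

unitSums-unique : ∀ d → Unique (unitSums d)
unitSums-unique zero    = []
unitSums-unique (suc d) = Unique.++⁺ (Unique.map⁺ Vec.∷-injectiveʳ (units-unique d))
  (Unique.map⁺ Vec.∷-injectiveʳ (unitSums-unique d)) disj
  where
  disj : ∀ {x} → x ∈ map (1 ∷_) (units d) × x ∈ map (0 ∷_) (unitSums d) → ⊥
  disj (l , r) with _ , _ , refl ← ∈-map⁻ _ l | _ , _ , () ← ∈-map⁻ _ r

-- The coordinate sums 0, 1 and 2 separate the origin, the units and their pair sums. This keeps the
-- three layers disjoint and lets the chosen pair sums be recovered from the lower set.
sum-unit : ∀ d {x} → x ∈ units d → sum x ≡ 1
sum-unit (suc d) (here refl) = cong suc (sum-𝟎 d)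
sum-unit (suc d) (there m) with _ , y∈ , refl ← ∈-map⁻ _ m = sum-unit d y∈

sum-unitSum : ∀ d {x} → x ∈ unitSums d → sum x ≡ 2
sum-unitSum (suc d) m with ∈-++⁻ (map (1 ∷_) (units d)) m
... | inj₁ l with _ , y∈ , refl ← ∈-map⁻ _ l = cong suc (sum-unit d y∈)
... | inj₂ r with _ , y∈ , refl ← ∈-map⁻ _ r = sum-unitSum d y∈

≼-unit : ∀ d {x} → x ∈ units d → ∀ x′ → x′ ≼ x → x′ ≡ 𝟎 ⊎ x′ ≡ x
≼-unit (suc d) (here refl) (zero  ∷ v) h = inj₁ (cong (0 ∷_) (≼-𝟎 {x = v} (h ∘ Fin.suc)))
≼-unit (suc d) (here refl) (suc a ∷ v) h = inj₂ (cong₂ _∷_ (ℕ.≤-antisym (h Fin.zero) (s≤s z≤n)) (≼-𝟎 {x = v} (h ∘ Fin.suc)))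
≼-unit (suc d) (there m)   (a ∷ v)     h with y , y∈ , refl ← ∈-map⁻ _ m | ≼-unit d y∈ v (h ∘ Fin.suc)
... | inj₁ e = inj₁ (cong₂ _∷_ (ℕ.n≤0⇒n≡0 (h Fin.zero)) e)
... | inj₂ e = inj₂ (cong₂ _∷_ (ℕ.n≤0⇒n≡0 (h Fin.zero)) e)

≼-unitSum : ∀ d {x} → x ∈ unitSums d → ∀ x′ → x′ ≼ x → x′ ≡ 𝟎 ⊎ x′ ∈ units d ⊎ x′ ≡ x
≼-unitSum (suc d) m x′ h with ∈-++⁻ (map (1 ∷_) (units d)) m
≼-unitSum (suc d) m (a ∷ v) h | inj₂ r with y , y∈ , refl ← ∈-map⁻ _ r | ≼-unitSum d y∈ v (h ∘ Fin.suc) | ℕ.n≤0⇒n≡0 (h Fin.zero)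
... | inj₁ e        | refl = inj₁ (cong (0 ∷_) e)
... | inj₂ (inj₁ u) | refl = inj₂ (inj₁ (there (∈-map⁺ _ u)))
... | inj₂ (inj₂ e) | refl = inj₂ (inj₂ (cong (0 ∷_) e))
≼-unitSum (suc d) m (a ∷ v) h | inj₁ l with y , y∈ , refl ← ∈-map⁻ _ l | ≼-unit d y∈ v (h ∘ Fin.suc) | a | h Fin.zero
... | inj₁ refl | zero        | _ = inj₁ refl
... | inj₂ refl | zero        | _ = inj₂ (inj₁ (there (∈-map⁺ _ y∈)))
... | inj₁ refl | suc zero    | _ = inj₂ (inj₁ (here refl))
... | inj₂ refl | suc zero    | _ = inj₂ (inj₂ refl)
... | _         | suc (suc _) | s≤s ()

-- The lower sets consisting of 0, all unit points and k sums of two of them.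
C-C2≤p : ∀ d k → (d C 2) C k ≤ p d (suc (d + k))
C-C2≤p d k = subst (_≤ p d (suc (d + k))) (trans (length-choose k (unitSums d)) (cong (_C k) (length-unitSums d)))
  (≤-p d (suc (d + k)) (choose-unique k (unitSums-unique d))
    (λ {zs} m → ofList d (suc (d + k)) (points zs) (unique m) (len m) (low m))
    (λ {zs} {zs′} m m′ e → trans (sym (choose-filter k (unitSums-unique d) m)) (trans
      (filter-local _ _ (unitSums d) (λ {x} x∈ → mk⇔
        (λ z∈ → back zs′ x∈ (⇒ (e x) (there (∈-++⁺ʳ (units d) z∈))))
        (λ z∈ → back zs  x∈ (⇐ (e x) (there (∈-++⁺ʳ (units d) z∈))))))
      (choose-filter k (unitSums-unique d) m′))))
  where
  points : List (Point d) → List (Point d)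
  points zs = 𝟎 ∷ units d ++ zs
  back : ∀ zs {x} → x ∈ unitSums d → x ∈ points zs → x ∈ zs
  back zs x∈ (here refl) with () ← trans (sym (sum-𝟎 d)) (sum-unitSum d x∈)
  back zs x∈ (there m) with ∈-++⁻ (units d) m
  ... | inj₂ r = r
  ... | inj₁ l with () ← trans (sym (sum-unit d l)) (sum-unitSum d x∈)
  module _ {zs : List (Point d)} (m : zs ∈ choose k (unitSums d)) where
    zs⊆ : ∀ {x} → x ∈ zs → x ∈ unitSums d
    zs⊆ = choose-⊆ k (unitSums d) m
    unique : Unique (points zs)
    unique = All.tabulate (λ x∈ e → 𝟎∉ (∈-++⁻ (units d) x∈) e) ∷ Unique.++⁺ (units-unique d)
      (subst Unique (choose-filter k (unitSums-unique d) m) (Unique.filter⁺ _ (unitSums-unique d)))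
      (λ { (l , r) → 1≢2 (trans (sym (sum-unit d l)) (sum-unitSum d (zs⊆ r))) })
      where
      1≢2 : 1 ≢ 2
      1≢2 ()
      𝟎∉ : ∀ {x} → x ∈ units d ⊎ x ∈ zs → 𝟎 ≢ x
      𝟎∉ (inj₁ l) refl with () ← trans (sym (sum-𝟎 d)) (sum-unit d l)
      𝟎∉ (inj₂ r) refl with () ← trans (sym (sum-𝟎 d)) (sum-unitSum d (zs⊆ r))
    len : length (points zs) ≡ suc (d + k)
    len = cong suc (trans (List.length-++ (units d)) (cong₂ _+_ (length-units d) (choose-length k (unitSums d) m)))
    low : IsLowerSet (_∈ points zs)
    low {x′ = x′} (here refl) h = here (≼-𝟎 {x = x′} h)
    low {x′ = x′} (there x∈)  h with ∈-++⁻ (units d) x∈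
    ... | inj₁ l with ≼-unit d l x′ h
    ...   | inj₁ e    = here e
    ...   | inj₂ refl = there x∈
    low {x′ = x′} (there x∈)  h | inj₂ r with ≼-unitSum d (zs⊆ r) x′ h
    ...   | inj₁ e           = here e
    ...   | inj₂ (inj₁ u)    = there (∈-++⁺ˡ u)
    ...   | inj₂ (inj₂ refl) = there x∈

-- A lower set embeds in the hyperplane where the new coordinate vanishes. A construction in m
-- dimensions thus counts in any d ≥ m.
p-suc-dim : ∀ d n → p d n ≤ p (suc d) n
p-suc-dim d n = ≤-p (suc d) n (lowerLists-unique d n)
  (λ {ys} m → ofList (suc d) n (map (0 ∷_) ys) (Unique.map⁺ Vec.∷-injectiveʳ (lowerLists-Unique d n m))
     (trans (List.length-map (0 ∷_) ys) (lowerLists-length d n m)) (low m))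
  (λ {ys} {ys′} m m′ e → trans (canonical-≡ d n m (λ x → mk⇔ id id)) (trans
     (filter-local _ _ (box d n) (λ {x} _ → mk⇔
       (λ z → pull ys′ (⇒ (e (0 ∷ x)) (∈-map⁺ (0 ∷_) z)))
       (λ z → pull ys  (⇐ (e (0 ∷ x)) (∈-map⁺ (0 ∷_) z)))))
     (sym (canonical-≡ d n m′ (λ x → mk⇔ id id)))))
  where
  pull : ∀ ys {x : Point d} → (0 ∷ x) ∈ map (0 ∷_) ys → x ∈ ys
  pull ys z with _ , x∈ , refl ← ∈-map⁻ (0 ∷_) z = x∈
  low : ∀ {ys} → ys ∈ lowerLists d n → IsLowerSet (_∈ map (0 ∷_) ys)
  low {ys} m {x′ = a ∷ v} z h with y , y∈ , refl ← ∈-map⁻ (0 ∷_) z =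
    subst (λ b → (b ∷ v) ∈ map (0 ∷_) ys) (sym (ℕ.n≤0⇒n≡0 (h Fin.zero)))
      (∈-map⁺ (0 ∷_) (lowerLists-lower d n m y∈ (h ∘ Fin.suc)))

p-mono-dim : ∀ {m d} n → m ≤ d → p m n ≤ p d n
p-mono-dim {d = d} n h = go (ℕ.≤⇒≤′ h)
  where
  go : ∀ {m d} → m ℕ.≤′ d → p m n ≤ p d n
  go (ℕ.≤′-reflexive refl) = ℕ.≤-refl
  go {d = suc d} (ℕ.≤′-step s) = ℕ.≤-trans (go s) (p-suc-dim d n)

-- Real inequalities

-- The order of ℝ, on the underlying sequences. As a record it lets its arguments be inferred from proofs.
record _≲_ (x y : ℕ → ℚ) : Set where
  field
    upTo-ε : ∀ ε → 0ℚ ℚ.< ε → ∃ λ N → ∀ n → N ≤ n → x n ℚ.≤ y n ℚ.+ ε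

open _≲_

infix  4 _≲_
infixl 6 _⊹_ _⊝_
infixr 7 _∙_

_⊹_ _⊝_ : (x y : ℕ → ℚ) → ℕ → ℚ
(x ⊹ y) j = x j ℚ.+ y j
(x ⊝ y) j = x j ℚ.- y j

_∙_ : ℚ → (ℕ → ℚ) → ℕ → ℚ
(q ∙ x) j = q ℚ.* x j

pointwise : ∀ {x y} → (∀ j → x j ℚ.≤ y j) → x ≲ y
pointwise {x} {y} h .upTo-ε ε ε>0 = 0 , λ j _ → ℚ.≤-trans (h j)
  (subst (ℚ._≤ y j ℚ.+ ε) (ℚ.+-identityʳ (y j)) (ℚ.+-monoʳ-≤ (y j) (ℚ.<⇒≤ ε>0)))

infixr 5 _⊞_
infixr 6 _⊡_

_⊞_ : ∀ {x y z w} → x ≲ y → z ≲ w → x ⊹ z ≲ y ⊹ w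
_⊞_ {x} {y} {z} {w} h k .upTo-ε ε ε>0 with N , f ← upTo-ε h (ε ℚ.* ℚ.½) (half-pos ε ε>0) | M , g ← upTo-ε k (ε ℚ.* ℚ.½) (half-pos ε ε>0) =
  N ℕ.⊔ M , λ j j≥ → subst (x j ℚ.+ z j ℚ.≤_)
    (trans (solve 3 (λ y w h → (y :+ h) :+ (w :+ h) := (y :+ w) :+ (h :+ h)) refl (y j) (w j) (ε ℚ.* ℚ.½))
      (cong (y j ℚ.+ w j ℚ.+_) (halve ε)))
    (ℚ.+-mono-≤ (f j (ℕ.m⊔n≤o⇒m≤o N M j≥)) (g j (ℕ.m⊔n≤o⇒n≤o N M j≥)))
  where open +-*-Solver

_⊡_ : ∀ {q x y} → 0ℚ ℚ.≤ q → x ≲ y → q ∙ x ≲ q ∙ y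
_⊡_ {q} {x} {y} q≥0 h .upTo-ε ε ε>0 = proj₁ (upTo-ε h δ δ>0) , λ j j≥ → ℚ.≤-trans
    (ℚ.*-monoˡ-≤-nonNeg q {{ℚ.nonNegative q≥0}} (proj₂ (upTo-ε h δ δ>0) j j≥))
    (subst (ℚ._≤ q ℚ.* y j ℚ.+ ε) (sym (ℚ.*-distribˡ-+ q (y j) δ))
      (ℚ.+-monoʳ-≤ (q ℚ.* y j) (subst (q ℚ.* δ ℚ.≤_) K*δ (ℚ.*-monoʳ-≤-nonNeg δ {{ℚ.nonNegative (ℚ.<⇒≤ δ>0)}} q≤K))))
  where
  K = q ℚ.+ 1ℚ
  instance
    K>0 : ℚ.Positive K
    K>0 = ℚ.nonNeg+pos⇒pos q {{ℚ.nonNegative q≥0}} 1ℚ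
    K≢0 : ℚ.NonZero K
    K≢0 = ℚ.pos⇒nonZero K
  -- Dividing by q+1 instead of q also covers q = 0, and still q δ ≤ ε.
  δ = (ℚ.1/ K) ℚ.* ε
  δ>0 : 0ℚ ℚ.< δ
  δ>0 = subst (ℚ._< δ) (ℚ.*-zeroʳ (ℚ.1/ K)) (ℚ.*-monoʳ-<-pos (ℚ.1/ K) {{ℚ.1/pos⇒pos K}} ε>0)
  K*δ : K ℚ.* δ ≡ ε
  K*δ = trans (sym (ℚ.*-assoc K (ℚ.1/ K) ε)) (trans (cong (ℚ._* ε) (ℚ.*-inverseʳ K)) (ℚ.*-identityˡ ε))
  q≤K : q ℚ.≤ K
  q≤K = subst (ℚ._≤ K) (ℚ.+-identityʳ q) (ℚ.+-monoʳ-≤ q (ℚ.<⇒≤ (ℚ.positive⁻¹ 1ℚ)))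

-- The hypothesis on terms says x - y = a - b. Estimates are proved by combining known inequalities
-- with `⊞` and `⊡` into one a ≲ b; the ring solver then checks that the wanted inequality has the
-- same difference.
by : ∀ {a b x y} → a ≲ b → (∀ j → x j ℚ.+ b j ≡ y j ℚ.+ a j) → x ≲ y
by {a} {b} {x} {y} h e .upTo-ε ε ε>0 with N , f ← upTo-ε h ε ε>0 = N , λ j j≥ →
  subst₂ ℚ._≤_ (solve 2 (λ x b → (x :+ b) :- b := x) refl (x j) (b j))
    (solve 3 (λ y b ε → (y :+ (b :+ ε)) :- b := y :+ ε) refl (y j) (b j) ε)
    (ℚ.+-monoˡ-≤ (ℚ.- b j) (ℚ.≤-trans (ℚ.≤-reflexive (e j)) (ℚ.+-monoʳ-≤ (y j) (f j j≥))))
  where open +-*-Solver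

≲-trans : ∀ {x y z} → x ≲ y → y ≲ z → x ≲ z
≲-trans {x} {y} {z} h k = by (h ⊞ k)
  λ j → solve 3 (λ x y z → x :+ (y :+ z) := z :+ (x :+ y)) refl (x j) (y j) (z j)
  where open +-*-Solver

∣∣-≲ : ∀ {x y} → x ≲ y → (λ j → ℚ.- x j) ≲ y → (λ j → ℚ.∣ x j ∣) ≲ y
∣∣-≲ h k .upTo-ε ε ε>0 with N , f ← upTo-ε h ε ε>0 | M , g ← upTo-ε k ε ε>0 =
  N ℕ.⊔ M , λ j j≥ → ∣-∣-≤ (f j (ℕ.m⊔n≤o⇒m≤o N M j≥)) (g j (ℕ.m⊔n≤o⇒n≤o N M j≥))

≤∣∣ : ∀ q → q ℚ.≤ ℚ.∣ q ∣
≤∣∣ q with ℚ.≤-total 0ℚ q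
... | inj₁ 0≤q = ℚ.≤-reflexive (sym (ℚ.0≤p⇒∣p∣≡p 0≤q))
... | inj₂ q≤0 = ℚ.≤-trans q≤0 (ℚ.0≤∣p∣ q)

-- The logarithm

∑-nonNeg : ∀ n f → (∀ i → 0ℚ ℚ.≤ f i) → 0ℚ ℚ.≤ ∑< n f
∑-nonNeg zero    f h = ℚ.≤-refl
∑-nonNeg (suc n) f h = ℚ.+-mono-≤ (∑-nonNeg n f h) (h n)

logSum-nonNeg : ∀ k M → 0ℚ ℚ.≤ logSum k M
logSum-nonNeg k M = ∑-nonNeg ((k ∸ 1) * M) _ (λ i → inv-nonNeg (M + i))

logSum-+ : ∀ a t M → logSum (suc a + t) M ≡ logSum (suc a) M ℚ.+ ∑< (t * M) (λ i → inv (suc a * M + i))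
logSum-+ a t M = trans (cong (λ l → ∑< l (λ i → inv (M + i))) (ℕ.*-distribʳ-+ M a t))
  (trans (∑-+ (a * M) (t * M) (λ i → inv (M + i)))
    (cong (∑< (a * M) (λ i → inv (M + i)) ℚ.+_) (∑-cong (t * M) λ i → cong inv (sym (ℕ.+-assoc M (a * M) i)))))

logSum-mono : ∀ {a b} M → a ≤ b → logSum a M ℚ.≤ logSum b M
logSum-mono {zero}  {b} M h = logSum-nonNeg b M
logSum-mono {suc a} {b} M h with k , refl ← ℕ.m≤n⇒∃[o]m+o≡n h =
  subst₂ ℚ._≤_ (ℚ.+-identityʳ _) (sym (logSum-+ a k M))
    (ℚ.+-monoʳ-≤ (logSum (suc a) M) (∑-nonNeg (k * M) _ (λ i → inv-nonNeg (suc a * M + i))))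

-- `inv (b * suc m + m)` is 1/((b+1)(m+1)): a step of width 1/(m+1) at integrand value 1/(b+1).
∑-inv-block : ∀ t b m → ∑< (t * suc m) (λ _ → inv (b * suc m + m)) ≡ fromℕ t ℚ.* inv b
∑-inv-block t b m = trans (∑-const (t * suc m) _) (trans (cong (ℚ._* inv (b * suc m + m)) (fromℕ-* t (suc m)))
  (trans (ℚ.*-assoc (fromℕ t) (fromℕ (suc m)) _) (cong (fromℕ t ℚ.*_) (inv-cancel b m))))

-- Substitution in the integral: scaling by a+1 carries the part beyond a+1 to the interval from 1
-- to b+1, with a mesh a+1 times finer. For the Riemann sums this is an exact equality.
logSum-* : ∀ a b M → logSum (suc a * suc b) M ≡ logSum (suc a) M ℚ.+ logSum (suc b) (suc a * M)
logSum-* a b M = trans (cong (λ k → logSum k M) (eq₁ a b)) (trans (logSum-+ a (b * suc a) M)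
  (cong (λ l → logSum (suc a) M ℚ.+ ∑< l (λ i → inv (suc a * M + i))) (ℕ.*-assoc b (suc a) M)))
  where
  eq₁ : ∀ a b → suc a * suc b ≡ suc a + b * suc a
  eq₁ = solve-∀

-- The approximating sequence of log k, with the junk value log 0 = 0.
opaque
  ln : ℕ → ℕ → ℚ
  ln k m = logSum k (suc m)

opaque
  unfolding ln

  ln-nonNeg : ∀ k → const 0ℚ ≲ ln k
  ln-nonNeg k = pointwise λ j → logSum-nonNeg k (suc j)

  ln-mono : ∀ {a b} → a ≤ b → ln a ≲ ln b
  ln-mono {a} {b} h = pointwise λ j → logSum-mono (suc j) h

  -- From a+1 to a+1+t the integrand 1/x is at most `inv a` = 1/(a+1), its value at the left end;
  -- `ln-+-≥` takes the right end instead.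
  ln-+-≤ : ∀ a t → ln (suc a + t) ≲ ln (suc a) ⊹ const (fromℕ t ℚ.* inv a)
  ln-+-≤ a t = pointwise λ m →
    subst₂ ℚ._≤_ (sym (logSum-+ a t (suc m))) (cong (logSum (suc a) (suc m) ℚ.+_) (∑-inv-block t a m))
      (ℚ.+-monoʳ-≤ (logSum (suc a) (suc m)) (∑-mono (t * suc m) λ i _ → inv-anti (bound m i)))
    where
    bound : ∀ m i → a * suc m + m ≤ suc a * suc m + i
    bound m i = ℕ.≤-trans (ℕ.≤-reflexive (ℕ.+-comm (a * suc m) m)) (ℕ.≤-trans (ℕ.n≤1+n _) (ℕ.m≤m+n _ i))

  ln-+-≥ : ∀ a t → ln (suc a) ⊹ const (fromℕ t ℚ.* inv (a + t)) ≲ ln (suc a + t)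
  ln-+-≥ a t = pointwise λ m →
    subst₂ ℚ._≤_ (cong (logSum (suc a) (suc m) ℚ.+_) (∑-inv-block t (a + t) m)) (sym (logSum-+ a t (suc m)))
      (ℚ.+-monoʳ-≤ (logSum (suc a) (suc m)) (∑-mono (t * suc m) λ i i< → inv-anti (bound m i i<)))
    where
    bound : ∀ m i → i < t * suc m → suc a * suc m + i ≤ (a + t) * suc m + m
    bound m i i< = ℕ.≤-pred (ℕ.≤-trans (ℕ.≤-reflexive (sym (ℕ.+-suc (suc a * suc m) i)))
      (ℕ.≤-trans (ℕ.+-monoʳ-≤ (suc a * suc m) i<) (ℕ.≤-reflexive (eq a t m))))
      where
      eq : ∀ a t m → suc a * suc m + t * suc m ≡ suc ((a + t) * suc m + m)
      eq = solve-∀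

  ln-*-≥ : ∀ a b .{{_ : NonZero a}} .{{_ : NonZero b}} → ln a ⊹ ln b ≲ ln (a * b)
  ln-*-≥ (suc a) (suc b) = pointwise λ j →
    subst (logSum (suc a) (suc j) ℚ.+ logSum (suc b) (suc j) ℚ.≤_) (sym (logSum-* a b (suc j)))
      (ℚ.+-monoʳ-≤ (logSum (suc a) (suc j))
        (subst (λ M → logSum (suc b) (suc j) ℚ.≤ logSum (suc b) M) (ℕ.*-comm (suc j) (suc a)) (logSum-lower (suc b) (suc j) a)))

  -- Refining the mesh can raise the sum, by at most `inv j`, so the inequality is obtained up to ε
  -- and not term by term.
  ln-*-≤ : ∀ a b .{{_ : NonZero a}} .{{_ : NonZero b}} → ln (a * b) ≲ ln a ⊹ ln b
  ln-*-≤ (suc a) (suc b) .upTo-ε ε ε>0 with N , small ← inv-small 0 ε ε>0 = N , λ j j≥ →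
    subst₂ ℚ._≤_ (sym (logSum-* a b (suc j))) (sym (ℚ.+-assoc (logSum (suc a) (suc j)) (logSum (suc b) (suc j)) ε))
      (ℚ.+-monoʳ-≤ (logSum (suc a) (suc j)) (subst (λ M → logSum (suc b) M ℚ.≤ logSum (suc b) (suc j) ℚ.+ ε) (ℕ.*-comm (suc j) (suc a))
        (ℚ.≤-trans (logSum-upper (suc b) j a) (subst (ℚ._≤ logSum (suc b) (suc j) ℚ.+ ε) (ℚ.+-comm (logSum (suc b) (suc j)) (inv j))
          (ℚ.+-monoʳ-≤ (logSum (suc b) (suc j)) (ℚ.≤-trans (inv-anti j≥) small))))))

  ln-^-≥ : ∀ a k .{{_ : NonZero a}} → fromℕ k ∙ ln a ≲ ln (a ^ k)
  ln-^-≥ a zero    = pointwise λ j → ℚ.≤-reflexive (ℚ.*-zeroˡ (logSum a (suc j)))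
  ln-^-≥ a (suc k) = by (ln-*-≥ a (a ^ k) {{it}} {{ℕ.m^n≢0 a k}} ⊞ ln-^-≥ a k)
    λ j → trans (cong (λ q → q ℚ.* ln a j ℚ.+ (ln (a * a ^ k) j ℚ.+ ln (a ^ k) j)) (fromℕ-+ 1 k))
      (solve 4 (λ k a x y → (con 1ℚ :+ k) :* a :+ (x :+ y) := x :+ ((a :+ y) :+ k :* a)) refl
        (fromℕ k) (ln a j) (ln (a * a ^ k) j) (ln (a ^ k) j))
    where open +-*-Solver

  ln-^-≤ : ∀ a k .{{_ : NonZero a}} → ln (a ^ k) ≲ fromℕ k ∙ ln a
  ln-^-≤ a zero    = pointwise λ j → ℚ.≤-reflexive (sym (ℚ.*-zeroˡ (logSum a (suc j))))
  ln-^-≤ a (suc k) = by (ln-*-≤ a (a ^ k) {{it}} {{ℕ.m^n≢0 a k}} ⊞ ln-^-≤ a k)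
    λ j → sym (trans (cong (λ q → q ℚ.* ln a j ℚ.+ (ln (a * a ^ k) j ℚ.+ ln (a ^ k) j)) (fromℕ-+ 1 k))
      (solve 4 (λ k a x y → (con 1ℚ :+ k) :* a :+ (x :+ y) := x :+ ((a :+ y) :+ k :* a)) refl
        (fromℕ k) (ln a j) (ln (a * a ^ k) j) (ln (a ^ k) j)))
    where open +-*-Solver

const-mono : ∀ {q r} → q ℚ.≤ r → const q ≲ const r
const-mono h = pointwise λ _ → h

fromℕ≥0 : ∀ a → 0ℚ ℚ.≤ fromℕ a
fromℕ≥0 a = fromℕ-mono-≤ {0} {a} z≤n

suc*inv : ∀ a → fromℕ (suc a) ℚ.* inv a ≡ 1ℚ
suc*inv a = trans (ℚ.*-comm (fromℕ (suc a)) (inv a)) (/-cancel 1 (suc a))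

fromℕ1* : ∀ q → fromℕ 1 ℚ.* q ≡ q
fromℕ1* q = trans (cong (ℚ._* q) {fromℕ 1} {1ℚ} refl) (ℚ.*-identityˡ q)

ln-suc-≤ : ∀ m → ln (suc (suc m)) ≲ ln (suc m) ⊹ const (inv m)
ln-suc-≤ m = subst (λ k → ln k ≲ ln (suc m) ⊹ const (inv m)) {suc m + 1} {suc (suc m)} (ℕ.+-comm (suc m) 1)
  (subst (λ q → ln (suc m + 1) ≲ ln (suc m) ⊹ const q) {fromℕ 1 ℚ.* inv m} {inv m} (fromℕ1* (inv m)) (ln-+-≤ m 1))

ln-suc-≥ : ∀ m → ln (suc m) ⊹ const (inv (suc m)) ≲ ln (suc (suc m))
ln-suc-≥ m = subst (λ k → ln (suc m) ⊹ const (inv k) ≲ ln (suc k)) {m + 1} {suc m} (ℕ.+-comm m 1)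
  (subst (λ q → ln (suc m) ⊹ const q ≲ ln (suc m + 1)) {fromℕ 1 ℚ.* inv (m + 1)} {inv (m + 1)} (fromℕ1* (inv (m + 1))) (ln-+-≥ m 1))

opaque
  unfolding ln

  ln-1-≥ : fromℕ 0 ∙ ln 1 ≲ ln 1 ⊹ const 0ℚ
  ln-1-≥ = pointwise λ _ → ℚ.≤-refl

  ln-1-≤ : ln 1 ⊹ const 0ℚ ≲ fromℕ 1 ∙ ln 1
  ln-1-≤ = pointwise λ _ → ℚ.≤-refl

  ln-1+ : ∀ {q} → ln 1 ⊹ const (q ℚ.* inv 0) ≲ const q
  ln-1+ {q} = pointwise λ _ → ℚ.≤-reflexive (trans (ℚ.+-identityˡ _) (ℚ.*-identityʳ q))

-- This is (m+1)ᵐ ≤ m! eᵐ. In the step, (m+1) log(m+2) exceeds (m+1) log(m+1) by at most 1, because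
-- log(m+2) - log(m+1) ≤ 1/(m+1).
stirling-≥ : ∀ m → fromℕ m ∙ ln (suc m) ≲ ln (m !) ⊹ const (fromℕ m)
stirling-≥ zero    = ln-1-≥
stirling-≥ (suc m) = step {x₁ = ln (suc m)} {ln (suc (suc m))} {ln (m !)} {ln (suc m !)} (fromℕ-+ 1 m) (suc*inv m) (fromℕ≥0 (suc m)) (stirling-≥ m) (ln-*-≥ (suc m) (m !) {{_}} {{m !≢0}}) (ln-suc-≤ m)
  where
  open +-*-Solver
  step : ∀ {M M′ i x₁ x₂ f₀ f₁} → M′ ≡ 1ℚ ℚ.+ M → M′ ℚ.* i ≡ 1ℚ → 0ℚ ℚ.≤ M′ → M ∙ x₁ ≲ f₀ ⊹ const M → x₁ ⊹ f₀ ≲ f₁ →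
         x₂ ≲ x₁ ⊹ const i → M′ ∙ x₂ ≲ f₁ ⊹ const M′
  step {M} {_} {i} {x₁} {x₂} {f₀} {f₁} refl e M′≥0 h₁ h₂ h₃ = by (h₁ ⊞ h₂ ⊞ M′≥0 ⊡ h₃)
    λ j → trans (solve 6 (λ M i a b f g → (con 1ℚ :+ M) :* b :+ (f :+ M :+ (g :+ (con 1ℚ :+ M) :* (a :+ i)))
        := g :+ ((con 1ℚ :+ M) :* i :+ M) :+ (M :* a :+ (a :+ f :+ (con 1ℚ :+ M) :* b))) refl M i (x₁ j) (x₂ j) (f₀ j) (f₁ j))
      (cong (λ o → f₁ j ℚ.+ (o ℚ.+ M) ℚ.+ (M ℚ.* x₁ j ℚ.+ (x₁ j ℚ.+ f₀ j ℚ.+ (1ℚ ℚ.+ M) ℚ.* x₂ j))) e)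

-- The step multiplies log(m+2) - log(m+1) ≥ 1/(m+2) by m+2. Compared with `stirling-≥` there is one
-- more log(m+1), which reappears as the term `ln n` in `ln-p-≥`.
stirling-≤ : ∀ m → ln (m !) ⊹ const (fromℕ m) ≲ fromℕ (suc m) ∙ ln (suc m)
stirling-≤ zero    = ln-1-≤
stirling-≤ (suc m) = step {x₁ = ln (suc m)} {ln (suc (suc m))} {ln (m !)} {ln (suc m !)} (fromℕ-+ 1 m) (fromℕ-+ 1 (suc m)) (suc*inv (suc m)) (fromℕ≥0 (suc (suc m)))
  (stirling-≤ m) (ln-*-≤ (suc m) (m !) {{_}} {{m !≢0}}) (ln-suc-≥ m)
  where
  open +-*-Solver
  step : ∀ {M M′ M″ i x₁ x₂ f₀ f₁} → M′ ≡ 1ℚ ℚ.+ M → M″ ≡ 1ℚ ℚ.+ M′ → M″ ℚ.* i ≡ 1ℚ → 0ℚ ℚ.≤ M″ → f₀ ⊹ const M ≲ M′ ∙ x₁ → f₁ ≲ x₁ ⊹ f₀ →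
         x₁ ⊹ const i ≲ x₂ → f₁ ⊹ const M′ ≲ M″ ∙ x₂
  step {M} {_} {_} {i} {x₁} {x₂} {f₀} {f₁} refl refl e M″≥0 h₁ h₂ h₃ = by (h₁ ⊞ h₂ ⊞ M″≥0 ⊡ h₃)
    λ j → sym (trans (solve 6 (λ M i a b f g → (con 1ℚ :+ (con 1ℚ :+ M)) :* b :+ (f :+ M :+ (g :+ (con 1ℚ :+ (con 1ℚ :+ M)) :* (a :+ i)))
        := g :+ ((con 1ℚ :+ (con 1ℚ :+ M)) :* i :+ M) :+ ((con 1ℚ :+ M) :* a :+ (a :+ f :+ (con 1ℚ :+ (con 1ℚ :+ M)) :* b))) refl
          M i (x₁ j) (x₂ j) (f₀ j) (f₁ j))
      (cong (λ o → f₁ j ℚ.+ (o ℚ.+ M) ℚ.+ ((1ℚ ℚ.+ M) ℚ.* x₁ j ℚ.+ (x₁ j ℚ.+ f₀ j ℚ.+ (1ℚ ℚ.+ (1ℚ ℚ.+ M)) ℚ.* x₂ j))) e))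

ln-≤ : ∀ a → ln (suc a) ≲ const (fromℕ a)
ln-≤ a = ≲-trans (ln-+-≤ 0 a) (ln-1+ {fromℕ a})

-- An explicit form of log n = o(n): log n ≤ log(κ+1+n) ≤ log(κ+1) + n/(κ+1), where log(κ+1) ≤ κ ≤
-- n/(κ+1).
ln-small : ∀ κ n → κ * suc κ ≤ n → ln n ≲ const ((inv κ ℚ.+ inv κ) ℚ.* fromℕ n)
ln-small κ n h = ≲-trans (ln-mono (ℕ.m≤n+m n (suc κ))) (≲-trans (ln-+-≤ κ n)
  (by (ln-≤ κ ⊞ const-mono κ≤) λ j → solve 4 (λ l n i k → (l :+ n :* i) :+ (k :+ i :* n) := ((i :+ i) :* n) :+ (l :+ k)) refl
    (ln (suc κ) j) (fromℕ n) (inv κ) (fromℕ κ)))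
  where
  open +-*-Solver
  κ≤ : fromℕ κ ℚ.≤ inv κ ℚ.* fromℕ n
  κ≤ = subst (ℚ._≤ inv κ ℚ.* fromℕ n) eq (ℚ.*-monoˡ-≤-nonNeg (inv κ) {{ℚ.nonNegative (inv-nonNeg κ)}} (fromℕ-mono-≤ h))
    where
    eq : inv κ ℚ.* fromℕ (κ * suc κ) ≡ fromℕ κ
    eq = trans (cong (inv κ ℚ.*_) (fromℕ-* κ (suc κ))) (trans
      (solve 3 (λ i k s → i :* (k :* s) := k :* (s :* i)) refl (inv κ) (fromℕ κ) (fromℕ (suc κ)))
      (trans (cong (fromℕ κ ℚ.*_) (suc*inv κ)) (ℚ.*-identityʳ (fromℕ κ))))

-- Estimates of log p

module _ (d m : ℕ) .{{_ : NonZero d}} where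
  private
    n = suc m
    P = p d n
    instance
      P≢0 : NonZero P
      P≢0 = p≢0 d n
      m!≢0 : NonZero (m !)
      m!≢0 = m !≢0

  ln-p-≤ : ln P ≲ fromℕ m ∙ (ln (d + n * n) ⊝ ln n ⊹ const 1ℚ)
  ln-p-≤ = by (stirling-≥ m ⊞ ≲-trans (ln-*-≥ (m !) P) (≲-trans (ln-mono (n!*p≤ d m)) (ln-^-≤ (d + n * n) m {{d+n²≢0}})))
    λ j → solve 5 (λ m a b f x → x :+ (f :+ m :+ m :* b) := m :* (b :- a :+ con 1ℚ) :+ (m :* a :+ (f :+ x))) refl
      (fromℕ m) (ln n j) (ln (d + n * n) j) (ln (m !) j) (ln P j)
    where
    open +-*-Solver
    d+n²≢0 : NonZero (d + n * n)
    d+n²≢0 = ℕ.>-nonZero (ℕ.<-≤-trans (ℕ.>-nonZero⁻¹ d) (ℕ.m≤m+n d (n * n)))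

  ln-p-≥ : fromℕ m ∙ (ln d ⊝ ln n ⊹ const 1ℚ) ≲ ln P ⊹ ln n
  ln-p-≥ = by (stirling-≤ m ⊞ ≲-trans (ln-^-≥ d m) (≲-trans (ln-mono (bound d)) (ln-*-≤ (m !) P)))
    λ j → subst (λ M → fromℕ m ℚ.* (ln d j ℚ.- ln n j ℚ.+ 1ℚ) ℚ.+ (M ℚ.* ln n j ℚ.+ (ln (m !) j ℚ.+ ln P j))
                     ≡ ln P j ℚ.+ ln n j ℚ.+ (ln (m !) j ℚ.+ fromℕ m ℚ.+ fromℕ m ℚ.* ln d j)) (sym (fromℕ-+ 1 m))
      (solve 5 (λ m a b f x → m :* (b :- a :+ con 1ℚ) :+ ((con 1ℚ :+ m) :* a :+ (f :+ x)) := x :+ a :+ (f :+ m :+ m :* b)) refl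
        (fromℕ m) (ln n j) (ln d j) (ln (m !) j) (ln P j))
    where
    open +-*-Solver
    bound : ∀ d .{{_ : NonZero d}} → d ^ m ≤ m ! * p d n
    bound (suc d) = ≤n!*p d m

  estimate-b : ∀ κ → suc κ * (n * n) ≤ d → κ * suc κ ≤ n →
    (λ j → ℚ.∣ (ln P ⊝ fromℕ m ∙ (ln d ⊝ ln n ⊹ const 1ℚ)) j ∣) ≲ const ((inv κ ℚ.+ inv κ) ℚ.* fromℕ n)
  estimate-b κ Kn²≤d κK≤n = ∣∣-≲
    (≲-trans (by (ln-p-≤ ⊞ fromℕ≥0 m ⊡ lnN≲) λ j →
        solve 6 (λ m a b c x i → (x :- m :* (b :- a :+ con 1ℚ)) :+ (m :* (c :- a :+ con 1ℚ) :+ m :* (b :+ i)) := m :* i :+ (x :+ m :* c)) refl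
          (fromℕ m) (ln n j) (ln d j) (ln N j) (ln P j) (inv κ))
      (const-mono {fromℕ m ℚ.* inv κ} mi≤))
    (by (ln-p-≥ ⊞ ln-small κ n κK≤n) λ j →
        solve 4 (λ y a x i → (:- (x :- y)) :+ ((x :+ a) :+ i) := i :+ (y :+ a)) refl
          (fromℕ m ℚ.* (ln d j ℚ.- ln n j ℚ.+ 1ℚ)) (ln n j) (ln P j) ((inv κ ℚ.+ inv κ) ℚ.* fromℕ n))
    where
    open +-*-Solver
    N = d + n * n
    K = suc κ
    N*K≤ : N * K ≤ d * suc K
    N*K≤ = ℕ.≤-trans (ℕ.≤-reflexive (eq d (n * n) K)) (ℕ.≤-trans (ℕ.+-monoʳ-≤ (d * K) Kn²≤d) (ℕ.≤-reflexive (eq′ d K)))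
      where
      eq : ∀ d s K → (d + s) * K ≡ d * K + K * s
      eq = solve-∀
      eq′ : ∀ d K → d * K + d ≡ d * suc K
      eq′ = solve-∀
    -- From N/d ≤ (K+1)/K and log(K+1) - log K ≤ 1/K.
    lnN≲ : ln N ≲ ln d ⊹ const (inv κ)
    lnN≲ = by (≲-trans (ln-*-≥ N K {{ℕ.>-nonZero (ℕ.<-≤-trans (ℕ.>-nonZero⁻¹ d) (ℕ.m≤m+n d (n * n)))}}) (≲-trans (ln-mono N*K≤) (ln-*-≤ d (suc K)))
               ⊞ subst (λ k → ln k ≲ ln K ⊹ const (fromℕ 1 ℚ.* inv κ)) (ℕ.+-comm K 1) (ln-+-≤ κ 1))
      λ j → solve 5 (λ N d K K′ i → N :+ ((d :+ K′) :+ (K :+ con 1ℚ :* i)) := (d :+ i) :+ ((N :+ K) :+ K′)) refl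
        (ln N j) (ln d j) (ln K j) (ln (suc K) j) (inv κ)
    mi≤ : fromℕ m ℚ.* inv κ ℚ.≤ (inv κ ℚ.+ inv κ) ℚ.* fromℕ n
    mi≤ = ℚ.≤-trans (ℚ.*-monoʳ-≤-nonNeg (inv κ) {{ℚ.nonNegative (inv-nonNeg κ)}} (fromℕ-mono-≤ (ℕ.n≤1+n m)))
      (subst₂ ℚ._≤_ (ℚ.+-identityʳ (fromℕ n ℚ.* inv κ)) (solve 2 (λ n i → n :* i :+ n :* i := (i :+ i) :* n) refl (fromℕ n) (inv κ))
        (ℚ.+-monoʳ-≤ (fromℕ n ℚ.* inv κ) (subst (ℚ._≤ fromℕ n ℚ.* inv κ) (ℚ.*-zeroʳ (fromℕ n))
          (ℚ.*-monoˡ-≤-nonNeg (fromℕ n) {{fromℕ-nonNeg n}} (inv-nonNeg κ)))))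

  -- Since d + n² ≤ (K+1)n², its logarithm is at most K + 2 log n, so each of the m non-origin
  -- points contributes at most log n + K + 1.
  estimate-c-≤ : ∀ K → d ≤ K * (n * n) → ln P ≲ fromℕ n ∙ ln n ⊹ const (fromℕ ((2 + K) * n))
  estimate-c-≤ K d≤ = by (ln-p-≤ ⊞ fromℕ≥0 m ⊡ lnN≲ ⊞ ln-nonNeg n ⊞ const-mono slack)
    λ j → subst₂ (λ M s → ln P j ℚ.+ (fromℕ m ℚ.* (ln N j ℚ.- ln n j ℚ.+ 1ℚ) ℚ.+ (fromℕ m ℚ.* (fromℕ K ℚ.+ fromℕ 2 ℚ.* ln n j) ℚ.+ (ln n j ℚ.+ S)))
        ≡ M ℚ.* ln n j ℚ.+ S ℚ.+ (ln P j ℚ.+ (fromℕ m ℚ.* ln N j ℚ.+ (0ℚ ℚ.+ s)))) (sym (fromℕ-+ 1 m)) (sym slack≡)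
      (solve 6 (λ m a b x K S → x :+ (m :* (b :- a :+ con 1ℚ) :+ (m :* (K :+ con (fromℕ 2) :* a) :+ (a :+ S)))
          := (con 1ℚ :+ m) :* a :+ S :+ (x :+ (m :* b :+ (con 0ℚ :+ m :* (con 1ℚ :+ K))))) refl
        (fromℕ m) (ln n j) (ln N j) (ln P j) (fromℕ K) S)
    where
    open +-*-Solver
    N = d + n * n
    S = fromℕ ((2 + K) * n)
    lnN≲ : ln N ≲ const (fromℕ K) ⊹ fromℕ 2 ∙ ln n
    lnN≲ = ≲-trans (ln-mono {N} {suc K * n ^ 2} (ℕ.≤-trans (ℕ.+-monoˡ-≤ (n * n) d≤) (ℕ.≤-reflexive (eq K n))))
      (≲-trans (ln-*-≤ (suc K) (n ^ 2) {{_}} {{ℕ.m^n≢0 n 2}}) (ln-≤ K ⊞ ln-^-≤ n 2))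
      where
      eq : ∀ K n → K * (n * n) + n * n ≡ suc K * (n * (n * 1))
      eq = solve-∀
    slack : fromℕ (m * suc K) ℚ.≤ S
    slack = fromℕ-mono-≤ (ℕ.≤-trans (ℕ.≤-reflexive (ℕ.*-comm m (suc K))) (ℕ.*-mono-≤ (ℕ.n≤1+n (suc K)) (ℕ.n≤1+n m)))
    slack≡ : fromℕ (m * suc K) ≡ fromℕ m ℚ.* (1ℚ ℚ.+ fromℕ K)
    slack≡ = trans (fromℕ-* m (suc K)) (cong (fromℕ m ℚ.*_) (fromℕ-+ 1 K))

  -- Two terms log n are lost, one in `ln-p-≥` and one between m log n and n log n; both are
  -- absorbed by log n ≤ m.
  estimate-c-≥ : ∀ K .{{_ : NonZero K}} → n * n ≤ K * d → fromℕ n ∙ ln n ≲ ln P ⊹ const (fromℕ ((2 + K) * n))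
  estimate-c-≥ (suc κ) n²≤ = by (ln-p-≥ ⊞ fromℕ≥0 m ⊡ lnd≳ ⊞ fromℕ≥0 2 ⊡ ln-≤ m ⊞ const-mono slack)
    λ j → subst₂ (λ M s → M ℚ.* ln n j ℚ.+ (ln P j ℚ.+ ln n j ℚ.+ (fromℕ m ℚ.* (fromℕ κ ℚ.+ ln d j) ℚ.+ (fromℕ 2 ℚ.* fromℕ m ℚ.+ S)))
        ≡ ln P j ℚ.+ S ℚ.+ (fromℕ m ℚ.* (ln d j ℚ.- ln n j ℚ.+ 1ℚ) ℚ.+ (fromℕ m ℚ.* (fromℕ 2 ℚ.* ln n j) ℚ.+ (fromℕ 2 ℚ.* ln n j ℚ.+ s)))) (sym (fromℕ-+ 1 m)) (sym slack≡)
      (solve 6 (λ m a b x K S → (con 1ℚ :+ m) :* a :+ (x :+ a :+ (m :* (K :+ b) :+ (con (fromℕ 2) :* m :+ S)))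
          := x :+ S :+ (m :* (b :- a :+ con 1ℚ) :+ (m :* (con (fromℕ 2) :* a) :+ (con (fromℕ 2) :* a :+ m :* (con 1ℚ :+ K))))) refl
        (fromℕ m) (ln n j) (ln d j) (ln P j) (fromℕ κ) S)
    where
    open +-*-Solver
    K = suc κ
    S = fromℕ ((2 + K) * n)
    lnd≳ : fromℕ 2 ∙ ln n ≲ const (fromℕ κ) ⊹ ln d
    lnd≳ = ≲-trans (ln-^-≥ n 2) (≲-trans (ln-mono {n ^ 2} {K * d} (ℕ.≤-trans (ℕ.≤-reflexive (eq n)) n²≤))
      (≲-trans (ln-*-≤ K d) (ln-≤ κ ⊞ pointwise {ln d} {ln d} λ _ → ℚ.≤-refl)))
      where
      eq : ∀ n → n * (n * 1) ≡ n * n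
      eq = solve-∀
    slack : fromℕ (m * suc κ) ℚ.≤ S
    slack = fromℕ-mono-≤ (ℕ.≤-trans (ℕ.≤-reflexive (ℕ.*-comm m (suc κ))) (ℕ.*-mono-≤ (ℕ.m≤n+m K 2) (ℕ.n≤1+n m)))
    slack≡ : fromℕ (m * suc κ) ≡ fromℕ m ℚ.* (1ℚ ℚ.+ fromℕ κ)
    slack≡ = trans (fromℕ-* m (suc κ)) (cong (fromℕ m ℚ.*_) (fromℕ-+ 1 κ))

-- Many lower sets in few dimensions

^-distribʳ-* : ∀ k a b → (a * b) ^ k ≡ a ^ k * b ^ k
^-distribʳ-* zero    a b = refl
^-distribʳ-* (suc k) a b = trans (cong (a * b *_) (^-distribʳ-* k a b)) (interchange a b (a ^ k) (b ^ k))
  where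
  interchange : ∀ a b c d → a * b * (c * d) ≡ a * c * (b * d)
  interchange = solve-∀

-- Out of P = m(m-1)/2 sums of two units, k are chosen. As 8n ≤ m², the difference P - k is at least
-- m²/8, so P(P-1)...(P-k+1) ≥ (m²/8)ᵏ, while the k! of the binomial is at most nᵏ.
[m*m]^k≤ : ∀ d m k → m ≤ d → 8 * suc (m + k) ≤ m * m → (m * m) ^ k ≤ (8 * suc (m + k)) ^ k * p d (suc (m + k))
[m*m]^k≤ d (suc (suc m)) k m≤d 8n≤m² = go (ℕ.m≤n⇒∃[o]m+o≡n k≤P)
  where
  open ℕ.≤-Reasoning
  s = suc (suc m)
  n = suc (s + k)
  P = s C 2
  m²+8k≤8P : s * s + 8 * k ≤ 8 * P
  m²+8k≤8P = begin
    s * s + 8 * k           ≤⟨ ℕ.+-monoʳ-≤ (s * s) (ℕ.≤-trans (ℕ.*-monoʳ-≤ 8 (ℕ.≤-trans (ℕ.m≤n+m k s) (ℕ.n≤1+n _))) 8n≤m²) ⟩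
    s * s + s * s           ≤⟨ ℕ.m≤m+n (s * s + s * s) (2 * (s * m)) ⟩
    s * s + s * s + 2 * (s * m) ≡⟨ eq m ⟩
    4 * (s * suc m)         ≡⟨ cong (4 *_) (2*C2 (suc m)) ⟨
    4 * (2 * P)             ≡⟨ ℕ.*-assoc 4 2 P ⟨
    8 * P                   ∎
    where
    eq : ∀ m → suc (suc m) * suc (suc m) + suc (suc m) * suc (suc m) + 2 * (suc (suc m) * m) ≡ 4 * (suc (suc m) * suc m)
    eq = solve-∀
  k≤P : k ≤ P
  k≤P = ℕ.*-cancelˡ-≤ 8 (ℕ.≤-trans (ℕ.m≤n+m (8 * k) (s * s)) m²+8k≤8P)
  go : (∃ λ M → k + M ≡ P) → (s * s) ^ k ≤ (8 * n) ^ k * p d n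
  go (M , k+M≡P) = begin
    (s * s) ^ k                       ≤⟨ ℕ.^-monoˡ-≤ k m²≤8M ⟩
    (8 * suc M) ^ k                   ≡⟨ ^-distribʳ-* k 8 (suc M) ⟩
    8 ^ k * suc M ^ k                 ≤⟨ ℕ.*-monoʳ-≤ (8 ^ k) (^≤k!*C M k) ⟩
    8 ^ k * (k ! * ((k + M) C k))     ≤⟨ ℕ.*-monoʳ-≤ (8 ^ k) (ℕ.*-mono-≤ k!≤ C≤p) ⟩
    8 ^ k * (n ^ k * p d n)           ≡⟨ ℕ.*-assoc (8 ^ k) (n ^ k) (p d n) ⟨
    8 ^ k * n ^ k * p d n             ≡⟨ cong (_* p d n) (^-distribʳ-* k 8 n) ⟨
    (8 * n) ^ k * p d n               ∎
    where
    m²≤8M : s * s ≤ 8 * suc M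
    m²≤8M = ℕ.≤-trans (ℕ.+-cancelʳ-≤ (8 * k) (s * s) (8 * M) (ℕ.≤-trans m²+8k≤8P (ℕ.≤-reflexive
      (trans (cong (8 *_) (sym k+M≡P)) (trans (ℕ.*-distribˡ-+ 8 k M) (ℕ.+-comm (8 * k) (8 * M))))))) (ℕ.*-monoʳ-≤ 8 (ℕ.n≤1+n M))
    k!≤ : k ! ≤ n ^ k
    k!≤ = ℕ.≤-trans (ℕ.≤-trans (ℕ.≤-reflexive (sym (trans (cong (k ! *_) (nCn≡1 k)) (ℕ.*-identityʳ (k !))))) (k!*C≤^ k k))
      (ℕ.^-monoˡ-≤ k (ℕ.≤-trans (ℕ.m≤n+m k s) (ℕ.n≤1+n _)))
    C≤p : (k + M) C k ≤ p d n
    C≤p = subst (λ z → z C k ≤ p d n) (sym k+M≡P) (ℕ.≤-trans (C-C2≤p s k) (p-mono-dim n m≤d))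
[m*m]^k≤ d (suc zero) k m≤d (s≤s ())
[m*m]^k≤ d zero       k m≤d ()

-- log 2 ≥ 1/2, the value of 1/x at the right end of [1,2], so 2B doublings suffice to reach B.
ln-large : ∀ B n → 2 ^ (2 * B) ≤ n → const (fromℕ B) ≲ ln n
ln-large B n h = ≲-trans half (≲-trans (fromℕ≥0 (2 * B) ⊡ ln2) (≲-trans (ln-^-≥ 2 (2 * B)) (ln-mono h)))
  where
  open +-*-Solver
  ln2 : const (inv 1) ≲ ln 2
  ln2 = by (ln-nonNeg 1 ⊞ ln-suc-≥ 0) λ j → solve 3 (λ i a b → i :+ (a :+ b) := b :+ (con 0ℚ :+ (a :+ i))) refl (inv 1) (ln 1 j) (ln 2 j)
  half : const (fromℕ B) ≲ fromℕ (2 * B) ∙ const (inv 1)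
  half = const-mono {fromℕ B} {fromℕ (2 * B) ℚ.* inv 1} (ℚ.≤-reflexive (sym (trans (cong (ℚ._* inv 1) {fromℕ (2 * B)} {fromℕ 2 ℚ.* fromℕ B} (fromℕ-* 2 B))
    (trans (solve 3 (λ t b i → t :* b :* i := b :* (t :* i)) refl (fromℕ 2) (fromℕ B) (inv 1))
      (trans (cong (fromℕ B ℚ.*_) (suc*inv 1)) (ℚ.*-identityʳ (fromℕ B)))))))

const-cancel : ∀ a b → const (fromℕ a) ≲ const (fromℕ b) → a ≤ b
const-cancel a b h with N , f ← upTo-ε h ℚ.½ (ℚ.positive⁻¹ ℚ.½) = ℕ.≤-pred (fromℕ-cancel-< {a} {suc b}
  (ℚ.≤-<-trans (f N ℕ.≤-refl) (subst (fromℕ b ℚ.+ ℚ.½ ℚ.<_) (trans (ℚ.+-comm (fromℕ b) 1ℚ) (sym (fromℕ-+ 1 b)))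
    (ℚ.+-monoʳ-< (fromℕ b) ½<1))))
  where
  ½<1 : ℚ.½ ℚ.< 1ℚ
  ½<1 = ℚ.*<* (ℤ.+<+ (s≤s (s≤s z≤n)))

ln8≲ : ∀ n .{{_ : NonZero n}} → ln (8 * n) ≲ const (fromℕ 7) ⊹ ln n
ln8≲ n = ≲-trans (ln-*-≤ 8 n) (ln-≤ 7 ⊞ pointwise {ln n} {ln n} λ _ → ℚ.≤-refl)

module _ (d m k κ : ℕ) .{{_ : NonZero d}} .{{_ : NonZero m}} (m≤d : m ≤ d) (3≤κ : 3 ≤ κ) where
  private
    n = suc (m + k)
    K = suc κ
    e = inv κ
    P = p d n
    c₀ = fromℕ (2 * K)

  -- The first hypothesis limits the points spent on 0 and the units, the second keeps log m close
  -- to log n. In `large`, 8K+15 exceeds 4 `c₀` + 14 = 8K+14 by one, for the contradiction in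
  -- `8n≤m²`, and dominates 2 `c₀` + 7 in `c₁≲`; the factor K cancels against e = 1/K.
  module _ (Km≤2n : K * suc m ≤ 2 * n)
           (ln-m : ln n ≲ ln m ⊹ (e ∙ ln n ⊹ const c₀))
           (large : const (fromℕ (K * (8 * K + 15))) ≲ ln n) where
    private
      open +-*-Solver

      e≤¼ : fromℕ 4 ℚ.* e ℚ.≤ 1ℚ
      e≤¼ = ℚ.≤-trans (ℚ.*-monoˡ-≤-nonNeg (fromℕ 4) (inv-anti 3≤κ)) (ℚ.≤-reflexive (suc*inv 3))

      0≤- : ∀ {q r} → q ℚ.≤ r → 0ℚ ℚ.≤ r ℚ.- q
      0≤- {q} {r} h = subst (ℚ._≤ r ℚ.- q) (ℚ.+-inverseʳ q) (ℚ.+-monoˡ-≤ (ℚ.- q) h)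

      -- Otherwise 2 log m ≤ 7 + log n. Inserted into four times `ln-m`, with 4e ≤ 1 from κ ≥ 3,
      -- this gives log n ≤ 4 `c₀` + 14, against `large`.
      8n≤m² : 8 * n ≤ m * m
      8n≤m² with 8 * n ℕ.≤? m * m
      ... | yes h = h
      ... | no ¬h = ⊥-elim (ℕ.1+n≰n (ℕ.+-cancelˡ-≤ (8 * K) 15 14 (const-cancel (8 * K + 15) (8 * K + 14) (≲-trans (const-mono {fromℕ (8 * K + 15)} (fromℕ-mono-≤ (ℕ.m≤n*m (8 * K + 15) K)))
                (≲-trans large (≲-trans small (const-mono {fromℕ 4 ℚ.* c₀ ℚ.+ fromℕ 14} {fromℕ (8 * K + 14)} (ℚ.≤-reflexive c₀≡))))))))
        where
        2ln-m : ln m ⊹ ln m ≲ const (fromℕ 7) ⊹ ln n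
        2ln-m = ≲-trans (ln-*-≥ m m) (≲-trans (ln-mono (ℕ.<⇒≤ (ℕ.≰⇒> ¬h))) (ln8≲ n))
        small : ln n ≲ const (fromℕ 4 ℚ.* c₀ ℚ.+ fromℕ 14)
        small = by (fromℕ≥0 4 ⊡ ln-m ⊞ fromℕ≥0 2 ⊡ 2ln-m ⊞ 0≤- e≤¼ ⊡ ln-nonNeg n)
          λ j → solve 4 (λ L l e c → L :+ (con (fromℕ 4) :* (l :+ (e :* L :+ c)) :+ (con (fromℕ 2) :* (con (fromℕ 7) :+ L) :+ (con 1ℚ :- con (fromℕ 4) :* e) :* L))
              := (con (fromℕ 4) :* c :+ con (fromℕ 14)) :+ (con (fromℕ 4) :* L :+ (con (fromℕ 2) :* (l :+ l) :+ (con 1ℚ :- con (fromℕ 4) :* e) :* con 0ℚ)))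
              refl (ln n j) (ln m j) e c₀
        c₀≡ : fromℕ 4 ℚ.* c₀ ℚ.+ fromℕ 14 ≡ fromℕ (8 * K + 14)
        c₀≡ = sym (trans (fromℕ-+ (8 * K) 14) (cong (ℚ._+ fromℕ 14) (trans (cong fromℕ {8 * K} {4 * (2 * K)} (ℕ.*-assoc 4 2 K)) (fromℕ-* 4 (2 * K)))))

      pairs : fromℕ k ∙ (ln m ⊹ ln m) ≲ fromℕ k ∙ (const (fromℕ 7) ⊹ ln n) ⊹ ln P
      pairs = ≲-trans (fromℕ≥0 k ⊡ ln-*-≥ m m) (≲-trans (ln-^-≥ (m * m) k {{ℕ.m*n≢0 m m}}) (≲-trans (ln-mono ([m*m]^k≤ d m k m≤d 8n≤m²))
        (≲-trans (ln-*-≤ ((8 * n) ^ k) P {{ℕ.m^n≢0 (8 * n) k}} {{p≢0 d n}})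
          (≲-trans (ln-^-≤ (8 * n) k) (fromℕ≥0 k ⊡ ln8≲ n) ⊞ pointwise {ln P} {ln P} λ _ → ℚ.≤-refl))))

      e*K* : ∀ q → e ℚ.* (fromℕ K ℚ.* q) ≡ q
      e*K* q = trans (sym (ℚ.*-assoc e (fromℕ K) q)) (trans (cong (ℚ._* q) (trans (ℚ.*-comm e (fromℕ K)) (suc*inv κ))) (ℚ.*-identityˡ q))

      c₁≲ : const (fromℕ 2 ℚ.* c₀ ℚ.+ fromℕ 7) ≲ e ∙ ln n
      c₁≲ = ≲-trans (const-mono {fromℕ 2 ℚ.* c₀ ℚ.+ fromℕ 7} {e ℚ.* fromℕ (K * (8 * K + 15))} c₁≤) (inv-nonNeg κ ⊡ large)
        where
        bound : 2 * (2 * K) + 7 ≤ 8 * K + 15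
        bound = ℕ.+-mono-≤ (ℕ.≤-trans (ℕ.≤-reflexive (sym (ℕ.*-assoc 2 2 K))) (ℕ.*-monoˡ-≤ K {4} {8} (ℕ.m≤m+n 4 4))) (ℕ.m≤m+n 7 8)
        c₁≤ : fromℕ 2 ℚ.* c₀ ℚ.+ fromℕ 7 ℚ.≤ e ℚ.* fromℕ (K * (8 * K + 15))
        c₁≤ = subst₂ ℚ._≤_ (trans (fromℕ-+ (2 * (2 * K)) 7) (cong (ℚ._+ fromℕ 7) (fromℕ-* 2 (2 * K))))
          (sym (trans (cong (e ℚ.*_) (fromℕ-* K (8 * K + 15))) (e*K* (fromℕ (8 * K + 15))))) (fromℕ-mono-≤ bound)

      u = fromℕ (suc m)

      u≤ : u ℚ.≤ e ℚ.* (fromℕ 2 ℚ.* fromℕ n)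
      u≤ = subst₂ ℚ._≤_ (trans (cong (e ℚ.*_) (fromℕ-* K (suc m))) (e*K* u)) (cong (e ℚ.*_) (fromℕ-* 2 n))
        (ℚ.*-monoˡ-≤-nonNeg e {{ℚ.nonNegative (inv-nonNeg κ)}} (fromℕ-mono-≤ Km≤2n))

      eu≥0 : 0ℚ ℚ.≤ (fromℕ 3 ℚ.* e) ℚ.* u
      eu≥0 = 0≤* (0≤* (fromℕ≥0 3) (inv-nonNeg κ)) (fromℕ≥0 (suc m))
        where
        0≤* : ∀ {q r} → 0ℚ ℚ.≤ q → 0ℚ ℚ.≤ r → 0ℚ ℚ.≤ q ℚ.* r
        0≤* {q} {r} hq hr = subst (ℚ._≤ q ℚ.* r) (ℚ.*-zeroʳ q) (ℚ.*-monoˡ-≤-nonNeg q {{ℚ.nonNegative hq}} hr)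

    -- The 5 is 2 + 1 + 2: `ln-m` is used twice per chosen sum, the constant 2 `c₀` + 7 is at most e
    -- log n, and the m+1 points 0 and units are at most 2en in number.
    estimate-d-≥ : fromℕ n ∙ ln n ≲ ln P ⊹ (fromℕ 5 ℚ.* e ℚ.* fromℕ n) ∙ ln n
    estimate-d-≥ = by (pairs ⊞ fromℕ≥0 k ⊡ fromℕ≥0 2 ⊡ ln-m ⊞ fromℕ≥0 k ⊡ c₁≲ ⊞ 0≤- u≤ ⊡ ln-nonNeg n ⊞ eu≥0 ⊡ ln-nonNeg n)
      λ j → identity (fromℕ-+ (suc m) k) (ln n j) (ln m j) (ln P j)
      where
      identity : ∀ {N} → N ≡ u ℚ.+ fromℕ k → ∀ L l x →
        N ℚ.* L ℚ.+ (fromℕ k ℚ.* (fromℕ 7 ℚ.+ L) ℚ.+ x ℚ.+ (fromℕ k ℚ.* (fromℕ 2 ℚ.* (l ℚ.+ (e ℚ.* L ℚ.+ c₀))) ℚ.+ (fromℕ k ℚ.* (e ℚ.* L)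
           ℚ.+ ((e ℚ.* (fromℕ 2 ℚ.* N) ℚ.- u) ℚ.* L ℚ.+ fromℕ 3 ℚ.* e ℚ.* u ℚ.* L))))
        ≡ x ℚ.+ fromℕ 5 ℚ.* e ℚ.* N ℚ.* L ℚ.+ (fromℕ k ℚ.* (l ℚ.+ l) ℚ.+ (fromℕ k ℚ.* (fromℕ 2 ℚ.* L) ℚ.+ (fromℕ k ℚ.* (fromℕ 2 ℚ.* c₀ ℚ.+ fromℕ 7)
           ℚ.+ ((e ℚ.* (fromℕ 2 ℚ.* N) ℚ.- u) ℚ.* 0ℚ ℚ.+ fromℕ 3 ℚ.* e ℚ.* u ℚ.* 0ℚ))))
      identity refl L l x = solve 7 (λ u k e c L l x →
        (u :+ k) :* L :+ (k :* (con (fromℕ 7) :+ L) :+ x :+ (k :* (con (fromℕ 2) :* (l :+ (e :* L :+ c))) :+ (k :* (e :* L)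
           :+ ((e :* (con (fromℕ 2) :* (u :+ k)) :- u) :* L :+ con (fromℕ 3) :* e :* u :* L))))
        := x :+ con (fromℕ 5) :* e :* (u :+ k) :* L :+ (k :* (l :+ l) :+ (k :* (con (fromℕ 2) :* L) :+ (k :* (con (fromℕ 2) :* c :+ con (fromℕ 7))
           :+ ((e :* (con (fromℕ 2) :* (u :+ k)) :- u) :* con 0ℚ :+ con (fromℕ 3) :* e :* u :* con 0ℚ))))) refl
        u (fromℕ k) e c₀ L l x

-- With m = min(d, n/K), `ln-m` holds in either case: for m = d by the hypothesis on d, at the cost
-- of e log n, and for m = n/K because n ≤ 2K(n/K) even after rounding down, at the cost of log(2K)
-- ≤ 2K.
estimate-d-≥′ : ∀ d n κ .{{_ : NonZero d}} → 3 ≤ κ → suc κ ≤ n → ln n ≲ ln d ⊹ inv κ ∙ ln n →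
  const (fromℕ (suc κ * (8 * suc κ + 15))) ≲ ln n → fromℕ n ∙ ln n ≲ ln (p d n) ⊹ (fromℕ 5 ℚ.* inv κ ℚ.* fromℕ n) ∙ ln n
estimate-d-≥′ d n κ 3≤κ K≤n ln-d large = go (ℕ.m≤n⇒∃[o]m+o≡n m<n) ln-m Km≤2n large
  where
  open +-*-Solver
  K = suc κ
  q = n ℕ./ K
  m = d ℕ.⊓ q
  instance
    q≢0 : NonZero q
    q≢0 = ℕ.>-nonZero (m≥n⇒m/n>0 K≤n)
    m≢0 : NonZero m
    m≢0 = ℕ.>-nonZero (ℕ.⊓-glb (ℕ.>-nonZero⁻¹ d) (ℕ.>-nonZero⁻¹ q))
  mK≤n : m * K ≤ n
  mK≤n = ℕ.≤-trans (ℕ.*-monoˡ-≤ K (ℕ.m⊓n≤n d q)) (m/n*n≤m n K)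
  m<n : m < n
  m<n = ℕ.<-≤-trans (ℕ.m<m*n m K (s≤s (ℕ.≤-trans (s≤s z≤n) 3≤κ))) mK≤n
  Km≤2n : K * suc m ≤ 2 * n
  Km≤2n = ℕ.≤-trans (ℕ.≤-reflexive (eq K m)) (ℕ.≤-trans (ℕ.+-mono-≤ K≤n mK≤n) (ℕ.≤-reflexive (eq′ n)))
    where
    eq : ∀ K m → K * suc m ≡ K + m * K
    eq = solve-∀
    eq′ : ∀ n → n + n ≡ 2 * n
    eq′ = solve-∀
  n≤2Kq : n ≤ 2 * K * q
  n≤2Kq = ℕ.≤-trans (ℕ.≤-reflexive (m≡m%n+[m/n]*n n K)) (ℕ.≤-trans
    (ℕ.+-monoˡ-≤ (q * K) (ℕ.≤-trans (ℕ.<⇒≤ (m%n<n n K)) (ℕ.m≤n*m K q))) (ℕ.≤-reflexive (eq q K)))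
    where
    eq : ∀ q K → q * K + q * K ≡ 2 * K * q
    eq = solve-∀
  ln-q : ln n ≲ const (fromℕ (2 * K)) ⊹ ln q
  ln-q = ≲-trans (ln-mono n≤2Kq) (≲-trans (ln-*-≤ (2 * K) q)
    (≲-trans (ln-≤ (κ + 1 * suc κ)) (const-mono {fromℕ (κ + 1 * suc κ)} (fromℕ-mono-≤ (ℕ.n≤1+n (κ + 1 * suc κ)))) ⊞ pointwise {ln q} {ln q} λ _ → ℚ.≤-refl))
  ln-m : ln n ≲ ln m ⊹ (inv κ ∙ ln n ⊹ const (fromℕ (2 * K)))
  ln-m with ℕ.⊓-sel d q
  ... | inj₁ e = subst (λ m → ln n ≲ ln m ⊹ (inv κ ∙ ln n ⊹ const (fromℕ (2 * K)))) {d} {m} (sym e)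
    (by (ln-d ⊞ const-mono {0ℚ} {fromℕ (2 * K)} (fromℕ≥0 (2 * K))) λ j →
      solve 4 (λ L d i c → L :+ ((d :+ i :* L) :+ c) := (d :+ (i :* L :+ c)) :+ (L :+ con 0ℚ)) refl (ln n j) (ln d j) (inv κ) (fromℕ (2 * K)))
  ... | inj₂ e = subst (λ m → ln n ≲ ln m ⊹ (inv κ ∙ ln n ⊹ const (fromℕ (2 * K)))) {q} {m} (sym e)
    (by (ln-q ⊞ inv-nonNeg κ ⊡ ln-nonNeg n) λ j →
      solve 4 (λ L q i c → L :+ ((c :+ q) :+ i :* L) := (q :+ (i :* L :+ c)) :+ (L :+ i :* con 0ℚ)) refl (ln n j) (ln q j) (inv κ) (fromℕ (2 * K)))
  go : ∀ {n} → (∃ λ k → suc m + k ≡ n) → ln n ≲ ln m ⊹ (inv κ ∙ ln n ⊹ const (fromℕ (2 * K))) → K * suc m ≤ 2 * n →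
    const (fromℕ (K * (8 * K + 15))) ≲ ln n → fromℕ n ∙ ln n ≲ ln (p d n) ⊹ (fromℕ 5 ℚ.* inv κ ℚ.* fromℕ n) ∙ ln n
  go (k , refl) ln-m Km≤2n large = estimate-d-≥ d m k κ (ℕ.m⊓n≤m d q) 3≤κ Km≤2n ln-m large

-- From real hypotheses to inequalities between natural numbers

fromℕ≤/⇒*≤ : ∀ K {d s} .{{_ : NonZero s}} → fromℕ K ℚ.≤ + d / s → K * s ≤ d
fromℕ≤/⇒*≤ K {d} {s} h = fromℕ-cancel-≤ {K * s} {d} (subst₂ ℚ._≤_ (sym (fromℕ-* K s)) (/-cancel d s)
  (ℚ.*-monoʳ-≤-nonNeg (fromℕ s) {{fromℕ-nonNeg s}} h))

/≤1⇒≤ : ∀ {d s} .{{_ : NonZero s}} → + d / s ℚ.≤ 1ℚ → d ≤ s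
/≤1⇒≤ {d} {s} h = fromℕ-cancel-≤ {d} {s} (subst₂ ℚ._≤_ (/-cancel d s) (ℚ.*-identityˡ (fromℕ s))
  (ℚ.*-monoʳ-≤-nonNeg (fromℕ s) {{fromℕ-nonNeg s}} h))

^2≡* : ∀ n → n ^ 2 ≡ n * n
^2≡* n = cong (n *_) (ℕ.*-identityʳ n)

≤-fromℕ : ∀ q → ∃ λ B → q ℚ.≤ fromℕ B
≤-fromℕ q@(ℚ.mkℚ (+ a) b _) = a , ℚ.toℚᵘ-cancel-≤ (ℚᵘ.≤-respʳ-≃ (ℚᵘ.≃-sym (ℚ.toℚᵘ-fromℚᵘ (ℚᵘ.mkℚᵘ (+ a) 0)))
  (ℚᵘ.*≤* (ℤ.*-monoˡ-≤-nonNeg (+ a) (ℤ.+≤+ (s≤s z≤n)))))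
≤-fromℕ q@(ℚ.mkℚ ℤ.-[1+ a ] b _) = 0 , ℚ.*≤* ℤ.-≤+

inv>0 : ∀ κ → 0ℚ ℚ.< inv κ
inv>0 κ = ℚ.positive⁻¹ (inv κ) {{ℚ.normalize-pos 1 (suc κ)}}

mulPos : ∀ {q r} → 0ℚ ℚ.< q → 0ℚ ℚ.< r → 0ℚ ℚ.< q ℚ.* r
mulPos {q} {r} hq hr = subst (ℚ._< q ℚ.* r) (ℚ.*-zeroʳ q) (ℚ.*-monoʳ-<-pos q {{ℚ.positive hq}} hr)

estimate-c : ∀ d m K .{{_ : NonZero d}} .{{_ : NonZero K}} → suc m * suc m ≤ K * d → d ≤ K * (suc m * suc m) →
  (λ j → ℚ.∣ (ln (p d (suc m)) ⊝ fromℕ (suc m) ∙ ln (suc m)) j ∣) ≲ const (fromℕ ((2 + K) * suc m))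
estimate-c d m K h₁ h₂ = ∣∣-≲
  (by (estimate-c-≤ d m K h₂) λ j → solve 3 (λ x y s → (x :- y) :+ (y :+ s) := s :+ x) refl (ln P j) (fromℕ n ℚ.* ln n j) S)
  (by (estimate-c-≥ d m K h₁) λ j → solve 3 (λ x y s → (:- (x :- y)) :+ (x :+ s) := s :+ y) refl (ln P j) (fromℕ n ℚ.* ln n j) S)
  where
  open +-*-Solver
  n = suc m
  P = p d n
  S = fromℕ ((2 + K) * n)

-- K is chosen before d and n. From 1/(κ+1) ≤ δ and tolerance 1 comes n² ≤ (κ+1)(d+1), and d + 1 ≤
-- 2d explains the factor 2.
n²≤K*d : ∀ (c : ℝ) → fromℚ 0ℚ <ᴿ c →
  ∃ λ K → ∀ d n → .{{NonZero d}} → fromℕ (n ^ 2) · c ≤ᴿ fromℚ (fromℕ d) → n * n ≤ K * d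
n²≤K*d c (δ , δ>0 , N₁ , f) = suc κ * 2 , bound
  where
  κ = proj₁ (inv-small 0 δ δ>0)
  bound : ∀ d n → .{{NonZero d}} → fromℕ (n ^ 2) · c ≤ᴿ fromℚ (fromℕ d) → n * n ≤ suc κ * 2 * d
  bound (suc D) n h = subst (_≤ suc κ * 2 * suc D) (^2≡* n) (fromℕ-cancel-≤ {n ^ 2} {suc κ * 2 * suc D}
      (subst (ℚ._≤ fromℕ (suc κ * 2 * suc D)) (trans (ℚ.*-assoc s (inv κ) (fromℕ (suc κ)))
          (trans (cong (s ℚ.*_) (/-cancel 1 (suc κ))) (ℚ.*-identityʳ s)))
        (ℚ.≤-trans (ℚ.*-monoʳ-≤-nonNeg (fromℕ (suc κ)) {{fromℕ-nonNeg (suc κ)}}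
            (ℚ.≤-trans (ℚ.*-monoˡ-≤-nonNeg s {{fromℕ-nonNeg (n ^ 2)}} invκ≤) (proj₂ (h 1ℚ 1>0) j (ℕ.m≤n⊔m N₁ _))))
          (ℚ.≤-trans (ℚ.≤-reflexive (trans (cong (ℚ._* fromℕ (suc κ)) (sym (fromℕ-+ (suc D) 1))) (sym (fromℕ-* (suc D + 1) (suc κ)))))
            (fromℕ-mono-≤ ineq)))))
    where
    s = fromℕ (n ^ 2)
    1>0 : 0ℚ ℚ.< 1ℚ
    1>0 = ℚ.positive⁻¹ 1ℚ
    j = N₁ ℕ.⊔ proj₁ (h 1ℚ 1>0)
    invκ≤ : inv κ ℚ.≤ seq c j
    invκ≤ = ℚ.≤-trans (proj₂ (inv-small 0 δ δ>0)) (subst (ℚ._≤ seq c j) (ℚ.+-identityˡ δ) (f j (ℕ.m≤m⊔n N₁ _)))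
    ineq : (suc D + 1) * suc κ ≤ suc κ * 2 * suc D
    ineq = subst ((suc D + 1) * suc κ ≤_) (eq D κ) (ℕ.m≤m+n _ (D * suc κ))
      where
      eq : ∀ D κ → (suc D + 1) * suc κ + D * suc κ ≡ suc κ * 2 * suc D
      eq = solve-∀

-- B bounds all late terms of c by the Cauchy property; one further n² absorbs the tolerance 1.
d≤K*n² : ∀ (c : ℝ) → ∃ λ K → ∀ d n → .{{NonZero n}} → fromℚ (fromℕ d) ≤ᴿ fromℕ (n ^ 2) · c → d ≤ K * (n * n)
d≤K*n² c = suc B , bound
  where
  1>0 : 0ℚ ℚ.< 1ℚ
  1>0 = ℚ.positive⁻¹ 1ℚ
  N₁ = proj₁ (cauchy c 1ℚ 1>0)
  B = proj₁ (≤-fromℕ (seq c N₁ ℚ.+ 1ℚ))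
  bound : ∀ d n → .{{NonZero n}} → fromℚ (fromℕ d) ≤ᴿ fromℕ (n ^ 2) · c → d ≤ suc B * (n * n)
  bound d n h = subst (λ s → d ≤ suc B * s) (^2≡* n) (fromℕ-cancel-≤ {d} {suc B * n ^ 2} (ℚ.≤-trans (proj₂ (h 1ℚ 1>0) j (ℕ.m≤n⊔m N₁ _))
      (ℚ.≤-trans (ℚ.+-monoˡ-≤ 1ℚ (ℚ.*-monoˡ-≤-nonNeg s {{fromℕ-nonNeg (n ^ 2)}} c≤))
        (ℚ.≤-trans (ℚ.≤-reflexive (trans (cong (ℚ._+ 1ℚ) (sym (fromℕ-* (n ^ 2) B))) (sym (fromℕ-+ (n ^ 2 * B) 1))))
          (fromℕ-mono-≤ ineq)))))
    where
    s = fromℕ (n ^ 2)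
    j = N₁ ℕ.⊔ proj₁ (h 1ℚ 1>0)
    c≤ : seq c j ℚ.≤ fromℕ B
    c≤ = ℚ.≤-trans (subst (ℚ._≤ seq c N₁ ℚ.+ 1ℚ) (solve 2 (λ a b → b :+ (a :- b) := a) refl (seq c j) (seq c N₁))
        (ℚ.+-monoʳ-≤ (seq c N₁) (ℚ.≤-trans (≤∣∣ (seq c j ℚ.- seq c N₁)) (proj₂ (cauchy c 1ℚ 1>0) j N₁ (ℕ.m≤m⊔n N₁ _) ℕ.≤-refl))))
      (proj₂ (≤-fromℕ (seq c N₁ ℚ.+ 1ℚ)))
      where open +-*-Solver
    ineq : n ^ 2 * B + 1 ≤ suc B * n ^ 2
    ineq = ℕ.≤-trans (ℕ.+-monoʳ-≤ (n ^ 2 * B) (ℕ.>-nonZero⁻¹ (n ^ 2) {{ℕ.m^n≢0 n 2}})) (ℕ.≤-reflexive (eq (n ^ 2) B))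
      where
      eq : ∀ s B → s * B + s ≡ suc B * s
      eq = solve-∀

opaque
  unfolding ln

  ln-nonNeg-at : ∀ k j → 0ℚ ℚ.≤ ln k j
  ln-nonNeg-at k j = logSum-nonNeg k (suc j)

  ≲⇒≤ᴿ-b : ∀ P D n .{{_ : NonZero P}} .{{_ : NonZero D}} .{{_ : NonZero n}} q (y : ℝ) →
    (λ j → ℚ.∣ (ln P ⊝ q ∙ (ln D ⊝ ln n ⊹ const 1ℚ)) j ∣) ≲ seq y → ∣ log P -ᴿ q · (log D -ᴿ log n +ᴿ fromℚ 1ℚ) ∣ᴿ ≤ᴿ y
  ≲⇒≤ᴿ-b P D n q y h = upTo-ε h

  ≲⇒≤ᴿ-c : ∀ P n .{{_ : NonZero P}} .{{_ : NonZero n}} q (y : ℝ) →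
    (λ j → ℚ.∣ (ln P ⊝ q ∙ ln n) j ∣) ≲ seq y → ∣ log P -ᴿ q · log n ∣ᴿ ≤ᴿ y
  ≲⇒≤ᴿ-c P n q y h = upTo-ε h

  ≲⇒≤ᴿ-d : ∀ P n .{{_ : NonZero P}} .{{_ : NonZero n}} q ε →
    (λ j → ℚ.∣ (ln P ⊝ q ∙ ln n) j ∣) ≲ (λ j → ε ℚ.* ℚ.∣ q ℚ.* ln n j ∣) → ∣ log P -ᴿ q · log n ∣ᴿ ≤ᴿ ε · ∣ q · log n ∣ᴿ
  ≲⇒≤ᴿ-d P n q ε h = upTo-ε h

  ≤ᴿ⇒≲-d : ∀ n D .{{_ : NonZero n}} .{{_ : NonZero D}} (e : ℝ) ε → ∣ e ∣ᴿ ≤ᴿ ε · ∣ log n ∣ᴿ → log n +ᴿ e ≤ᴿ log D →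
    ((λ j → ℚ.∣ seq e j ∣) ≲ λ j → ε ℚ.* ℚ.∣ ln n j ∣) × (ln n ⊹ seq e ≲ ln D)
  ≤ᴿ⇒≲-d n D e ε h k = record { upTo-ε = h } , record { upTo-ε = k }

ln-d-≥ : ∀ n D (e : ℕ → ℚ) ε → (λ j → ℚ.∣ e j ∣) ≲ (λ j → ε ℚ.* ℚ.∣ ln n j ∣) → ln n ⊹ e ≲ ln D → ln n ≲ ln D ⊹ ε ∙ ln n
ln-d-≥ n D e ε h k = ≲-trans (pointwise {y = (λ j → ℚ.∣ e j ∣) ⊹ (ln n ⊹ e)} abs) (≲-trans (h ⊞ k) (pointwise λ j → ℚ.≤-reflexive
    (trans (cong (λ z → ε ℚ.* z ℚ.+ ln D j) (ℚ.0≤p⇒∣p∣≡p (ln-nonNeg-at n j))) (ℚ.+-comm (ε ℚ.* ln n j) (ln D j)))))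
  where
  open +-*-Solver
  abs : ∀ j → ln n j ℚ.≤ ℚ.∣ e j ∣ ℚ.+ (ln n j ℚ.+ e j)
  abs j = subst₂ ℚ._≤_ (solve 2 (λ L e → (:- e) :+ (L :+ e) := L) refl (ln n j) (e j)) refl
    (ℚ.+-monoˡ-≤ (ln n j ℚ.+ e j) (subst (ℚ.- e j ℚ.≤_) (ℚ.∣-p∣≡∣p∣ (e j)) (≤∣∣ (ℚ.- e j))))

-- From above, d ≤ n² permits `estimate-c-≤` with constant 1, whose error 3n is at most e n log n
-- since log n ≥ 3(κ+1). From below, `estimate-d-≥′` loses 5e n log n.
estimate-d : ∀ d m κ δ .{{_ : NonZero d}} → 3 ≤ κ → suc κ ≤ suc m → 0ℚ ℚ.≤ δ → fromℕ 5 ℚ.* inv κ ℚ.≤ δ → d ≤ suc m * suc m →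
  ln (suc m) ≲ ln d ⊹ inv κ ∙ ln (suc m) → const (fromℕ (suc κ * (8 * suc κ + 15))) ≲ ln (suc m) →
  (λ j → ℚ.∣ (ln (p d (suc m)) ⊝ fromℕ (suc m) ∙ ln (suc m)) j ∣) ≲ (λ j → δ ℚ.* ℚ.∣ fromℕ (suc m) ℚ.* ln (suc m) j ∣)
estimate-d d m κ δ 3≤κ K≤n δ≥0 5e≤δ d≤n² ln-d large = ∣∣-≲
  (≲-trans (by (estimate-c-≤ d m 1 (subst (d ≤_) (sym (ℕ.*-identityˡ (n * n))) d≤n²) ⊞ fromℕ≥0 n ⊡ 3≲)
      λ j → trans (cong (λ s → (ln P j ℚ.- N ℚ.* ln n j) ℚ.+ (N ℚ.* ln n j ℚ.+ s ℚ.+ N ℚ.* (e ℚ.* ln n j))) (fromℕ-* 3 n))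
        (solve 5 (λ x N L e t → (x :- N :* L) :+ (N :* L :+ t :* N :+ N :* (e :* L)) := e :* (N :* L) :+ (x :+ N :* t)) refl
          (ln P j) N (ln n j) e (fromℕ 3)))
    (pointwise {x = λ j → e ℚ.* (N ℚ.* ln n j)} λ j → dominated (ℚ.≤-trans e≤5e 5e≤δ) j))
  (≲-trans (by (estimate-d-≥′ d n κ 3≤κ K≤n ln-d large)
      λ j → solve 4 (λ x N L f → (:- (x :- N :* L)) :+ (x :+ f :* N :* L) := f :* (N :* L) :+ N :* L) refl (ln P j) N (ln n j) (fromℕ 5 ℚ.* e))
    (pointwise {x = λ j → fromℕ 5 ℚ.* e ℚ.* (N ℚ.* ln n j)} λ j → dominated 5e≤δ j))
  where
  open +-*-Solver
  n = suc m
  N = fromℕ n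
  P = p d n
  K = suc κ
  e = inv κ
  3≲ : const (fromℕ 3) ≲ e ∙ ln n
  3≲ = ≲-trans (const-mono {fromℕ 3} {e ℚ.* fromℕ (K * 3)} (ℚ.≤-reflexive (sym (trans (cong (e ℚ.*_) (fromℕ-* K 3))
      (trans (sym (ℚ.*-assoc e (fromℕ K) (fromℕ 3))) (trans (cong (ℚ._* fromℕ 3) (/-cancel 1 K)) (ℚ.*-identityˡ (fromℕ 3))))))))
    (inv-nonNeg κ ⊡ ≲-trans (const-mono {fromℕ (K * 3)} (fromℕ-mono-≤ (ℕ.*-monoʳ-≤ K (ℕ.≤-trans (ℕ.m≤m+n 3 12) (ℕ.m≤n+m 15 (8 * K)))))) large)
  e≤5e : e ℚ.≤ fromℕ 5 ℚ.* e
  e≤5e = subst (ℚ._≤ fromℕ 5 ℚ.* e) (fromℕ1* e) (ℚ.*-monoʳ-≤-nonNeg e {{ℚ.nonNegative (inv-nonNeg κ)}} (fromℕ-mono-≤ {1} {5} (s≤s z≤n)))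
  dominated : ∀ {c} → c ℚ.≤ δ → ∀ j → c ℚ.* (N ℚ.* ln n j) ℚ.≤ δ ℚ.* ℚ.∣ N ℚ.* ln n j ∣
  dominated {c} c≤δ j = ℚ.≤-trans (ℚ.*-monoʳ-≤-nonNeg (N ℚ.* ln n j) {{ℚ.nonNegative NL≥0}} c≤δ)
    (ℚ.*-monoˡ-≤-nonNeg δ {{ℚ.nonNegative δ≥0}} (≤∣∣ (N ℚ.* ln n j)))
    where
    NL≥0 : 0ℚ ℚ.≤ N ℚ.* ln n j
    NL≥0 = subst (ℚ._≤ N ℚ.* ln n j) (ℚ.*-zeroʳ N) (ℚ.*-monoˡ-≤-nonNeg N {{fromℕ-nonNeg n}} (ln-nonNeg-at n j))

-- The asymptotic statements: choice of κ and of the thresholds for n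

module _ (d : Seq ℕ) {{d≢0 : ∀ {n} .{{_ : NonZero n}} → NonZero (d n)}} where

  theorem2-b : (d /n²) ⟶∞ →
    (λ n → log (p (d n) n) {{p≢0 (d n) n}} -ᴿ fromℕ (n ∸ 1) · (log (d n) -ᴿ log n +ᴿ fromℚ 1ℚ))
      ∈o (λ n → fromℚ (fromℕ n))
  theorem2-b h ε ε>0 = N ℕ.⊔ κ * suc κ , λ n n≥ → at (d n) n {{d≢0 {n}}}
      (subst (λ s → suc κ * s ≤ d n) (^2≡* n) (fromℕ≤/⇒*≤ (suc κ) {d n} {n ^ 2} {{ℕ.m^n≢0 n 2}} (f n (ℕ.m⊔n≤o⇒m≤o N _ n≥))))
      (ℕ.m⊔n≤o⇒n≤o N _ n≥)
    where
    -- The error in `estimate-b` is 2n/(κ+1), so 1/(κ+1) is taken at most ε/2.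
    κ = proj₁ (inv-small 0 (ε ℚ.* ℚ.½) (half-pos ε ε>0))
    2invκ≤ε : inv κ ℚ.+ inv κ ℚ.≤ ε
    2invκ≤ε = subst (inv κ ℚ.+ inv κ ℚ.≤_) (halve ε) (ℚ.+-mono-≤ small small)
      where small = proj₂ (inv-small 0 (ε ℚ.* ℚ.½) (half-pos ε ε>0))
    N = proj₁ (h (fromℕ (suc κ)))
    f = proj₂ (h (fromℕ (suc κ)))
    at : ∀ D n .{{_ : NonZero D}} .{{_ : NonZero n}} → suc κ * (n * n) ≤ D → κ * suc κ ≤ n →
      ∣ log (p D n) {{p≢0 D n}} -ᴿ fromℕ (n ∸ 1) · (log D -ᴿ log n +ᴿ fromℚ 1ℚ) ∣ᴿ ≤ᴿ ε · ∣ fromℚ (fromℕ n) ∣ᴿ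
    at D (suc m) h₁ h₂ = ≲⇒≤ᴿ-b (p D (suc m)) D (suc m) {{p≢0 D (suc m)}} (fromℕ m) (ε · ∣ fromℚ (fromℕ (suc m)) ∣ᴿ)
      (≲-trans (estimate-b D m κ h₁ h₂)
      (pointwise λ _ →
        (ℚ.≤-trans (ℚ.*-monoʳ-≤-nonNeg (fromℕ (suc m)) {{fromℕ-nonNeg (suc m)}} 2invκ≤ε)
          (ℚ.*-monoˡ-≤-nonNeg ε {{ℚ.nonNegative (ℚ.<⇒≤ ε>0)}} (≤∣∣ (fromℕ (suc m)))))))

  theorem2-c : (∃ λ (c₁ : ℝ) → ∃ λ (c₂ : ℝ) → fromℚ 0ℚ <ᴿ c₁ × fromℚ 0ℚ <ᴿ c₂ ×
      (∀ n .{{_ : NonZero n}} → fromℕ (n ^ 2) · c₁ ≤ᴿ fromℚ (fromℕ (d n)) × fromℚ (fromℕ (d n)) ≤ᴿ fromℕ (n ^ 2) · c₂)) →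
    (λ n → log (p (d n) n) {{p≢0 (d n) n}} -ᴿ fromℕ n · log n) ∈O (λ n → fromℚ (fromℕ n))
  theorem2-c (c₁ , c₂ , c₁>0 , _ , h) = fromℕ (2 + K) , 0 , λ n _ → at (d n) n {{d≢0 {n}}}
      (ℕ.≤-trans (proj₂ (n²≤K*d c₁ c₁>0) (d n) n {{d≢0 {n}}} (proj₁ (h n))) (ℕ.*-monoˡ-≤ (d n) (ℕ.m≤n⇒m≤1+n (ℕ.m≤m+n K₁ K₂))))
      (ℕ.≤-trans (proj₂ (d≤K*n² c₂) (d n) n (proj₂ (h n))) (ℕ.*-monoˡ-≤ (n * n) (ℕ.m≤n⇒m≤1+n (ℕ.m≤n+m K₂ K₁))))
    where
    K₁ = proj₁ (n²≤K*d c₁ c₁>0)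
    K₂ = proj₁ (d≤K*n² c₂)
    -- One constant for both sides; the successor makes it nonzero, as `estimate-c` asks.
    K = suc (K₁ + K₂)
    at : ∀ D n .{{_ : NonZero D}} .{{_ : NonZero n}} → n * n ≤ K * D → D ≤ K * (n * n) →
      ∣ log (p D n) {{p≢0 D n}} -ᴿ fromℕ n · log n ∣ᴿ ≤ᴿ fromℕ (2 + K) · ∣ fromℚ (fromℕ n) ∣ᴿ
    at D (suc m) h₁ h₂ = ≲⇒≤ᴿ-c (p D (suc m)) (suc m) {{p≢0 D (suc m)}} (fromℕ (suc m)) (fromℕ (2 + K) · ∣ fromℚ (fromℕ (suc m)) ∣ᴿ)
      (≲-trans (estimate-c D m K h₁ h₂) (pointwise λ _ → ℚ.≤-trans (ℚ.≤-reflexive (fromℕ-* (2 + K) (suc m)))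
        (ℚ.*-monoˡ-≤-nonNeg (fromℕ (2 + K)) {{fromℕ-nonNeg (2 + K)}} (≤∣∣ (fromℕ (suc m))))))

  theorem2-d : (d /n²) ⟶0 →
    (∃ λ (e : Seq ℝ) → e ∈o (λ n → log n) × Eventually (λ n → log n +ᴿ e n ≤ᴿ log (d n))) →
    (λ n → log (p (d n) n) {{p≢0 (d n) n}} -ᴿ fromℕ n · log n) ∈o (λ n → fromℕ n · log n)
  theorem2-d d/n²⟶0 (e , e∈o , N₁ , log-d) δ δ>0 = N₁ ℕ.⊔ (N₂ ℕ.⊔ (N₃ ℕ.⊔ (suc κ ℕ.⊔ 2 ^ (2 * B)))) , λ n n≥ →
      let n≥₁ = ℕ.m⊔n≤o⇒n≤o N₁ _ n≥ ; n≥₂ = ℕ.m⊔n≤o⇒n≤o N₂ _ n≥₁ ; n≥₃ = ℕ.m⊔n≤o⇒n≤o N₃ _ n≥₂ in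
      at (d n) n (e n) {{d≢0 {n}}}
        (subst (d n ≤_) (^2≡* n) (/≤1⇒≤ {d n} {n ^ 2} {{ℕ.m^n≢0 n 2}} (ℚ.≤-trans (≤∣∣ ((d /n²) n)) (proj₂ (d/n²⟶0 1ℚ 1>0) n (ℕ.m⊔n≤o⇒m≤o N₂ _ n≥₁)))))
        (proj₂ (e∈o (inv κ) (inv>0 κ)) n (ℕ.m⊔n≤o⇒m≤o N₃ _ n≥₂))
        (log-d n (ℕ.m⊔n≤o⇒m≤o N₁ _ n≥))
        (ℕ.m⊔n≤o⇒m≤o (suc κ) (2 ^ (2 * B)) n≥₃)
        (ℕ.m⊔n≤o⇒n≤o (suc κ) (2 ^ (2 * B)) n≥₃)
    where
    δ/5>0 : 0ℚ ℚ.< δ ℚ.* inv 4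
    δ/5>0 = mulPos δ>0 (inv>0 4)
    -- `inv 4` is 1/5, matching the loss 5/(κ+1) of the lower bound; the maximum with 3 provides
    -- 4/(κ+1) ≤ 1.
    κ₀ = proj₁ (inv-small 0 (δ ℚ.* inv 4) δ/5>0)
    κ = κ₀ ℕ.⊔ 3
    B = suc κ * (8 * suc κ + 15)
    1>0 : 0ℚ ℚ.< 1ℚ
    1>0 = ℚ.positive⁻¹ 1ℚ
    N₂ = proj₁ (d/n²⟶0 1ℚ 1>0)
    N₃ = proj₁ (e∈o (inv κ) (inv>0 κ))
    5e≤δ : fromℕ 5 ℚ.* inv κ ℚ.≤ δ
    5e≤δ = ℚ.≤-trans (ℚ.*-monoˡ-≤-nonNeg (fromℕ 5) {{fromℕ-nonNeg 5}} (ℚ.≤-trans (inv-anti {κ₀} {κ} (ℕ.m≤m⊔n κ₀ 3)) (proj₂ (inv-small 0 (δ ℚ.* inv 4) δ/5>0))))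
      (ℚ.≤-reflexive (trans (solve 3 (λ f d i → f :* (d :* i) := d :* (f :* i)) refl (fromℕ 5) δ (inv 4)) (trans (cong (δ ℚ.*_) (suc*inv 4)) (ℚ.*-identityʳ δ))))
      where open +-*-Solver
    at : ∀ D n (e : ℝ) .{{_ : NonZero D}} .{{_ : NonZero n}} → D ≤ n * n → ∣ e ∣ᴿ ≤ᴿ inv κ · ∣ log n ∣ᴿ → log n +ᴿ e ≤ᴿ log D →
      suc κ ≤ n → 2 ^ (2 * B) ≤ n → ∣ log (p D n) {{p≢0 D n}} -ᴿ fromℕ n · log n ∣ᴿ ≤ᴿ δ · ∣ fromℕ n · log n ∣ᴿ
    at D (suc m) e h₁ h₂ h₃ h₄ h₅ = ≲⇒≤ᴿ-d (p D (suc m)) (suc m) {{p≢0 D (suc m)}} (fromℕ (suc m)) δ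
      (estimate-d D m κ δ (ℕ.m≤n⊔m κ₀ 3) h₄ (ℚ.<⇒≤ δ>0) 5e≤δ h₁
        (ln-d-≥ (suc m) D (seq e) (inv κ) (proj₁ (≤ᴿ⇒≲-d (suc m) D e (inv κ) h₂ h₃)) (proj₂ (≤ᴿ⇒≲-d (suc m) D e (inv κ) h₂ h₃)))
        (ln-large B (suc m) h₅))

theorem2 : (d : Seq ℕ) {{d≢0 : ∀ {n} .{{_ : NonZero n}} → NonZero (d n)}} →
    (∀ n .{{_ : NonZero n}} → (n³/2<d : + (n ^ 3) / 2 ℚ.< fromℕ (d n)) →
    let ratio = (+ p (d n) n / ((d n ℕ.+ n ∸ 2) C (d n ∸ 1))) {{binom≢0 (d n) n}}
    in 1ℚ ℚ.≤ ratio × ratio ℚ.< (ℚ.1/ 1-n³/2d (d n) n) {{1-n³/2d≢0 (d n) n n³/2<d}})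
    ×
    ((d /n²) ⟶∞ →
    (λ n → log (p (d n) n) {{p≢0 (d n) n}} -ᴿ fromℕ (n ∸ 1) · (log (d n) -ᴿ log n +ᴿ fromℚ 1ℚ))
    ∈o (λ n → fromℚ (fromℕ n)))
    ×
    ((∃ λ (c₁ : ℝ) → ∃ λ (c₂ : ℝ) → fromℚ 0ℚ <ᴿ c₁ × fromℚ 0ℚ <ᴿ c₂ ×
    (∀ n .{{_ : NonZero n}} → fromℕ (n ^ 2) · c₁ ≤ᴿ fromℚ (fromℕ (d n)) × fromℚ (fromℕ (d n)) ≤ᴿ fromℕ (n ^ 2) · c₂)) →
    (λ n → log (p (d n) n) {{p≢0 (d n) n}} -ᴿ fromℕ n · log n) ∈O (λ n → fromℚ (fromℕ n)))
    ×
    ((d /n²) ⟶0 →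
    (∃ λ (e : Seq ℝ) → e ∈o (λ n → log n) × Eventually (λ n → log n +ᴿ e n ≤ᴿ log (d n))) →
    (λ n → log (p (d n) n) {{p≢0 (d n) n}} -ᴿ fromℕ n · log n) ∈o (λ n → fromℕ n · log n))
theorem2 d = (λ n → theorem2-a (d n) n) , theorem2-b d , theorem2-c d , theorem2-d d
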